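{- Let $\varepsilon>0$ be fixed. For any integer $S$ and large positive integer $m$, the set $$\{xy\pmod m:\ 1\le x\le m^{1/2},\ S+1\le y\le S+m^{1/2}(\log m)^{2+\varepsilon}\}$$ (with $x,y$ integers) contains $(1+O((\log m)^{ -\varepsilon}))\,m$ residue classes modulo $m$.
   Context: The asymptotic statement is for $m\to\infty$; the constant implied by $O$ may depend on $\varepsilon$ but is uniform in $m$ and $S$. -}

module Defs where

import Algebra.Definitions.RawSemiring as RawSemiring
open import Data.Fin.Base using (Fin; toℕ)
open import Data.Fin.Properties using (injective⇒≤)
open import Data.Integer.Base as ℤ using (ℤ; +_; 1ℤ)
import Data.Integer.Divisibility as ℤ
import Data.Integer.Properties as ℤ
open import Data.Nat.Base as ℕ using (ℕ; suc)
open import Data.Product.Base using (∃; ∃₂; _×_; _,_; proj₁; proj₂)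
open import Data.Rational.Base as ℚ using (ℚ; 0ℚ; 1ℚ)
import Data.Rational.Properties as ℚ
import Data.Rational.Unnormalised.Base as ℚᵘ
import Data.Rational.Unnormalised.Properties as ℚᵘ
open import Data.Sum.Base using (_⊎_)
open import Function.Base using (_∘_)
open import Function.Bundles using (_⇔_; mk⇔)
open import Function.Definitions using (Injective)
open import Relation.Binary.PropositionalEquality using (_≡_; cong; sym; trans)
open import Relation.Nullary.Negation using (¬_)

open RawSemiring ℚ.+-*-rawSemiring using () renaming (_^_ to _^ℚ_)

------------------------------------------------------------------------
-- Real numbers as two-sided Dedekind cuts in ℚ.  The operations below
-- act on arbitrary pairs of predicates, so that they can be written down
-- by their order characterisation; on pairs satisfying IsReal (and, for
-- logᴿ, _^ᴿ_ and √ᴿ, in the usual domain) they are the usual operations.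

record Cut : Set₁ where
  field
    lower : ℚ → Set    -- lower q  means  q < x
    upper : ℚ → Set    -- upper q  means  x < q

open Cut public

record IsReal (x : Cut) : Set where
  field
    lower-inhabited : ∃ (lower x)
    upper-inhabited : ∃ (upper x)
    lower-rounded   : ∀ q → lower x q ⇔ (∃ λ r → q ℚ.< r × lower x r)
    upper-rounded   : ∀ q → upper x q ⇔ (∃ λ r → r ℚ.< q × upper x r)
    disjoint        : ∀ q → ¬ (lower x q × upper x q)
    located         : ∀ q r → q ℚ.< r → lower x q ⊎ upper x r

infix 4 _≤ᴿ_ _<ᴿ_

_≤ᴿ_ : Cut → Cut → Set
x ≤ᴿ y = ∀ q → lower x q → lower y q

_<ᴿ_ : Cut → Cut → Set
x <ᴿ y = ∃ λ q → upper x q × lower y q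

fromℚ : ℚ → Cut
fromℚ p .lower q = q ℚ.< p
fromℚ p .upper q = p ℚ.< q

fromℤ : ℤ → Cut
fromℤ n = fromℚ (n ℚ./ 1)

fromℕ : ℕ → Cut
fromℕ n = fromℤ (+ n)

infixl 6 _+ᴿ_ _-ᴿ_
infixl 7 _*ᴿ_
infix  8 -ᴿ_
infixr 9 _^ᴿ_

_+ᴿ_ : Cut → Cut → Cut
(x +ᴿ y) .lower q = ∃₂ λ a b → lower x a × lower y b × q ℚ.< a ℚ.+ b
(x +ᴿ y) .upper q = ∃₂ λ a b → upper x a × upper y b × a ℚ.+ b ℚ.< q

-ᴿ_ : Cut → Cut
(-ᴿ x) .lower q = upper x (ℚ.- q)
(-ᴿ x) .upper q = lower x (ℚ.- q)

_-ᴿ_ : Cut → Cut → Cut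
x -ᴿ y = x +ᴿ (-ᴿ y)

-- Interval multiplication: on the box a < x < b, c < y < d the extreme
-- values of the product are attained at the corners.

_*ᴿ_ : Cut → Cut → Cut
(x *ᴿ y) .lower q =
  ∃₂ λ a b → ∃₂ λ c d →
    (lower x a × upper x b) × (lower y c × upper y d) ×
    q ℚ.< a ℚ.* c × q ℚ.< a ℚ.* d × q ℚ.< b ℚ.* c × q ℚ.< b ℚ.* d
(x *ᴿ y) .upper q =
  ∃₂ λ a b → ∃₂ λ c d →
    (lower x a × upper x b) × (lower y c × upper y d) ×
    a ℚ.* c ℚ.< q × a ℚ.* d ℚ.< q × b ℚ.* c ℚ.< q × b ℚ.* d ℚ.< q

√ᴿ : Cut → Cut
√ᴿ x .lower q = q ℚ.< 0ℚ ⊎ lower x (q ℚ.* q)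
√ᴿ x .upper q = 0ℚ ℚ.< q × upper x (q ℚ.* q)

-- (1 + p/n)ⁿ ≤ eᵖ ≤ (1 - p/n)⁻ⁿ whenever the bases are nonnegative
-- (positive on the right), and both sides converge to eᵖ as n = suc k
-- tends to infinity.  In the upper cut, 1 < q * (1 - p/n)ⁿ says
-- (1 - p/n)⁻ⁿ < q.

expᴿ : Cut → Cut
expᴿ x .lower q =
  ∃₂ λ p k → let t = 1ℚ ℚ.+ p ℚ.* (1ℤ ℚ./ suc k) in
    lower x p × 0ℚ ℚ.≤ t × q ℚ.< t ^ℚ suc k
expᴿ x .upper q =
  ∃₂ λ p k → let t = 1ℚ ℚ.- p ℚ.* (1ℤ ℚ./ suc k) in
    upper x p × 0ℚ ℚ.≤ t × 1ℚ ℚ.< q ℚ.* t ^ℚ suc k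

-- The natural logarithm, as the inverse of expᴿ; meaningful for 0 < x.

logᴿ : Cut → Cut
logᴿ x .lower q = expᴿ (fromℚ q) <ᴿ x
logᴿ x .upper q = x <ᴿ expᴿ (fromℚ q)

-- Meaningful for a positive base.

_^ᴿ_ : Cut → Cut → Cut
x ^ᴿ y = expᴿ (y *ᴿ logᴿ x)

------------------------------------------------------------------------
-- Cardinality of a set A of residue classes modulo m, a class being
-- represented by its residue in Fin m.

-- A list without repetition of k members of A.

Distinct : ∀ {m} → (Fin m → Set) → ℕ → Set
Distinct {m} A k =
  ∃ λ (f : Fin k → Fin m) → Injective _≡_ _≡_ f × (∀ i → A (f i))

HasCardinality : ∀ {m} → (Fin m → Set) → ℕ → Set
HasCardinality A k =
  ∃ λ ((f , _) : Distinct A k) → ∀ r → A r → ∃ λ i → f i ≡ r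

-- Bounds on the cardinality that make sense when membership in A is not
-- decidable, so that A may have no enumeration constructively.  They are
-- the plain inequalities as soon as A has a cardinality: see ≤∣∣⇔ and
-- ∣∣≤⇔ below.

_≤∣_∣ : ∀ {m} → Cut → (Fin m → Set) → Set
b ≤∣ A ∣ = ∃ λ k → Distinct A k × b ≤ᴿ fromℕ k

∣_∣≤_ : ∀ {m} → (Fin m → Set) → Cut → Set
∣ A ∣≤ b = ∀ k → Distinct A k → fromℕ k ≤ᴿ b

fromℕ-mono : ∀ {j k} → j ℕ.≤ k → fromℕ j ≤ᴿ fromℕ k
fromℕ-mono {j} {k} j≤k q q<j = ℚ.<-≤-trans q<j
  (ℚ.toℚᵘ-cancel-≤
    (ℚᵘ.≤-respˡ-≃ (ℚᵘ.≃-sym (ℚ.toℚᵘ-fromℚᵘ (ℚᵘ.mkℚᵘ (+ j) 0)))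
      (ℚᵘ.≤-respʳ-≃ (ℚᵘ.≃-sym (ℚ.toℚᵘ-fromℚᵘ (ℚᵘ.mkℚᵘ (+ k) 0)))
        (ℚᵘ.*≤* (ℤ.*-monoʳ-≤-nonNeg 1ℤ (ℤ.+≤+ j≤k))))))

Distinct-≤ : ∀ {m} {A : Fin m → Set} {j k} →
             HasCardinality A k → Distinct A j → j ℕ.≤ k
Distinct-≤ {j = j} {k} ((f , _) , onto) (g , g-inj , g∈A) =
  injective⇒≤ {f = index} λ {i} {i′} eq →
    g-inj (trans (sym (index-ok i)) (trans (cong f eq) (index-ok i′)))
  where
  index : Fin j → Fin k
  index i = proj₁ (onto (g i) (g∈A i))

  index-ok : ∀ i → f (index i) ≡ g i
  index-ok i = proj₂ (onto (g i) (g∈A i))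

≤∣∣⇔ : ∀ {m} {A : Fin m → Set} {k b} →
       HasCardinality A k → (b ≤∣ A ∣) ⇔ (b ≤ᴿ fromℕ k)
≤∣∣⇔ {k = k} card = mk⇔
  (λ (j , list , b≤j) q → fromℕ-mono (Distinct-≤ card list) q ∘ b≤j q)
  (λ b≤k → k , proj₁ card , b≤k)

∣∣≤⇔ : ∀ {m} {A : Fin m → Set} {k b} →
       HasCardinality A k → (∣ A ∣≤ b) ⇔ (fromℕ k ≤ᴿ b)
∣∣≤⇔ {k = k} card = mk⇔
  (λ A≤b → A≤b k (proj₁ card))
  (λ k≤b j list q → k≤b q ∘ fromℕ-mono (Distinct-≤ card list) q)

------------------------------------------------------------------------
-- The residues r modulo m with r ≡ xy (mod m) for some integers
-- 1 ≤ x ≤ m^{1/2} and S + 1 ≤ y ≤ S + m^{1/2} (log m)^{2+ε}.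

ProductResidues : Cut → (m : ℕ) → ℤ → Fin m → Set
ProductResidues ε m S r =
  ∃₂ λ (x y : ℤ) →
    (1ℤ ℤ.≤ x × fromℤ x ≤ᴿ √ᴿ (fromℕ m)) ×
    (S ℤ.+ 1ℤ ℤ.≤ y ×
     fromℤ y ≤ᴿ fromℤ S +ᴿ √ᴿ (fromℕ m) *ᴿ logᴿ (fromℕ m) ^ᴿ (fromℕ 2 +ᴿ ε)) ×
    (+ m) ℤ.∣ (x ℤ.* y ℤ.- + toℕ r)

{-# OPTIONS --safe #-}
module Submission where

-- Write l = ⌊log₂ m⌋ and X = ⌊√m⌋.  Let x run over only K ≈ X / (32 l) primes
-- in (K , X] not dividing m, which exist by Chebyshev's lower bound for π(X),
-- and let y run over Y = X t consecutive integers, where t ≈ (log m)^{2 + ε}.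
-- For x ≠ x′ the number of solutions of x y ≡ x′ y′ (mod m) exceeds Y² / m by
-- O(Y / K + Y X / m + 1), so the number of representations of a residue as x y
-- has mean K Y / m and its variance summed over the residues is O(K Y).  By
-- Chebyshev's inequality at most 6 m² / (K Y) = O(m l / t) residues are missed.
-- The choice of K makes this a factor log m smaller than (log m)^{-ε} m; the
-- surplus absorbs the crude rational approximations of ε and log log m from
-- which t is built.

open import Defs

import Algebra.Definitions.RawSemiring as RawSemiring
open import Algebra.Bundles using (CommutativeRing)
import Algebra.Properties.CommutativeSemiring.Exp as Exp
open import Data.Fin.Base as Fin using (Fin; fromℕ<)
open import Data.Fin.Properties using (toℕ-fromℕ<; fromℕ<-injective; injective⇒≤)
open import Data.Integer.Base as ℤ using (ℤ; 1ℤ) renaming (+_ to pos)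
import Data.Integer.DivMod as ℤ
import Data.Integer.Properties as ℤ
open import Data.Integer.Tactic.RingSolver using () renaming (solve-∀ to solveℤ-∀)
open import Data.List.Base using (List; []; _∷_; _++_; map; length; lookup; filter; take; upTo; cartesianProduct)
open import Data.List.Membership.Propositional using (_∈_)
open import Data.List.Membership.Propositional.Properties
  using (∈-upTo⁺; ∈-upTo⁻; ∈-cartesianProduct⁺; ∈-cartesianProduct⁻; ∈-filter⁺; ∈-filter⁻; ∈-lookup)
import Data.List.Properties as List
open import Data.List.Relation.Unary.All as All using (All; []; _∷_)
import Data.List.Relation.Unary.All.Properties as All
open import Data.List.Relation.Unary.AllPairs using ([]; _∷_)
open import Data.List.Relation.Unary.Any using (here; there)
open import Data.List.Relation.Unary.Unique.Propositional using (Unique)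
open import Data.List.Relation.Unary.Unique.Propositional.Properties
  using (upTo⁺; cartesianProduct⁺; filter⁺; take⁺)
open import Data.Maybe.Base using (Maybe; just; nothing)
open import Data.Nat.Base
open import Data.Nat.Combinatorics using (nC1≡n; nCk+nC[k+1]≡[n+1]C[k+1]) renaming (_C_ to _choose_)
open import Data.Nat.Coprimality as Coprime using (Coprime; coprime-divisor)
open import Data.Nat.Divisibility
open import Data.Nat.DivMod
open import Data.Nat.Induction using (<-rec)
open import Data.Nat.ListAction using (product)
open import Data.Nat.Primality
open import Data.Nat.Primality.Factorisation using (factorise)
open import Data.Nat.Properties
open import Data.Nat.Tactic.RingSolver using (solve-∀)
open import Data.Product.Base using (∃; ∃₂; _×_; _,_; proj₁; proj₂)
open import Data.Product.Properties using (≡-dec)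
open import Data.Rational.Base as ℚ using (ℚ; 0ℚ; 1ℚ)
import Data.Rational.Properties as ℚ
import Data.Rational.Unnormalised.Base as ℚᵘ
import Data.Rational.Unnormalised.Properties as ℚᵘ
open import Data.Sum.Base using (_⊎_; inj₁; inj₂; [_,_]′)
open import Function.Base using (_∘_; id; it)
open import Function.Bundles using (Equivalence)
open import Function.Definitions using (Injective)
open import Level using (0ℓ)
open import Relation.Binary.Definitions using (DecidableEquality; tri<; tri≈; tri>)
open import Relation.Binary.PropositionalEquality
  using (_≡_; _≢_; refl; sym; trans; cong; cong₂; subst; module ≡-Reasoning)
open import Relation.Nullary.Decidable using (Dec; yes; no; _×-dec_; ¬?)
open import Relation.Nullary.Negation using (¬_; contradiction)
import Tactic.RingSolver as Solver
import Tactic.RingSolver.Core.AlmostCommutativeRing as ACR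

open IsReal
open RawSemiring ℚ.+-*-rawSemiring using () renaming (_^_ to _^ℚ_)

-- Finite sums

-- Primes are taken for their coprimality, to m and to each other: it lets a pair (y, y′) solving x
-- y ≡ x′ y′ be recovered from two bounded quotients, so collisions are counted by the pigeonhole
-- principle. The count feels S only through a residue modulo m, which gives the uniformity. The
-- analytic half is shaped by the cuts. ε and log log m are pairs of predicates and cannot be
-- evaluated, yet t must be a definite integer. It is computed from rational brackets; an error δ in
-- an exponent costs a factor (log m)^δ, and the spare factor log m tolerates a total δ below 1, so
-- ε is bracketed only to within 1/8. Exponentials are available only through (1 + p/n)^n and (1 -
-- p/n)^(-n), and comparisons between them reduce to Bernoulli's inequality. The upper bound on the
-- cardinality is just m: what has to be shown there is that the error term is positive as a cut.

∑ : {A : Set} → List A → (A → ℕ) → ℕ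
∑ []       f = 0
∑ (x ∷ xs) f = f x + ∑ xs f

⟦_⟧ : {P : Set} → Dec P → ℕ
⟦ yes _ ⟧ = 1
⟦ no _ ⟧  = 0

⟦⟧-true : {P : Set} (d : Dec P) → P → ⟦ d ⟧ ≡ 1
⟦⟧-true (yes _) p = refl
⟦⟧-true (no ¬p) p = contradiction p ¬p

⟦⟧-false : {P : Set} (d : Dec P) → ¬ P → ⟦ d ⟧ ≡ 0
⟦⟧-false (yes p) ¬p = contradiction p ¬p
⟦⟧-false (no _)  ¬p = refl

module _ {A : Set} where

  ∑-mono : ∀ xs {f g : A → ℕ} → (∀ {x} → x ∈ xs → f x ≤ g x) → ∑ xs f ≤ ∑ xs g
  ∑-mono []       f≤g = z≤n
  ∑-mono (x ∷ xs) f≤g = +-mono-≤ (f≤g (here refl)) (∑-mono xs (f≤g ∘ there))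

  ∑-cong : ∀ xs {f g : A → ℕ} → (∀ x → f x ≡ g x) → ∑ xs f ≡ ∑ xs g
  ∑-cong []       f≡g = refl
  ∑-cong (x ∷ xs) f≡g = cong₂ _+_ (f≡g x) (∑-cong xs f≡g)

  ∑-+ : ∀ xs (f g : A → ℕ) → ∑ xs (λ x → f x + g x) ≡ ∑ xs f + ∑ xs g
  ∑-+ []       f g = refl
  ∑-+ (x ∷ xs) f g rewrite ∑-+ xs f g = lemma (f x) (g x) (∑ xs f) (∑ xs g)
    where
    lemma : ∀ a b c d → a + b + (c + d) ≡ a + c + (b + d)
    lemma = solve-∀

  ∑-*ˡ : ∀ xs c (f : A → ℕ) → ∑ xs (λ x → c * f x) ≡ c * ∑ xs f
  ∑-*ˡ []       c f = sym (*-zeroʳ c)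
  ∑-*ˡ (x ∷ xs) c f rewrite ∑-*ˡ xs c f = sym (*-distribˡ-+ c (f x) (∑ xs f))

  ∑-*ʳ : ∀ xs c (f : A → ℕ) → ∑ xs (λ x → f x * c) ≡ ∑ xs f * c
  ∑-*ʳ xs c f = trans (∑-cong xs λ x → *-comm (f x) c)
    (trans (∑-*ˡ xs c f) (*-comm c (∑ xs f)))

  ∑-const : ∀ (xs : List A) c → ∑ xs (λ _ → c) ≡ length xs * c
  ∑-const []       c = refl
  ∑-const (x ∷ xs) c = cong (c +_) (∑-const xs c)

  ∑-length : ∀ (xs : List A) → ∑ xs (λ _ → 1) ≡ length xs
  ∑-length xs = trans (∑-const xs 1) (*-identityʳ _)

  ∑-++ : ∀ xs ys (f : A → ℕ) → ∑ (xs ++ ys) f ≡ ∑ xs f + ∑ ys f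
  ∑-++ []       ys f = refl
  ∑-++ (x ∷ xs) ys f rewrite ∑-++ xs ys f = sym (+-assoc (f x) _ _)

  ∑-map : ∀ {B : Set} (h : B → A) xs (f : A → ℕ) → ∑ (map h xs) f ≡ ∑ xs (f ∘ h)
  ∑-map h []       f = refl
  ∑-map h (x ∷ xs) f = cong (f (h x) +_) (∑-map h xs f)

  ≤∑ : ∀ {xs} (f : A → ℕ) {x} → x ∈ xs → f x ≤ ∑ xs f
  ≤∑ {x ∷ xs} f (here refl) = m≤m+n (f x) _
  ≤∑ {x ∷ xs} f (there x∈) = ≤-trans (≤∑ f x∈) (m≤n+m _ (f x))

  ∑≡0 : ∀ xs (f : A → ℕ) → (∀ {x} → x ∈ xs → f x ≡ 0) → ∑ xs f ≡ 0
  ∑≡0 []       f z = refl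
  ∑≡0 (x ∷ xs) f z rewrite z (here refl) = ∑≡0 xs f (z ∘ there)

  ∑-unique : ∀ {xs} → Unique xs → {P : A → Set} (P? : ∀ x → Dec (P x)) →
             (∀ {x y} → x ∈ xs → y ∈ xs → P x → P y → x ≡ y) →
             ∑ xs (λ x → ⟦ P? x ⟧) ≤ 1
  ∑-unique []            P? uniq = z≤n
  ∑-unique {x ∷ xs} (x∉ ∷ u) P? uniq with P? x
  ... | no _  = ∑-unique u P? λ a b → uniq (there a) (there b)
  ... | yes p = ≤-reflexive (cong suc (∑≡0 xs _ λ {y} y∈ → ⟦⟧-false (P? y)
                  λ q → All.lookup x∉ y∈ (uniq (here refl) (there y∈) p q)))

∑-swap : {A B : Set} (xs : List A) (ys : List B) (f : A → B → ℕ) →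
         ∑ xs (λ x → ∑ ys (f x)) ≡ ∑ ys (λ y → ∑ xs (λ x → f x y))
∑-swap []       ys f = sym (∑≡0 ys _ λ _ → refl)
∑-swap (x ∷ xs) ys f rewrite ∑-swap xs ys f = sym (∑-+ ys (f x) _)

∑-cartesianProduct : {A B : Set} (xs : List A) (ys : List B) (f : A × B → ℕ) →
  ∑ (cartesianProduct xs ys) f ≡ ∑ xs (λ x → ∑ ys (λ y → f (x , y)))
∑-cartesianProduct []       ys f = refl
∑-cartesianProduct (x ∷ xs) ys f =
  trans (∑-++ (map (x ,_) ys) _ f)
        (cong₂ _+_ (∑-map (x ,_) ys f) (∑-cartesianProduct xs ys f))

-- Double counting of the pairs (x, y) with P x and h x ≡ y. Injectivity is asked only on the x
-- satisfying P, so a congruence P may help to recover x from h x.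
pigeonhole : {A B : Set} → DecidableEquality B → {xs : List A} {ys : List B} →
  Unique xs → {P : A → Set} (P? : ∀ x → Dec (P x)) (h : A → B) →
  (∀ {x} → x ∈ xs → P x → h x ∈ ys) →
  (∀ {x y} → x ∈ xs → y ∈ xs → P x → P y → h x ≡ h y → x ≡ y) →
  ∑ xs (λ x → ⟦ P? x ⟧) ≤ length ys
pigeonhole _≟B_ {xs} {ys} u P? h into inj = begin
  ∑ xs (λ x → ⟦ P? x ⟧)                        ≤⟨ ∑-mono xs below ⟩
  ∑ xs (λ x → ∑ ys λ y → ⟦ hit x y ⟧)          ≡⟨ ∑-swap xs ys _ ⟩
  ∑ ys (λ y → ∑ xs λ x → ⟦ hit x y ⟧)          ≤⟨ ∑-mono ys (λ {y} _ → ∑-unique u (λ x → hit x y)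
                                                   λ a b (p , eq) (q , eq′) → inj a b p q (trans eq (sym eq′))) ⟩
  ∑ ys (λ _ → 1)                               ≡⟨ ∑-length ys ⟩
  length ys                                    ∎
  where
  open ≤-Reasoning
  hit : ∀ x y → Dec _
  hit x y = P? x ×-dec (h x ≟B y)

  below : ∀ {x} → x ∈ xs → ⟦ P? x ⟧ ≤ ∑ ys λ y → ⟦ hit x y ⟧
  below {x} x∈ with P? x in eq
  ... | no _  = z≤n
  ... | yes p = ≤-trans (≤-reflexive (sym (trans (cong (λ d → ⟦ d ×-dec (h x ≟B h x) ⟧) (sym eq)) (⟦⟧-true (hit x (h x)) (p , refl)))))
                  (subst (λ d → ⟦ d ×-dec (h x ≟B h x) ⟧ ≤ ∑ ys λ y → ⟦ d ×-dec (h x ≟B y) ⟧) eq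
                    (≤∑ (λ y → ⟦ hit x y ⟧) (into x∈ p)))

length-⊆ : {A : Set} → DecidableEquality A → {xs ys : List A} →
           Unique xs → (∀ {x} → x ∈ xs → x ∈ ys) → length xs ≤ length ys
length-⊆ _≟A_ {xs} u sub = subst (_≤ _)
  (∑-length xs)
  (pigeonhole _≟A_ u (λ _ → yes refl) id (λ x∈ (_ : 0 ≡ 0) → sub x∈) λ _ _ _ _ eq → eq)

-- Second moments

2ab≤a²+b² : ∀ a b → 2 * a * b ≤ a * a + b * b
2ab≤a²+b² a b with ≤-total a b
... | inj₁ a≤b = subst (λ b → 2 * a * b ≤ a * a + b * b) (m+[n∸m]≡n a≤b)
        (≤-trans (m≤m+n _ _) (≤-reflexive (lemma a (b ∸ a))))
  where
  lemma : ∀ a d → 2 * a * (a + d) + d * d ≡ a * a + (a + d) * (a + d)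
  lemma = solve-∀
... | inj₂ b≤a = subst (λ a → 2 * a * b ≤ a * a + b * b) (m+[n∸m]≡n b≤a)
        (≤-trans (m≤m+n _ _) (≤-reflexive (lemma b (a ∸ b))))
  where
  lemma : ∀ b d → 2 * (b + d) * b + d * d ≡ (b + d) * (b + d) + b * b
  lemma = solve-∀

collisions : {J : Set} → List J → (J → ℕ) → ℕ
collisions js c = ∑ js λ i → ∑ js λ j → ⟦ c i ≟ c j ⟧

missed : {J : Set} → ℕ → List J → (J → ℕ) → ℕ
missed m js c = ∑ (upTo m) λ a → ⟦ (∑ js λ j → ⟦ c j ≟ a ⟧) ≟ 0 ⟧

-- Chebyshev's inequality for r a = #{ j : c j ≡ a }, with all terms moved
-- so that no subtraction occurs.
second-moment : {J : Set} (m : ℕ) (js : List J) (c : J → ℕ) →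
  (∀ {j} → j ∈ js → c j < m) →
  let V = length js in
  missed m js c * (V * V) + m * (V * V) ≤ m * m * collisions js c
second-moment {J} m js c c<m = +-cancelˡ-≤ (m * (V * V)) _ _ (begin
  m * (V * V) + (missed m js c * (V * V) + m * (V * V))
    ≡⟨ lemma₁ m V (missed m js c) ⟩
  2 * m * V * V + missed m js c * (V * V)
    ≤⟨ +-monoˡ-≤ _ (*-monoʳ-≤ (2 * m * V) total) ⟩
  2 * m * V * ∑ as r + missed m js c * (V * V)
    ≡⟨ cong₂ _+_ (∑-*ˡ as (2 * m * V) r) (∑-*ʳ as (V * V) z) ⟨
  ∑ as (λ a → 2 * m * V * r a) + ∑ as (λ a → z a * (V * V))
    ≡⟨ ∑-+ as _ _ ⟨
  ∑ as (λ a → 2 * m * V * r a + z a * (V * V))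
    ≤⟨ ∑-mono as (λ {a} _ → pointwise a) ⟩
  ∑ as (λ a → m * m * (r a * r a) + V * V)
    ≡⟨ ∑-+ as _ _ ⟩
  ∑ as (λ a → m * m * (r a * r a)) + ∑ as (λ _ → V * V)
    ≡⟨ cong₂ _+_ (∑-*ˡ as (m * m) _) (trans (∑-const as (V * V)) (cong (_* (V * V)) (List.length-upTo m))) ⟩
  m * m * ∑ as (λ a → r a * r a) + m * (V * V)
    ≤⟨ +-monoˡ-≤ _ (*-monoʳ-≤ (m * m) squares) ⟩
  m * m * collisions js c + m * (V * V)
    ≡⟨ +-comm _ (m * (V * V)) ⟩
  m * (V * V) + m * m * collisions js c ∎)
  where
  open ≤-Reasoning
  V = length js
  as = upTo m

  r : ℕ → ℕ
  r a = ∑ js λ j → ⟦ c j ≟ a ⟧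

  z : ℕ → ℕ
  z a = ⟦ r a ≟ 0 ⟧

  lemma₁ : ∀ m V U → m * (V * V) + (U * (V * V) + m * (V * V)) ≡ 2 * m * V * V + U * (V * V)
  lemma₁ = solve-∀

  total : V ≤ ∑ as r
  total = begin
    V                                            ≡⟨ ∑-length js ⟨
    ∑ js (λ _ → 1)
      ≤⟨ ∑-mono js (λ {j} j∈ → subst (_≤ ∑ as λ a → ⟦ c j ≟ a ⟧) (⟦⟧-true (c j ≟ c j) refl)
                                                      (≤∑ (λ a → ⟦ c j ≟ a ⟧) (∈-upTo⁺ (c<m j∈)))) ⟩
    ∑ js (λ j → ∑ as λ a → ⟦ c j ≟ a ⟧)          ≡⟨ ∑-swap js as _ ⟩
    ∑ as r                                       ∎

  -- This is (m r a - V)² ≥ 0; for r a ≡ 0 the square is V² itself, so a missed residue can be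
  -- charged the full V².
  pointwise : ∀ a → 2 * m * V * r a + z a * (V * V) ≤ m * m * (r a * r a) + V * V
  pointwise a with r a
  ... | zero = ≤-reflexive (lemma m V)
    where
    lemma : ∀ m V → 2 * m * V * 0 + (1 * (V * V)) ≡ m * m * 0 + V * V
    lemma = solve-∀
  ... | suc n = begin
    2 * m * V * suc n + 0                        ≡⟨ lemma m V (suc n) ⟩
    2 * (m * suc n) * V                          ≤⟨ 2ab≤a²+b² (m * suc n) V ⟩
    m * suc n * (m * suc n) + V * V              ≡⟨ lemma′ m V (suc n) ⟩
    m * m * (suc n * suc n) + V * V              ∎
    where
    lemma : ∀ m V k → 2 * m * V * k + 0 ≡ 2 * (m * k) * V
    lemma = solve-∀
    lemma′ : ∀ m V k → m * k * (m * k) + V * V ≡ m * m * (k * k) + V * V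
    lemma′ = solve-∀

  both : ∀ i j a → ⟦ c i ≟ a ⟧ * ⟦ c j ≟ a ⟧ ≡ ⟦ c i ≟ a ×-dec c i ≟ c j ⟧
  both i j a with c i ≟ a
  ... | no _ = refl
  ... | yes refl = trans (+-identityʳ _) (sym (lemma (c j ≟ c i) (c i ≟ c j)))
    where
    lemma : (d : Dec (c j ≡ c i)) (e : Dec (c i ≡ c j)) → ⟦ yes (refl {x = c i}) ×-dec e ⟧ ≡ ⟦ d ⟧
    lemma d (yes eq) = sym (⟦⟧-true d (sym eq))
    lemma d (no ne)  = sym (⟦⟧-false d (ne ∘ sym))

  one : ∀ i j → ∑ as (λ a → ⟦ c i ≟ a ×-dec c i ≟ c j ⟧) ≤ ⟦ c i ≟ c j ⟧
  one i j with c i ≟ c j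
  ... | yes eq = ∑-unique (upTo⁺ m) (λ a → c i ≟ a ×-dec yes eq)
                   λ _ _ (p , _) (q , _) → trans (sym p) q
  ... | no ne = ≤-reflexive (∑≡0 as _ λ {a} _ → ⟦⟧-false (c i ≟ a ×-dec no ne) (ne ∘ proj₂))

  squares : ∑ as (λ a → r a * r a) ≤ collisions js c
  squares = begin
    ∑ as (λ a → r a * r a)
      ≡⟨ ∑-cong as (λ a → trans (∑-cong js λ i → ∑-*ˡ js ⟦ c i ≟ a ⟧ _)
           (∑-*ʳ js (r a) _)) ⟨
    ∑ as (λ a → ∑ js λ i → ∑ js λ j → ⟦ c i ≟ a ⟧ * ⟦ c j ≟ a ⟧)
      ≡⟨ ∑-swap as js _ ⟩
    ∑ js (λ i → ∑ as λ a → ∑ js λ j → ⟦ c i ≟ a ⟧ * ⟦ c j ≟ a ⟧)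
      ≡⟨ ∑-cong js (λ i → trans (∑-swap as js _) (∑-cong js λ j → ∑-cong as (both i j))) ⟩
    ∑ js (λ i → ∑ js λ j → ∑ as λ a → ⟦ c i ≟ a ×-dec c i ≟ c j ⟧)
      ≤⟨ ∑-mono js (λ {i} _ → ∑-mono js λ {j} _ → one i j) ⟩
    collisions js c ∎

-- Congruences modulo m

%≡⇒∣∸ : ∀ {a b} m .{{_ : NonZero m}} → a % m ≡ b % m → b ≤ a → m ∣ a ∸ b
%≡⇒∣∸ {a} {b} m eq b≤a = divides (a / m ∸ b / m) (begin
  a ∸ b
    ≡⟨ cong₂ _∸_ (m≡m%n+[m/n]*n a m) (m≡m%n+[m/n]*n b m) ⟩
  (a % m + a / m * m) ∸ (b % m + b / m * m)
    ≡⟨ cong (λ r → (r + a / m * m) ∸ (b % m + b / m * m)) eq ⟩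
  (b % m + a / m * m) ∸ (b % m + b / m * m)      ≡⟨ [m+n]∸[m+o]≡n∸o (b % m) _ _ ⟩
  a / m * m ∸ b / m * m                          ≡⟨ *-distribʳ-∸ m (a / m) (b / m) ⟨
  (a / m ∸ b / m) * m                            ∎)
  where open ≡-Reasoning

∣∸⇒%≡ : ∀ {a b} m .{{_ : NonZero m}} → b ≤ a → m ∣ a ∸ b → a % m ≡ b % m
∣∸⇒%≡ {a} {b} m b≤a (divides q eq) =
  trans (cong (_% m) (trans (sym (m+[n∸m]≡n b≤a)) (cong (b +_) eq))) ([m+kn]%n≡m%n b q m)

%-cancel-+ : ∀ e {a b} m .{{_ : NonZero m}} → (e + a) % m ≡ (e + b) % m → a % m ≡ b % m
%-cancel-+ e {a} {b} m eq with ≤-total a b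
... | inj₁ a≤b = sym (∣∸⇒%≡ m a≤b (subst (m ∣_) ([m+n]∸[m+o]≡n∸o e b a) (%≡⇒∣∸ m (sym eq) (+-monoʳ-≤ e a≤b))))
... | inj₂ b≤a = ∣∸⇒%≡ m b≤a (subst (m ∣_) ([m+n]∸[m+o]≡n∸o e a b) (%≡⇒∣∸ m eq (+-monoʳ-≤ e b≤a)))

%-cancel-* : ∀ x {a b} m .{{_ : NonZero m}} → Coprime x m → (x * a) % m ≡ (x * b) % m → a % m ≡ b % m
%-cancel-* x {a} {b} m cop eq with ≤-total a b
... | inj₁ a≤b = sym (∣∸⇒%≡ m a≤b (coprime-divisor (Coprime.sym cop) (subst (m ∣_) (sym (*-distribˡ-∸ x b a)) (%≡⇒∣∸ m (sym eq) (*-monoʳ-≤ x a≤b)))))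
... | inj₂ b≤a = ∣∸⇒%≡ m b≤a (coprime-divisor (Coprime.sym cop) (subst (m ∣_) (sym (*-distribˡ-∸ x a b)) (%≡⇒∣∸ m eq (*-monoʳ-≤ x b≤a))))

%-cong-+ʳ : ∀ c {a b} m .{{_ : NonZero m}} → a % m ≡ b % m → (a + c) % m ≡ (b + c) % m
%-cong-+ʳ c {a} {b} m eq = trans (%-distribˡ-+ a c m)
  (trans (cong (λ r → (r + c % m) % m) eq) (sym (%-distribˡ-+ b c m)))

/-%-injective : ∀ {a b} m .{{_ : NonZero m}} → a / m ≡ b / m → a % m ≡ b % m → a ≡ b
/-%-injective {a} {b} m p q = trans (m≡m%n+[m/n]*n a m)
  (trans (cong₂ (λ r k → r + k * m) q p) (sym (m≡m%n+[m/n]*n b m)))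

range² : ℕ → List (ℕ × ℕ)
range² Y = cartesianProduct (upTo Y) (upTo Y)

length-box : ∀ A B → length (cartesianProduct (upTo A) (upTo B)) ≡ A * B
length-box A B = begin
  length (cartesianProduct (upTo A) (upTo B))
    ≡⟨ ∑-length (cartesianProduct (upTo A) (upTo B)) ⟨
  ∑ (cartesianProduct (upTo A) (upTo B)) (λ _ → 1) ≡⟨ ∑-cartesianProduct (upTo A) (upTo B) _ ⟩
  ∑ (upTo A) (λ _ → ∑ (upTo B) λ _ → 1)            ≡⟨ ∑-const (upTo A) _ ⟩
  length (upTo A) * ∑ (upTo B) (λ _ → 1)
    ≡⟨ cong₂ _*_ (List.length-upTo A) (trans (∑-length (upTo B)) (List.length-upTo B)) ⟩
  A * B                                            ∎
  where open ≡-Reasoning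

∈-box⁺ : ∀ {A B a b} → a < A → b < B → (a , b) ∈ cartesianProduct (upTo A) (upTo B)
∈-box⁺ a< b< = ∈-cartesianProduct⁺ (∈-upTo⁺ a<) (∈-upTo⁺ b<)

∈-box⁻ : ∀ {A B ab} → ab ∈ cartesianProduct (upTo A) (upTo B) → proj₁ ab < A × proj₂ ab < B
∈-box⁻ {A} {B} ∈ = let (a , b) = ∈-cartesianProduct⁻ (upTo A) (upTo B) ∈ in ∈-upTo⁻ a , ∈-upTo⁻ b

module _ (m s : ℕ) .{{_ : NonZero m}} where

  pairs : (Y x x′ : ℕ) → ℕ
  pairs Y x x′ = ∑ (range² Y) λ (y , y′) → ⟦ (x * (s + y)) % m ≟ (x′ * (s + y′)) % m ⟧

  -- Cancelling x and s leaves y ≡ y′ (mod m), so y and the quotient y′ / m determine the pair.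
  pairs-diagonal : ∀ Y x → Coprime x m → pairs Y x x ≤ Y * suc (Y / m)
  pairs-diagonal Y x cop = subst (pairs Y x x ≤_) (length-box Y (suc (Y / m)))
    (pigeonhole (≡-dec _≟_ _≟_) (cartesianProduct⁺ (upTo⁺ Y) (upTo⁺ Y)) _
      (λ (y , y′) → y , y′ / m)
      (λ ∈ _ → let (y< , y′<) = ∈-box⁻ {Y} {Y} ∈ in ∈-box⁺ y< (s≤s (/-monoˡ-≤ m (<⇒≤ y′<))))
      (λ { {y , y′} {z , z′} _ _ p q eq → let y≡z = cong proj₁ eq in
        cong₂ _,_ y≡z (/-%-injective m (cong proj₂ eq)
          (%-cancel-+ s m (%-cancel-* x m cop
            (trans (sym p) (trans (cong (λ y → (x * (s + y)) % m) y≡z) q))))) }))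

  -- Writing y′ = b x + v with v < x, the congruence determines
  -- D = x y + x′ (x - 1 - v) modulo m in terms of b, and D determines
  -- (y , v) because x and x′ are coprime.
  pairs-coprime : ∀ Y x x′ .{{_ : NonZero x}} → Coprime x x′ →
                  pairs Y x x′ ≤ suc (Y / x) * suc ((x * Y + x′ * x) / m)
  pairs-coprime Y x x′ cop = subst (pairs Y x x′ ≤_) (length-box (suc (Y / x)) (suc ((x * Y + x′ * x) / m)))
    (pigeonhole (≡-dec _≟_ _≟_) (cartesianProduct⁺ (upTo⁺ Y) (upTo⁺ Y)) _
      (λ p → proj₂ p / x , D p / m)
      (λ { {y , y′} ∈ _ → let (y< , y′<) = ∈-box⁻ {Y} {Y} ∈ in
        ∈-box⁺ (s≤s (/-monoˡ-≤ x (<⇒≤ y′<)))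
               (s≤s (/-monoˡ-≤ m (+-mono-≤ (*-monoʳ-≤ x (<⇒≤ y<)) (*-monoʳ-≤ x′ (m∸n≤m x (y′ % x)))))) })
      (λ { {y , y′} {z , z′} _ _ p q eq →
        let b≡ = cong proj₁ eq
            D≡ = /-%-injective m (cong proj₂ eq)
                   (%-cancel-+ (x * s) m (trans (shift {y} {y′} p)
                     (trans (cong (λ b → (x′ * (s + b * x + x)) % m) b≡) (sym (shift {z} {z′} q)))))
            v≡ = coordinate y y′ z z′ D≡
            y′≡ = /-%-injective x b≡ v≡
        in cong₂ _,_ (*-cancelˡ-≡ y z x (+-cancelʳ-≡ _ _ _
             (trans D≡ (cong (λ v → x * z + x′ * (x ∸ v)) (sym v≡))))) y′≡ }))
    where
    -- In code v enters through its complement x - v, which is exact because v < x and keeps D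
    -- natural where the congruence suggests x y - x′ v.
    D : ℕ × ℕ → ℕ
    D (y , y′) = x * y + x′ * (x ∸ y′ % x)

    shift : ∀ {y y′} → (x * (s + y)) % m ≡ (x′ * (s + y′)) % m →
            (x * s + D (y , y′)) % m ≡ (x′ * (s + y′ / x * x + x)) % m
    shift {y} {y′} eq = begin
      (x * s + D (y , y′)) % m
        ≡⟨ cong (_% m) (lemma₁ x s y (x′ * (x ∸ y′ % x))) ⟩
      (x * (s + y) + x′ * (x ∸ y′ % x)) % m
        ≡⟨ %-cong-+ʳ _ m eq ⟩
      (x′ * (s + y′) + x′ * (x ∸ y′ % x)) % m
        ≡⟨ cong (λ k → (x′ * (s + k) + x′ * (x ∸ y′ % x)) % m) (m≡m%n+[m/n]*n y′ x) ⟩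
      (x′ * (s + (y′ % x + y′ / x * x)) + x′ * (x ∸ y′ % x)) % m
        ≡⟨ cong (_% m) (lemma₂ x′ s (y′ % x) (y′ / x * x) (x ∸ y′ % x)) ⟩
      (x′ * (s + y′ / x * x + (y′ % x + (x ∸ y′ % x)))) % m
        ≡⟨ cong (λ k → (x′ * (s + y′ / x * x + k)) % m) (m+[n∸m]≡n (<⇒≤ (m%n<n y′ x))) ⟩
      (x′ * (s + y′ / x * x + x)) % m ∎
      where
      open ≡-Reasoning
      lemma₁ : ∀ x s y t → x * s + (x * y + t) ≡ x * (s + y) + t
      lemma₁ = solve-∀
      lemma₂ : ∀ x′ s v b w → x′ * (s + (v + b)) + x′ * w ≡ x′ * (s + b + (v + w))
      lemma₂ = solve-∀

    -- Modulo x only x′ (x - v) survives in D; cancelling x′ gives congruent complements, and adding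
    -- both residues to each turns them into the residues themselves, interchanged.
    coordinate : ∀ y y′ z z′ → D (y , y′) ≡ D (z , z′) → y′ % x ≡ z′ % x
    coordinate y y′ z z′ eq = sym (begin
      z′ % x                                ≡⟨ complement y′ (z′ % x) (m%n%n≡m%n z′ x) ⟨
      ((x ∸ y′ % x) + (y′ % x + z′ % x)) % x
        ≡⟨ %-cong-+ʳ _ x (%-cancel-* x′ x (Coprime.sym cop) (begin
        (x′ * (x ∸ y′ % x)) % x             ≡⟨ [m+kn]%n≡m%n _ y x ⟨
        (x′ * (x ∸ y′ % x) + y * x) % x     ≡⟨ cong (_% x) (lemma (x′ * (x ∸ y′ % x)) y x) ⟩
        D (y , y′) % x                      ≡⟨ cong (_% x) eq ⟩
        D (z , z′) % x                      ≡⟨ cong (_% x) (lemma (x′ * (x ∸ z′ % x)) z x) ⟨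
        (x′ * (x ∸ z′ % x) + z * x) % x     ≡⟨ [m+kn]%n≡m%n _ z x ⟩
        (x′ * (x ∸ z′ % x)) % x             ∎)) ⟩
      ((x ∸ z′ % x) + (y′ % x + z′ % x)) % x
        ≡⟨ cong (λ k → ((x ∸ z′ % x) + k) % x) (+-comm (y′ % x) _) ⟩
      ((x ∸ z′ % x) + (z′ % x + y′ % x)) % x ≡⟨ complement z′ (y′ % x) (m%n%n≡m%n y′ x) ⟩
      y′ % x                                ∎)
      where
      open ≡-Reasoning
      lemma : ∀ a y x → a + y * x ≡ x * y + a
      lemma = solve-∀

      complement : ∀ u w → w % x ≡ w → ((x ∸ u % x) + (u % x + w)) % x ≡ w
      complement u w w< = begin
        ((x ∸ u % x) + (u % x + w)) % x     ≡⟨ cong (_% x) (+-assoc (x ∸ u % x) _ w) ⟨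
        (x ∸ u % x + u % x + w) % x
          ≡⟨ cong (λ k → (k + w) % x) (m∸n+n≡m (<⇒≤ (m%n<n u x))) ⟩
        (x + w) % x                         ≡⟨ cong (_% x) (+-comm x w) ⟩
        (w + x) % x                         ≡⟨ [m+n]%n≡m%n w x ⟩
        w % x                               ≡⟨ w< ⟩
        w                                   ∎

-- Representation counts for pairwise coprime multipliers

suc[a/m]*m≤a+m : ∀ a m .{{_ : NonZero m}} → suc (a / m) * m ≤ a + m
suc[a/m]*m≤a+m a m = ≤-trans (+-monoʳ-≤ m (m/n*n≤m a m)) (≤-reflexive (+-comm m a))

-- The number N of multipliers also bounds each of them from below. An off-diagonal pair can exceed
-- Y² / m by about Y / N, and N² such excesses come to N Y, no more than the order of the diagonal
-- contribution.
module Multiples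
  (m s X Y N : ℕ) .{{_ : NonZero m}} .{{_ : NonZero N}} (xs : List ℕ)
  (unique : Unique xs) (length≡N : length xs ≡ N)
  (N≤ : ∀ {x} → x ∈ xs → N ≤ x) (≤X : ∀ {x} → x ∈ xs → x ≤ X)
  (coprime-m : ∀ {x} → x ∈ xs → Coprime x m)
  (coprime : ∀ {x x′} → x ∈ xs → x′ ∈ xs → x ≢ x′ → Coprime x x′)
  (X²≤m : X * X ≤ m) (N≤X : N ≤ X) (N≤Y : N ≤ Y)
  where

  index : List (ℕ × ℕ)
  index = cartesianProduct xs (upTo Y)

  residue : ℕ × ℕ → ℕ
  residue (x , y) = (x * (s + y)) % m

  length-index : length index ≡ N * Y
  length-index = begin
    length index                    ≡⟨ ∑-length index ⟨
    ∑ index (λ _ → 1)               ≡⟨ ∑-cartesianProduct xs (upTo Y) _ ⟩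
    ∑ xs (λ _ → ∑ (upTo Y) λ _ → 1) ≡⟨ ∑-const xs _ ⟩
    length xs * ∑ (upTo Y) (λ _ → 1)
      ≡⟨ cong₂ _*_ length≡N (trans (∑-length (upTo Y)) (List.length-upTo Y)) ⟩
    N * Y                           ∎
    where open ≡-Reasoning

  collisions≡ : collisions index residue ≡ ∑ xs λ x → ∑ xs λ x′ → pairs m s Y x x′
  collisions≡ = begin
    ∑ index (λ i → ∑ index (λ j → f i j))
      ≡⟨ ∑-cartesianProduct xs (upTo Y) _ ⟩
    ∑ xs (λ x → ∑ (upTo Y) λ y → ∑ index (f (x , y)))
      ≡⟨ ∑-cong xs (λ x → ∑-cong (upTo Y) λ y → ∑-cartesianProduct xs (upTo Y) _) ⟩
    ∑ xs (λ x → ∑ (upTo Y) λ y → ∑ xs λ x′ → ∑ (upTo Y) λ y′ → f (x , y) (x′ , y′))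
      ≡⟨ ∑-cong xs (λ x → ∑-swap (upTo Y) xs _) ⟩
    ∑ xs (λ x → ∑ xs λ x′ → ∑ (upTo Y) λ y → ∑ (upTo Y) λ y′ → f (x , y) (x′ , y′))
      ≡⟨ ∑-cong xs (λ x → ∑-cong xs λ x′ → ∑-cartesianProduct (upTo Y) (upTo Y) _) ⟨
    ∑ xs (λ x → ∑ xs λ x′ → pairs m s Y x x′) ∎
    where
    open ≡-Reasoning
    f : ℕ × ℕ → ℕ × ℕ → ℕ
    f i j = ⟦ residue i ≟ residue j ⟧

  -- This is N m times Y² / m + 2 X Y / m + 2 + Y / N, scaled so that no division remains.
  B : ℕ
  B = N * (Y * Y + 2 * (X * Y) + 2 * m) + Y * m

  open ≤-Reasoning

  pairs≤ : ∀ {x x′} → x ∈ xs → x′ ∈ xs →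
           N * m * pairs m s Y x x′ ≤ B + N * Y * m * ⟦ x ≟ x′ ⟧
  pairs≤ {x} {x′} x∈ x′∈ with x ≟ x′
  ... | yes refl = begin
    N * m * pairs m s Y x x     ≤⟨ *-monoʳ-≤ (N * m) (pairs-diagonal m s Y x (coprime-m x∈)) ⟩
    N * m * (Y * suc (Y / m))   ≡⟨ lemma₁ N m Y (suc (Y / m)) ⟩
    N * Y * (suc (Y / m) * m)   ≤⟨ *-monoʳ-≤ (N * Y) (suc[a/m]*m≤a+m Y m) ⟩
    N * Y * (Y + m)             ≤⟨ m≤m+n _ (N * (2 * (X * Y) + 2 * m) + Y * m) ⟩
    N * Y * (Y + m) + (N * (2 * (X * Y) + 2 * m) + Y * m) ≡⟨ lemma₂ N Y m X ⟩
    B + N * Y * m * 1           ∎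
    where
    lemma₁ : ∀ N m Y q → N * m * (Y * q) ≡ N * Y * (q * m)
    lemma₁ = solve-∀
    lemma₂ : ∀ N Y m X → N * Y * (Y + m) + (N * (2 * (X * Y) + 2 * m) + Y * m) ≡
      N * (Y * Y + 2 * (X * Y) + 2 * m) + Y * m + N * Y * m * 1
    lemma₂ = solve-∀
  ... | no x≢x′ = begin
    N * m * pairs m s Y x x′
      ≤⟨ *-monoʳ-≤ (N * m) (pairs-coprime m s Y x x′ (coprime x∈ x′∈ x≢x′)) ⟩
    N * m * (suc q * suc ((x * Y + x′ * x) / m))
      ≡⟨ lemma₁ N m (suc q) _ ⟩
    N * suc q * (suc ((x * Y + x′ * x) / m) * m)
      ≤⟨ *-monoʳ-≤ (N * suc q) (suc[a/m]*m≤a+m (x * Y + x′ * x) m) ⟩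
    N * suc q * (x * Y + x′ * x + m)
      ≡⟨ lemma₂ N q x x′ Y m ⟩
    N * (q * x * Y + (q * x * x′ + x * Y) + (x′ * x + m)) + N * q * m
      ≤⟨ +-mono-≤
           (*-monoʳ-≤ N (+-mono-≤
             (+-mono-≤ (*-monoˡ-≤ Y qx≤Y) (+-mono-≤ (*-mono-≤ qx≤Y (≤X x′∈)) (*-monoˡ-≤ Y (≤X x∈))))
             (+-monoˡ-≤ m (≤-trans (*-mono-≤ (≤X x′∈) (≤X x∈)) X²≤m))))
           -- The lower bound on the multipliers enters here: N q ≤ x q ≤ Y.
           (*-monoˡ-≤ m (≤-trans (≤-reflexive (*-comm N q)) (≤-trans (*-monoʳ-≤ q (N≤ x∈)) qx≤Y))) ⟩
    N * (Y * Y + (Y * X + X * Y) + (m + m)) + Y * m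
      ≡⟨ lemma₃ N Y X m ⟩
    B + N * Y * m * 0 ∎
    where
    instance
      x≢0 : NonZero x
      x≢0 = >-nonZero (<-≤-trans (>-nonZero⁻¹ N) (N≤ x∈))
    q = Y / x
    qx≤Y : q * x ≤ Y
    qx≤Y = m/n*n≤m Y x
    lemma₁ : ∀ N m a b → N * m * (a * b) ≡ N * a * (b * m)
    lemma₁ = solve-∀
    lemma₂ : ∀ N q x x′ Y m → N * (1 + q) * (x * Y + x′ * x + m) ≡
      N * (q * x * Y + (q * x * x′ + x * Y) + (x′ * x + m)) + N * q * m
    lemma₂ = solve-∀
    lemma₃ : ∀ N Y X m → N * (Y * Y + (Y * X + X * Y) + (m + m)) + Y * m ≡
      N * (Y * Y + 2 * (X * Y) + 2 * m) + Y * m + N * Y * m * 0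
    lemma₃ = solve-∀

  -- The first term is what N Y products spread evenly over the residues would give. The 6 collects
  -- three errors of at most 2 N Y m each: cross terms, by N X ≤ X² ≤ m; constant terms, by N ≤ Y;
  -- and the Y / N excess together with the diagonal.
  collisions≤ : m * collisions index residue ≤ N * Y * (N * Y) + 6 * m * (N * Y)
  collisions≤ = *-cancelˡ-≤ N (begin
    N * (m * collisions index residue)
      ≡⟨ *-assoc N m _ ⟨
    N * m * collisions index residue
      ≡⟨ cong (N * m *_) collisions≡ ⟩
    N * m * ∑ xs (λ x → ∑ xs λ x′ → pairs m s Y x x′)
      ≡⟨ trans (∑-cong xs λ x → ∑-*ˡ xs (N * m) _) (∑-*ˡ xs (N * m) _) ⟨
    ∑ xs (λ x → ∑ xs λ x′ → N * m * pairs m s Y x x′)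
      ≤⟨ ∑-mono xs (λ x∈ → ∑-mono xs λ x′∈ → pairs≤ x∈ x′∈) ⟩
    ∑ xs (λ x → ∑ xs λ x′ → B + N * Y * m * ⟦ x ≟ x′ ⟧)
      ≡⟨ ∑-cong xs (λ x → trans (∑-+ xs _ _) (cong₂ _+_ (trans (∑-const xs B) (cong (_* B) length≡N)) (∑-*ˡ xs (N * Y * m) _))) ⟩
    ∑ xs (λ x → N * B + N * Y * m * ∑ xs λ x′ → ⟦ x ≟ x′ ⟧)
      ≤⟨ ∑-mono xs (λ {x} _ → +-monoʳ-≤ (N * B) (*-monoʳ-≤ (N * Y * m)
           (∑-unique unique (x ≟_) λ _ _ p q → trans (sym p) q))) ⟩
    ∑ xs (λ x → N * B + N * Y * m * 1)
      ≡⟨ trans (∑-const xs _) (cong (_* (N * B + N * Y * m * 1)) length≡N) ⟩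
    N * (N * B + N * Y * m * 1)
      ≡⟨ cong (N *_) (lemma₁ N Y m X) ⟩
    N * (N * Y * (N * Y) + (2 * (N * (N * X) * Y) + 2 * (N * N * m) + 2 * (N * Y * m)))
      ≤⟨ *-monoʳ-≤ N (+-monoʳ-≤ (N * Y * (N * Y)) (+-monoˡ-≤ (2 * (N * Y * m)) (+-mono-≤
           (*-monoʳ-≤ 2 (*-monoˡ-≤ Y (*-monoʳ-≤ N (≤-trans (*-monoˡ-≤ X N≤X) X²≤m))))
           (*-monoʳ-≤ 2 (*-monoˡ-≤ m (*-monoʳ-≤ N N≤Y)))))) ⟩
    N * (N * Y * (N * Y) + (2 * (N * m * Y) + 2 * (N * Y * m) + 2 * (N * Y * m)))
      ≡⟨ cong (N *_) (lemma₂ N Y m) ⟩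
    N * (N * Y * (N * Y) + 6 * m * (N * Y)) ∎)
    where
    lemma₁ : ∀ N Y m X → N * (N * (Y * Y + 2 * (X * Y) + 2 * m) + Y * m) + N * Y * m * 1 ≡
      N * Y * (N * Y) + (2 * (N * (N * X) * Y) + 2 * (N * N * m) + 2 * (N * Y * m))
    lemma₁ = solve-∀
    lemma₂ : ∀ N Y m → N * Y * (N * Y) + (2 * (N * m * Y) + 2 * (N * Y * m) + 2 * (N * Y * m)) ≡
      N * Y * (N * Y) + 6 * m * (N * Y)
    lemma₂ = solve-∀

  missed≤ : missed m index residue * (N * Y) ≤ 6 * m * m
  missed≤ = *-cancelʳ-≤ _ _ (N * Y) (+-cancelʳ-≤ (m * (V * V)) _ _ (begin
    U * V * V + m * (V * V)    ≡⟨ cong (_+ m * (V * V)) (*-assoc U V V) ⟩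
    U * (V * V) + m * (V * V)  ≤⟨ moment ⟩
    m * m * collisions index residue ≡⟨ *-assoc m m _ ⟩
    m * (m * collisions index residue) ≤⟨ *-monoʳ-≤ m collisions≤ ⟩
    m * (V * V + 6 * m * V)    ≡⟨ lemma m V ⟩
    6 * m * m * V + m * (V * V) ∎))
    where
    V = N * Y
    U = missed m index residue

    instance
      V≢0 : NonZero (N * Y)
      V≢0 = m*n≢0 N Y {{it}} {{>-nonZero (<-≤-trans (>-nonZero⁻¹ N) N≤Y)}}

    moment : U * (V * V) + m * (V * V) ≤ m * m * collisions index residue
    moment = subst (λ V → U * (V * V) + m * (V * V) ≤ m * m * collisions index residue) length-index
      (second-moment m index residue λ {j} _ → m%n<n (proj₁ j * (s + proj₂ j)) m)

    lemma : ∀ m V → m * (V * V + 6 * m * V) ≡ 6 * m * m * V + m * (V * V)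
    lemma = solve-∀

-- Chebyshev's lower bound for the number of primes

absorption : ∀ n k → suc k * (suc n choose suc k) ≡ suc n * (n choose k)
absorption zero    zero    = refl
absorption zero    (suc k) = *-zeroʳ (suc (suc k))
absorption (suc n) zero    = trans (*-identityˡ _) (trans (nC1≡n (suc (suc n))) (sym (*-identityʳ _)))
absorption (suc n) (suc k) = begin
  suc (suc k) * (suc (suc n) choose suc (suc k))
    ≡⟨ cong (suc (suc k) *_) (nCk+nC[k+1]≡[n+1]C[k+1] (suc n) (suc k)) ⟨
  suc (suc k) * (a + b)
    ≡⟨ lemma (suc k) a b ⟩
  suc k * a + suc (suc k) * b + a
    ≡⟨ cong (_+ a) (cong₂ _+_ (absorption n k) (absorption n (suc k))) ⟩
  suc n * (n choose k) + suc n * (n choose suc k) + a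
    ≡⟨ cong (_+ a) (*-distribˡ-+ (suc n) (n choose k) (n choose suc k)) ⟨
  suc n * (n choose k + n choose suc k) + a
    ≡⟨ cong (λ c → suc n * c + a) (nCk+nC[k+1]≡[n+1]C[k+1] n k) ⟩
  suc n * a + a
    ≡⟨ +-comm _ a ⟩
  suc (suc n) * a ∎
  where
  open ≡-Reasoning
  a = suc n choose suc k
  b = suc n choose suc (suc k)
  lemma : ∀ k a b → suc k * (a + b) ≡ k * a + suc k * b + a
  lemma = solve-∀

-- The denominators of Leibniz's harmonic triangle.
leibniz : ℕ → ℕ → ℕ
leibniz n k = suc n * (n choose k)

-- 1 / leibniz (suc n) (suc k) ≡ 1 / leibniz n k - 1 / leibniz (suc n) k
leibniz-rule : ∀ n k → let a = leibniz n k; b = leibniz (suc n) k; c = leibniz (suc n) (suc k) in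
               c * a + a * b ≡ c * b
leibniz-rule n k = begin
  c * a + a * b
    ≡⟨ lemma₁ (suc (suc n)) (suc n choose k) (suc n choose suc k) a ⟩
  a * (suc (suc n) * (suc n choose k + suc n choose suc k))
    ≡⟨ cong₂ (λ a e → a * (suc (suc n) * e)) (sym (absorption n k)) (nCk+nC[k+1]≡[n+1]C[k+1] (suc n) k) ⟩
  suc k * (suc n choose suc k) * (suc (suc n) * (suc (suc n) choose suc k))
    ≡⟨ lemma₂ (suc k) (suc (suc n)) (suc n choose suc k) (suc (suc n) choose suc k) ⟩
  c * (suc k * (suc (suc n) choose suc k))
    ≡⟨ cong (c *_) (absorption (suc n) k) ⟩
  c * b ∎
  where
  open ≡-Reasoning
  a = leibniz n k
  b = leibniz (suc n) k
  c = leibniz (suc n) (suc k)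
  lemma₁ : ∀ n u v a → n * v * a + a * (n * u) ≡ a * (n * (u + v))
  lemma₁ = solve-∀
  lemma₂ : ∀ k n v w → k * v * (n * w) ≡ n * v * (k * w)
  lemma₂ = solve-∀

-- By the rule of the triangle, D / c = D / a - D / b is a difference of integers once a and b
-- divide D; the induction starts from the edge entries n + 1.
leibniz∣ : ∀ {D} .{{_ : NonZero D}} n k → k ≤ n →
           (∀ {i} → 1 ≤ i → i ≤ suc n → i ∣ D) → leibniz n k ∣ D
leibniz∣ {D} n zero _ div = subst (_∣ D) (sym (*-identityʳ (suc n))) (div (s≤s z≤n) ≤-refl)
leibniz∣ {D} (suc n) (suc k) (s≤s k≤n) div
  with leibniz∣ n k k≤n (λ p q → div p (m≤n⇒m≤1+n q)) | leibniz∣ (suc n) k (m≤n⇒m≤1+n k≤n) div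
... | divides q₁ eq₁ | divides q₂ eq₂ = divides (q₁ ∸ q₂) (sym (*-cancelʳ-≡ _ _ (a * b) (begin
  (q₁ ∸ q₂) * c * (a * b)
    ≡⟨ trans (*-assoc (q₁ ∸ q₂) c _) (*-distribʳ-∸ (c * (a * b)) q₁ q₂) ⟩
  q₁ * (c * (a * b)) ∸ q₂ * (c * (a * b)) ≡⟨ cong₂ _∸_ (lemma₁ q₁ a b c) (lemma₂ q₂ a b c) ⟩
  q₁ * a * (c * b) ∸ q₂ * b * (c * a) ≡⟨ cong₂ (λ d e → d * (c * b) ∸ e * (c * a)) eq₁ eq₂ ⟨
  D * (c * b) ∸ D * (c * a)          ≡⟨ *-distribˡ-∸ D (c * b) (c * a) ⟨
  D * (c * b ∸ c * a)                ≡⟨ cong (λ e → D * (e ∸ c * a)) (leibniz-rule n k) ⟨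
  D * (c * a + a * b ∸ c * a)        ≡⟨ cong (D *_) (m+n∸m≡n (c * a) (a * b)) ⟩
  D * (a * b)                        ∎)))
  where
  open ≡-Reasoning
  a = leibniz n k
  b = leibniz (suc n) k
  c = leibniz (suc n) (suc k)
  lemma₁ : ∀ q a b c → q * (c * (a * b)) ≡ q * a * (c * b)
  lemma₁ = solve-∀
  lemma₂ : ∀ q a b c → q * (c * (a * b)) ≡ q * b * (c * a)
  lemma₂ = solve-∀
  instance
    ab≢0 : NonZero (a * b)
    ab≢0 = m*n≢0 a b {{m*n≢0⇒n≢0 q₁ {{subst NonZero eq₁ it}}}} {{m*n≢0⇒n≢0 q₂ {{subst NonZero eq₂ it}}}}

2^k≤[2k]Ck : ∀ k → 2 ^ k ≤ (2 * k) choose k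
2^k≤[2k]Ck zero    = ≤-refl
2^k≤[2k]Ck (suc k) = begin
  2 ^ k + (2 ^ k + 0)
    ≤⟨ +-mono-≤ (2^k≤[2k]Ck k) (≤-trans (≤-reflexive (+-identityʳ _)) (2^k≤[2k]Ck k)) ⟩
  (2 * k) choose k + (2 * k) choose k
    ≤⟨ +-mono-≤ (left k) (≤-trans (m≤m+n _ _) (≤-reflexive (nCk+nC[k+1]≡[n+1]C[k+1] (2 * k) k))) ⟩
  suc (2 * k) choose k + suc (2 * k) choose suc k       ≡⟨ nCk+nC[k+1]≡[n+1]C[k+1] (suc (2 * k)) k ⟩
  suc (suc (2 * k)) choose suc k                   ≡⟨ cong (λ n → n choose suc k) (*-suc 2 k) ⟨
  (2 * suc k) choose suc k                         ∎
  where
  open ≤-Reasoning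
  left : ∀ {n} k → n choose k ≤ suc n choose k
  left zero    = ≤-refl
  left {n} (suc k) = ≤-trans (m≤n+m _ (n choose k)) (≤-reflexive (nCk+nC[k+1]≡[n+1]C[k+1] n k))

-- Nair's argument: the central entry of row 2k of the triangle divides D.
2^k≤common-multiple : ∀ {D} .{{_ : NonZero D}} k →
  (∀ {i} → 1 ≤ i → i ≤ suc (2 * k) → i ∣ D) → 2 ^ k ≤ D
2^k≤common-multiple k div = ≤-trans (2^k≤[2k]Ck k) (≤-trans (m≤m+n _ _)
  (∣⇒≤ (leibniz∣ (2 * k) k (m≤m+n k _) div)))

-- The common source of the floors below: of log₂ m, of √m, of logarithms to other bases, and of the
-- integer just below a rational.
last : {P : ℕ → Set} → (∀ n → Dec (P n)) → P 0 → ∀ M → ¬ P M → ∃ λ j → j < M × P j × ¬ P (suc j)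
last P? p0 zero    ¬p = contradiction p0 ¬p
last P? p0 (suc M) ¬p with P? M
... | yes p = M , ≤-refl , p , ¬p
... | no ¬p′ = let (j , j< , rest) = last P? p0 M ¬p′ in j , m≤n⇒m≤1+n j< , rest

n<2^n : ∀ n → n < 2 ^ n
n<2^n zero    = s≤s z≤n
n<2^n (suc n) = +-mono-≤ (≤-trans (s≤s z≤n) (n<2^n n)) (≤-trans (n<2^n n) (m≤m+n _ 0))

^-monoʳ-∣ : ∀ p {a b} → a ≤ b → p ^ a ∣ p ^ b
^-monoʳ-∣ p {a} {b} a≤b = divides (p ^ (b ∸ a))
  (trans (cong (p ^_) (sym (m∸n+n≡m a≤b))) (^-distribˡ-+-* p (b ∸ a) a))

largest-power : ∀ p X .{{_ : NonTrivial p}} .{{_ : NonZero X}} →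
                ∃ λ e → p ^ e ≤ X × (∀ a → p ^ a ≤ X → p ^ a ∣ p ^ e)
largest-power p X = let (e , _ , e≤ , e+1≰) = last (λ e → p ^ e ≤? X) (>-nonZero⁻¹ X) X (<⇒≱ X<p^X) in
  e , e≤ , λ a a≤ → ^-monoʳ-∣ p {a} {e} (≮⇒≥ λ e<a → e+1≰ (≤-trans (^-monoʳ-≤ p {{nonTrivial⇒nonZero p}} e<a) a≤))
  where
  X<p^X : X < p ^ X
  X<p^X = <-≤-trans (n<2^n X) (^-monoˡ-≤ X (nonTrivial⇒n>1 p))

remove-factor : ∀ p .{{_ : NonTrivial p}} n .{{_ : NonZero n}} → ∃₂ λ a n′ → n ≡ p ^ a * n′ × ¬ p ∣ n′
remove-factor p n = <-rec R step n
  where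
  R : ℕ → Set
  R n = .{{NonZero n}} → ∃₂ λ a n′ → n ≡ p ^ a * n′ × ¬ p ∣ n′

  step : ∀ n → (∀ {k} → k < n → R k) → R n
  step n rec with p ∣? n
  ... | no p∤n = 0 , n , sym (*-identityˡ n) , p∤n
  ... | yes p∣n with rec (quotient-< p∣n) {{quotient≢0 p∣n}}
  ... | a , n′ , eq , p∤n′ = suc a , n′ ,
    trans (m∣n⇒n≡m*quotient p∣n) (trans (cong (p *_) eq) (sym (*-assoc p (p ^ a) n′))) , p∤n′

prime-divisor : ∀ n .{{_ : NonZero n}} → n ≢ 1 → ∃ λ p → Prime p × p ∣ n
prime-divisor n n≢1 with factorise n
... | record { factors = [] ; isFactorisation = eq } = contradiction eq n≢1
... | record { factors = p ∷ ps ; isFactorisation = eq ; factorsPrime = p-prime ∷ _ } =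
  p , p-prime , divides (product ps) (trans eq (*-comm p (product ps)))

-- D is the product of the largest powers ≤ X of the primes in the list.
common-multiple : ∀ X .{{_ : NonZero X}} ps → All Prime ps →
  ∃ λ D → NonZero D × D ≤ X ^ length ps ×
    (∀ {i} → .{{NonZero i}} → i ≤ X → (∀ {q} → Prime q → q ∣ i → q ∈ ps) → i ∣ D)
common-multiple X [] [] = 1 , it , ≤-refl , λ {i} i≤X factors → divisor i factors
  where
  divisor : ∀ i .{{_ : NonZero i}} → (∀ {q} → Prime q → q ∣ i → q ∈ []) → i ∣ 1
  divisor i factors with i ≟ 1
  ... | yes refl = ∣-refl
  ... | no i≢1 with prime-divisor i i≢1
  ... | q , q-prime , q∣i with factors q-prime q∣i
  ... | ()
common-multiple X (p ∷ ps) (p-prime ∷ primes) =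
  let (D , D≢0 , D≤ , div) = common-multiple X ps primes
      (e , e≤ , largest) = largest-power p X {{prime⇒nonTrivial p-prime}}
  in p ^ e * D , m*n≢0 (p ^ e) D {{m^n≢0 p e {{prime⇒nonZero p-prime}}}} {{D≢0}} ,
     *-mono-≤ e≤ D≤ , λ {i} i≤X factors →
       let (a , i′ , eq , p∤i′) = remove-factor p {{prime⇒nonTrivial p-prime}} i
           i′≢0 : NonZero i′
           i′≢0 = m*n≢0⇒n≢0 (p ^ a) {{subst NonZero eq it}}
           p^a≢0 : NonZero (p ^ a)
           p^a≢0 = m*n≢0⇒m≢0 (p ^ a) {{subst NonZero eq it}}
       in subst (_∣ p ^ e * D) (sym eq) (*-pres-∣
            (largest a (≤-trans (m≤m*n (p ^ a) i′ {{i′≢0}}) (≤-trans (≤-reflexive (sym eq)) i≤X)))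
            (div {{i′≢0}} (≤-trans (m≤n*m i′ (p ^ a) {{p^a≢0}}) (≤-trans (≤-reflexive (sym eq)) i≤X))
              λ q-prime q∣i′ → remaining p∤i′ q∣i′
                (factors q-prime (subst (_ ∣_) (sym eq) (∣n⇒∣m*n (p ^ a) q∣i′)))))
  where
  remaining : ∀ {q i′} → ¬ p ∣ i′ → q ∣ i′ → q ∈ p ∷ ps → q ∈ ps
  remaining p∤i′ q∣i′ (here refl) = contradiction q∣i′ p∤i′
  remaining p∤i′ q∣i′ (there q∈) = q∈

∑-filter : {A : Set} {P : A → Set} (P? : ∀ x → Dec (P x)) (xs : List A) →
           ∑ xs (λ x → ⟦ P? x ⟧) ≡ length (filter P? xs)
∑-filter P? [] = refl
∑-filter P? (x ∷ xs) with P? x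
... | yes _ = cong suc (∑-filter P? xs)
... | no _  = ∑-filter P? xs

length-cover : {A : Set} {P Q R : A → Set}
  (P? : ∀ x → Dec (P x)) (Q? : ∀ x → Dec (Q x)) (R? : ∀ x → Dec (R x)) (xs : List A) →
  (∀ x → P x ⊎ Q x ⊎ R x) →
  length xs ≤ length (filter P? xs) + (length (filter Q? xs) + length (filter R? xs))
length-cover P? Q? R? xs cover = begin
  length xs                                             ≡⟨ ∑-length xs ⟨
  ∑ xs (λ _ → 1)                                        ≤⟨ ∑-mono xs (λ {x} _ → one x (cover x)) ⟩
  ∑ xs (λ x → ⟦ P? x ⟧ + (⟦ Q? x ⟧ + ⟦ R? x ⟧))
    ≡⟨ trans (∑-+ xs _ _) (cong₂ _+_ (∑-filter P? xs)
                                                             (trans (∑-+ xs _ _) (cong₂ _+_ (∑-filter Q? xs) (∑-filter R? xs)))) ⟩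
  length (filter P? xs) + (length (filter Q? xs) + length (filter R? xs)) ∎
  where
  open ≤-Reasoning
  one : ∀ x → _ → 1 ≤ ⟦ P? x ⟧ + (⟦ Q? x ⟧ + ⟦ R? x ⟧)
  one x (inj₁ p)        = subst (λ b → 1 ≤ b + (⟦ Q? x ⟧ + ⟦ R? x ⟧)) (sym (⟦⟧-true (P? x) p)) (s≤s z≤n)
  one x (inj₂ (inj₁ q)) = subst (λ b → 1 ≤ ⟦ P? x ⟧ + (b + ⟦ R? x ⟧)) (sym (⟦⟧-true (Q? x) q)) (≤-trans (m≤m+n 1 ⟦ R? x ⟧) (m≤n+m _ ⟦ P? x ⟧))
  one x (inj₂ (inj₂ r)) = subst (λ b → 1 ≤ ⟦ P? x ⟧ + (⟦ Q? x ⟧ + b)) (sym (⟦⟧-true (R? x) r))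
    (≤-trans (m≤n+m _ ⟦ Q? x ⟧) (m≤n+m _ ⟦ P? x ⟧))

^-cancelʳ-≤ : ∀ b {m n} → 1 < b → b ^ m ≤ b ^ n → m ≤ n
^-cancelʳ-≤ b 1<b le = ≮⇒≥ λ n<m → <⇒≱ (^-monoʳ-< b 1<b n<m) le

prime-∤⇒coprime : ∀ {p n} → Prime p → ¬ p ∣ n → Coprime p n
prime-∤⇒coprime p-prime p∤n (d∣p , d∣n) with prime⇒irreducible p-prime d∣p
... | inj₁ d≡1  = d≡1
... | inj₂ refl = contradiction d∣n p∤n

primes-coprime : ∀ {p q} → Prime p → Prime q → p ≢ q → Coprime p q
primes-coprime p-prime q-prime p≢q = prime-∤⇒coprime p-prime λ p∣q →
  [ (λ { refl → ¬prime[1] p-prime }) , p≢q ]′ (prime⇒irreducible q-prime p∣q)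

-- Dividing n by p keeps the other primes as divisors, and every p is at least 2. Applied to m, this
-- bounds by log₂ m the number of primes lost by avoiding the divisors of m.
2^length≤ : ∀ ps n .{{_ : NonZero n}} → Unique ps → All Prime ps → All (_∣ n) ps → 2 ^ length ps ≤ n
2^length≤ [] n _ _ _ = >-nonZero⁻¹ n
2^length≤ (p ∷ ps) n (p∉ ∷ unique) (p-prime ∷ primes) (p∣n ∷ divs) = begin
  2 * 2 ^ length ps   ≤⟨ *-mono-≤ (nonTrivial⇒n>1 p {{prime⇒nonTrivial p-prime}})
                          (2^length≤ ps (quotient p∣n) {{quotient≢0 p∣n}} unique primes
                            (All.tabulate λ {q} q∈ → coprime-divisor
                              (primes-coprime (All.lookup primes q∈) p-prime (All.lookup p∉ q∈ ∘ sym))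
                              (subst (q ∣_) (m∣n⇒n≡m*quotient p∣n) (All.lookup divs q∈)))) ⟩
  p * quotient p∣n    ≡⟨ m∣n⇒n≡m*quotient p∣n ⟨
  n                   ∎
  where open ≤-Reasoning

primesUpTo : ℕ → List ℕ
primesUpTo X = filter prime? (upTo (suc X))

primesUpTo-prime : ∀ X → All Prime (primesUpTo X)
primesUpTo-prime X = All.all-filter prime? (upTo (suc X))

-- A common multiple of 1, ..., 2 k + 1 built from one prime power at most X for each prime lies
-- between the two sides. With k near X / 2 this is π(X) ≫ X / log X.
2^k≤X^π[X] : ∀ k X → suc (2 * k) ≤ X → 2 ^ k ≤ X ^ length (primesUpTo X)
2^k≤X^π[X] k X@(suc _) 2k<X =
  let (D , D≢0 , D≤ , div) = common-multiple X (primesUpTo X) (primesUpTo-prime X) in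
  ≤-trans (2^k≤common-multiple {{D≢0}} k λ {i} 1≤i i≤ →
    div {{>-nonZero 1≤i}} (≤-trans i≤ 2k<X) λ q-prime q∣i →
      ∈-filter⁺ prime? (∈-upTo⁺ (s≤s (≤-trans (∣⇒≤ {{>-nonZero 1≤i}} q∣i) (≤-trans i≤ 2k<X)))) q-prime) D≤

-- Chebyshev's bound provides more than 2 K + l primes up to X. Discarding at most K + 1 that are
-- not above K and at most l that divide m leaves K.
primes-avoiding : ∀ m .{{_ : NonZero m}} l X K k →
  m < 2 ^ suc l → X < 2 ^ suc l → suc (2 * k) ≤ X → suc l * (2 * K + l) < k →
  ∃ λ xs → Unique xs × length xs ≡ K ×
    (∀ {x} → x ∈ xs → Prime x × K ≤ x × x ≤ X × ¬ x ∣ m)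
primes-avoiding m l X K k m< X< 2k<X few<k =
  take K gs , take⁺ K (filter⁺ good? ps-unique) ,
  trans (List.length-take K gs) (m≤n⇒m⊓n≡m K≤) , λ x∈ →
    let (x∈ps , K< , x∤m) = ∈-filter⁻ good? {xs = ps} (take-⊆ K gs x∈)
        (x∈up , x-prime) = ∈-filter⁻ prime? {xs = upTo (suc X)} x∈ps
    in x-prime , <⇒≤ K< , s≤s⁻¹ (∈-upTo⁻ x∈up) , x∤m
  where
  ps = primesUpTo X

  ps-unique : Unique ps
  ps-unique = filter⁺ prime? (upTo⁺ (suc X))

  good? : ∀ x → Dec (K < x × ¬ x ∣ m)
  good? x = (K <? x) ×-dec ¬? (x ∣? m)

  gs = filter good? ps
  small = filter (_≤? K) ps
  dividing = filter (_∣? m) ps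

  take-⊆ : ∀ n (xs : List ℕ) {x} → x ∈ take n xs → x ∈ xs
  take-⊆ (suc n) (x ∷ xs) (here eq)  = here eq
  take-⊆ (suc n) (x ∷ xs) (there x∈) = there (take-⊆ n xs x∈)

  k≤ : k ≤ suc l * length ps
  k≤ = ^-cancelʳ-≤ 2 ≤-refl (begin
    2 ^ k                     ≤⟨ 2^k≤X^π[X] k X 2k<X ⟩
    X ^ length ps             ≤⟨ ^-monoˡ-≤ (length ps) (<⇒≤ X<) ⟩
    (2 ^ suc l) ^ length ps   ≡⟨ ^-*-assoc 2 (suc l) (length ps) ⟩
    2 ^ (suc l * length ps)   ∎)
    where open ≤-Reasoning

  cover : ∀ x → (K < x × ¬ x ∣ m) ⊎ x ≤ K ⊎ x ∣ m
  cover x with x ≤? K | x ∣? m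
  ... | yes x≤K | _       = inj₂ (inj₁ x≤K)
  ... | no _    | yes x∣m = inj₂ (inj₂ x∣m)
  ... | no x≰K  | no x∤m  = inj₁ (≰⇒> x≰K , x∤m)

  small≤ : length small ≤ suc K
  small≤ = ≤-trans (length-⊆ _≟_ (filter⁺ (_≤? K) ps-unique)
      (λ x∈ → ∈-upTo⁺ (s≤s (proj₂ (∈-filter⁻ (_≤? K) {xs = ps} x∈)))))
    (≤-reflexive (List.length-upTo (suc K)))

  dividing≤ : length dividing ≤ l
  dividing≤ = s≤s⁻¹ (≰⇒> λ l< → <⇒≱ m< (≤-trans (^-monoʳ-≤ 2 l<)
    (2^length≤ dividing m (filter⁺ (_∣? m) ps-unique)
      (All.filter⁺ (_∣? m) (primesUpTo-prime X)) (All.all-filter (_∣? m) ps))))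

  K≤ : K ≤ length gs
  K≤ = ≮⇒≥ λ gs<K → <⇒≱ few<k (≤-trans k≤ (*-monoʳ-≤ (suc l) (begin
    length ps                                     ≤⟨ length-cover good? (_≤? K) (_∣? m) ps cover ⟩
    length gs + (length small + length dividing)
      ≤⟨ +-monoʳ-≤ (length gs) (+-mono-≤ small≤ dividing≤) ⟩
    length gs + (suc K + l)                       ≡⟨ lemma (length gs) K l ⟩
    suc (length gs) + K + l                       ≤⟨ +-monoˡ-≤ l (+-monoˡ-≤ K gs<K) ⟩
    K + K + l                                     ≡⟨ cong (λ k → K + k + l) (+-identityʳ K) ⟨
    2 * K + l                                     ∎)))
    where
    open ≤-Reasoning
    lemma : ∀ g K l → g + (suc K + l) ≡ suc g + K + l
    lemma = solve-∀

-- Size parameters and the count of missed residues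

16[l+1]⁴≤2^l : ∀ l → 120 ≤ l → 4 * (suc l * suc l) * (4 * (suc l * suc l)) ≤ 2 ^ l
16[l+1]⁴≤2^l l 120≤l = begin
  4 * (suc l * suc l) * (4 * (suc l * suc l))
    ≤⟨ *-mono-≤ (*-monoʳ-≤ 4 (*-mono-≤ l<8b l<8b)) (*-monoʳ-≤ 4 (*-mono-≤ l<8b l<8b)) ⟩
  4 * (8 * b * (8 * b)) * (4 * (8 * b * (8 * b)))
    ≡⟨ lemma₁ b ⟩
  (16 * b * (16 * b)) * (16 * b * (16 * b))
    ≤⟨ *-mono-≤ (*-mono-≤ 16b≤b² 16b≤b²) (*-mono-≤ 16b≤b² 16b≤b²) ⟩
  (b * b * (b * b)) * (b * b * (b * b))
    ≡⟨ lemma₂ b ⟩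
  b ^ 8
    ≤⟨ ^-monoˡ-≤ 8 (n<2^n q) ⟩
  (2 ^ q) ^ 8
    ≡⟨ ^-*-assoc 2 q 8 ⟩
  2 ^ (q * 8)
    ≤⟨ ^-monoʳ-≤ 2 (m/n*n≤m l 8) ⟩
  2 ^ l ∎
  where
  open ≤-Reasoning
  -- Here b ≤ 2^q gives b⁸ ≤ 2^l, while l < 8 b; and l ≥ 120 = 8 · 15 makes b ≥ 16, which absorbs
  -- the constant 16⁴.
  q = l / 8
  b = suc q
  lemma₁ : ∀ b → 4 * (8 * b * (8 * b)) * (4 * (8 * b * (8 * b))) ≡ (16 * b * (16 * b)) * (16 * b * (16 * b))
  lemma₁ = solve-∀
  lemma₂ : ∀ b → (b * b * (b * b)) * (b * b * (b * b)) ≡ b * (b * (b * (b * (b * (b * (b * (b * 1)))))))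
  lemma₂ = solve-∀
  l<8b : l < 8 * b
  l<8b = begin-strict
    l               ≡⟨ m≡m%n+[m/n]*n l 8 ⟩
    l % 8 + q * 8   <⟨ +-monoˡ-< (q * 8) (m%n<n l 8) ⟩
    8 + q * 8       ≡⟨ *-comm b 8 ⟩
    8 * b           ∎
  16b≤b² : 16 * b ≤ b * b
  16b≤b² = *-monoˡ-≤ b (s≤s (/-monoˡ-≤ 8 120≤l))

record Size (m l X : ℕ) : Set where
  field
    2^l≤m   : 2 ^ l ≤ m
    m<2^1+l : m < 2 ^ suc l
    X²≤m    : X * X ≤ m
    m<[1+X]² : m < suc X * suc X
    120≤l   : 120 ≤ l

module Sieve {m l X : ℕ} (size : Size m l X) where
  open Size size
  open ≤-Reasoning

  4[l+1]²≤X : 4 * (suc l * suc l) ≤ X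
  4[l+1]²≤X = ≮⇒≥ λ X< → <⇒≱ m<[1+X]² (≤-trans (*-mono-≤ X< X<) (≤-trans (16[l+1]⁴≤2^l l 120≤l) 2^l≤m))

  32l≤X : 32 * l ≤ X
  32l≤X = begin
    32 * l                  ≤⟨ *-monoʳ-≤ 32 (n≤1+n l) ⟩
    32 * suc l              ≡⟨ *-assoc 4 8 (suc l) ⟩
    4 * (8 * suc l)
      ≤⟨ *-monoʳ-≤ 4 (*-monoˡ-≤ (suc l) (≤-trans (m≤m+n 8 112) (≤-trans 120≤l (n≤1+n l)))) ⟩
    4 * (suc l * suc l)     ≤⟨ 4[l+1]²≤X ⟩
    X                       ∎

  instance
    l≢0 : NonZero l
    l≢0 = >-nonZero (<-≤-trans (s≤s z≤n) 120≤l)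

    32l≢0 : NonZero (32 * l)
    32l≢0 = m*n≢0 32 l

    X≢0 : NonZero X
    X≢0 = >-nonZero (<-≤-trans (>-nonZero⁻¹ (32 * l)) 32l≤X)

    m≢0 : NonZero m
    m≢0 = >-nonZero (<-≤-trans (>-nonZero⁻¹ (2 ^ l) {{m^n≢0 2 l}}) 2^l≤m)

  X<2^1+l : X < 2 ^ suc l
  X<2^1+l = ≤-<-trans (m≤m*n X X) (≤-<-trans X²≤m m<2^1+l)

  m≤4X² : m ≤ 4 * (X * X)
  m≤4X² = begin
    m                 ≤⟨ <⇒≤ m<[1+X]² ⟩
    suc X * suc X     ≤⟨ *-mono-≤ 1+X≤2X 1+X≤2X ⟩
    (X + X) * (X + X) ≡⟨ lemma X ⟩
    4 * (X * X)       ∎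
    where
    1+X≤2X : suc X ≤ X + X
    1+X≤2X = +-monoˡ-≤ X (>-nonZero⁻¹ X)
    lemma : ∀ X → (X + X) * (X + X) ≡ 4 * (X * X)
    lemma = solve-∀

  K : ℕ
  K = X / (32 * l)

  instance
    K≢0 : NonZero K
    K≢0 = >-nonZero (m≥n⇒m/n>0 32l≤X)

  K≤X : K ≤ X
  K≤X = m/n≤m X (32 * l)

  X≤64lK : X ≤ 64 * l * K
  X≤64lK = begin
    X                                  ≡⟨ m≡m%n+[m/n]*n X (32 * l) ⟩
    X % (32 * l) + K * (32 * l)        ≤⟨ +-monoˡ-≤ (K * (32 * l)) (<⇒≤ (m%n<n X (32 * l))) ⟩
    32 * l + K * (32 * l)              ≤⟨ +-monoˡ-≤ (K * (32 * l)) (m≤n*m (32 * l) K) ⟩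
    K * (32 * l) + K * (32 * l)        ≡⟨ lemma K l ⟩
    64 * l * K                         ∎
    where
    lemma : ∀ K l → K * (32 * l) + K * (32 * l) ≡ 64 * l * K
    lemma = solve-∀

  k : ℕ
  k = suc (suc l * (2 * K + l))

  -- The divisor 32 l in K is chosen for this: the terms with K come to at most X / 4, the remaining
  -- ones, quadratic in l, to at most X / 2.
  2k<X : suc (2 * k) ≤ X
  2k<X = *-cancelˡ-≤ 4 (begin
    4 * suc (2 * k)                                     ≡⟨ lemma₁ l K ⟩
    16 * l * K + 16 * K + (8 * suc l * l + 12)
      ≤⟨ +-mono-≤ (+-monoʳ-≤ (16 * l * K) (*-monoˡ-≤ K (m≤m*n 16 l))) (+-monoʳ-≤ (8 * suc l * l) 12≤) ⟩
    16 * l * K + 16 * l * K + (8 * suc l * l + 8 * suc l) ≡⟨ lemma₂ l K ⟩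
    K * (32 * l) + 2 * (4 * (suc l * suc l))
      ≤⟨ +-mono-≤ (m/n*n≤m X (32 * l)) (*-monoʳ-≤ 2 4[l+1]²≤X) ⟩
    X + 2 * X                                           ≤⟨ m≤n+m _ X ⟩
    4 * X                                               ∎)
    where
    lemma₁ : ∀ l K → 4 * suc (2 * suc (suc l * (2 * K + l))) ≡ 16 * l * K + 16 * K + (8 * suc l * l + 12)
    lemma₁ = solve-∀
    lemma₂ : ∀ l K → 16 * l * K + 16 * l * K + (8 * suc l * l + 8 * suc l) ≡ K * (32 * l) + 2 * (4 * (suc l * suc l))
    lemma₂ = solve-∀
    12≤ : 12 ≤ 8 * suc l
    12≤ = *-mono-≤ (m≤m+n 6 2) (s≤s (>-nonZero⁻¹ l))

  FewMissed : ℕ → ℕ → Set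
  FewMissed s t =
    ∃ λ js → (∀ {x y} → (x , y) ∈ js → 1 ≤ x × x ≤ X × y < X * t) ×
             missed m js (λ (x , y) → (x * (s + y)) % m) * t ≤ 1536 * l * m

  few-missed : ∀ s t .{{_ : NonZero t}} → FewMissed s t
  few-missed s t = found
    (primes-avoiding m l X K k m<2^1+l X<2^1+l 2k<X ≤-refl)
    where
    found : (∃ λ xs → Unique xs × length xs ≡ K ×
               (∀ {x} → x ∈ xs → Prime x × K ≤ x × x ≤ X × ¬ x ∣ m)) → FewMissed s t
    found (xs , unique , length≡ , good) = index , in-range , bound
      where
      open Multiples m s X (X * t) K xs unique length≡
        (λ x∈ → proj₁ (proj₂ (good x∈))) (λ x∈ → proj₁ (proj₂ (proj₂ (good x∈))))
        (λ x∈ → prime-∤⇒coprime (proj₁ (good x∈)) (proj₂ (proj₂ (proj₂ (good x∈)))))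
        (λ x∈ x′∈ → primes-coprime (proj₁ (good x∈)) (proj₁ (good x′∈)))
        X²≤m K≤X (≤-trans K≤X (m≤m*n X t))

      in-range : ∀ {x y} → (x , y) ∈ index → 1 ≤ x × x ≤ X × y < X * t
      in-range ∈ = let (x∈ , y∈) = ∈-cartesianProduct⁻ xs (upTo (X * t)) ∈
                       (_ , K≤ , ≤X , _) = good x∈
                   in ≤-trans (>-nonZero⁻¹ K) K≤ , ≤X , ∈-upTo⁻ y∈

      U = missed m index residue

      -- 1536 = 4 · 64 · 6, from m ≤ 4 X², X ≤ 64 l K and the 6 in `missed≤`.
      bound : U * t ≤ 1536 * l * m
      bound = *-cancelʳ-≤ _ _ m (begin
        U * t * m                         ≤⟨ *-monoʳ-≤ (U * t) m≤4X² ⟩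
        U * t * (4 * (X * X))             ≤⟨ *-monoʳ-≤ (U * t) (*-monoʳ-≤ 4 (*-monoˡ-≤ X X≤64lK)) ⟩
        U * t * (4 * (64 * l * K * X))    ≡⟨ lemma₁ U t 64 l K X ⟩
        4 * 64 * l * (U * (K * (X * t)))  ≤⟨ *-monoʳ-≤ (256 * l) missed≤ ⟩
        4 * 64 * l * (6 * m * m)          ≡⟨ lemma₂ (4 * 64) l 6 m ⟩
        4 * 64 * 6 * l * m * m            ∎)
        where
        lemma₁ : ∀ U t c l K X → U * t * (4 * (c * l * K * X)) ≡ 4 * c * l * (U * (K * (X * t)))
        lemma₁ = solve-∀
        lemma₂ : ∀ c l d m → c * l * (d * m * m) ≡ c * d * l * m * m
        lemma₂ = solve-∀

open Sieve using (X≢0; m≢0; FewMissed; few-missed)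

-- From attained residues to members of the set

lookup-unique : {A : Set} {xs : List A} → Unique xs → Injective _≡_ _≡_ (lookup xs)
lookup-unique (x∉ ∷ u) {Fin.zero}  {Fin.zero}  eq = refl
lookup-unique (x∉ ∷ u) {Fin.zero}  {Fin.suc j} eq = contradiction eq (All.lookup x∉ (∈-lookup j))
lookup-unique (x∉ ∷ u) {Fin.suc i} {Fin.zero}  eq = contradiction (sym eq) (All.lookup x∉ (∈-lookup i))
lookup-unique (x∉ ∷ u) {Fin.suc i} {Fin.suc j} eq = cong Fin.suc (lookup-unique u eq)

-- Membership in A cannot be tested, so the list collects the residues at which a decidable
-- obstruction P fails.
distinct-members : ∀ {m} (A : Fin m → Set) {P : ℕ → Set} (P? : ∀ a → Dec (P a)) →
  (∀ {a} (a<m : a < m) → ¬ P a → A (fromℕ< a<m)) →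
  ∃ λ k → Distinct A k × m ≤ k + ∑ (upTo m) (λ a → ⟦ P? a ⟧)
distinct-members {m} A P? A∋ = length as ,
  ((λ i → fromℕ< (below i)) ,
   (λ {i} {j} eq → lookup-unique (filter⁺ (¬? ∘ P?) (upTo⁺ m)) (fromℕ<-injective _ _ (below i) (below j) eq)) ,
   λ i → A∋ (below i) (proj₂ (member i))) ,
  (begin
    m
      ≡⟨ trans (∑-length (upTo m)) (List.length-upTo m) ⟨
    ∑ (upTo m) (λ _ → 1)
      ≤⟨ ∑-mono (upTo m) (λ {a} _ → one a) ⟩
    ∑ (upTo m) (λ a → ⟦ ¬? (P? a) ⟧ + ⟦ P? a ⟧)                    ≡⟨ ∑-+ (upTo m) _ _ ⟩
    ∑ (upTo m) (λ a → ⟦ ¬? (P? a) ⟧) + ∑ (upTo m) (λ a → ⟦ P? a ⟧)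
      ≡⟨ cong (_+ ∑ (upTo m) λ a → ⟦ P? a ⟧) (∑-filter (¬? ∘ P?) (upTo m)) ⟩
    length as + ∑ (upTo m) (λ a → ⟦ P? a ⟧)                        ∎)
  where
  open ≤-Reasoning
  as = filter (¬? ∘ P?) (upTo m)

  member : ∀ i → lookup as i ∈ upTo m × ¬ _
  member i = ∈-filter⁻ (¬? ∘ P?) {xs = upTo m} (∈-lookup i)

  below : ∀ i → lookup as i < m
  below i = ∈-upTo⁻ (proj₁ (member i))

  one : ∀ a → 1 ≤ ⟦ ¬? (P? a) ⟧ + ⟦ P? a ⟧
  one a with P? a
  ... | yes _ = ≤-refl
  ... | no _  = ≤-refl

∑⟦⟧≢0 : {A : Set} {P : A → Set} (P? : ∀ x → Dec (P x)) (xs : List A) →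
        ∑ xs (λ x → ⟦ P? x ⟧) ≢ 0 → ∃ λ x → x ∈ xs × P x
∑⟦⟧≢0 P? []       ≢0 = contradiction refl ≢0
∑⟦⟧≢0 P? (x ∷ xs) ≢0 with P? x
... | yes p = x , here refl , p
... | no _  = let (y , y∈ , p) = ∑⟦⟧≢0 P? xs ≢0 in y , there y∈ , p

-- Replacing z by its residue s changes the product by a multiple of m. The counting therefore works
-- with natural numbers and is uniform in the start of the interval.
shifted-residue : ∀ m .{{_ : NonZero m}} (z : ℤ) x y → let s = z ℤ.%ℕ m in
  m ∣ ℤ.∣ pos x ℤ.* (z ℤ.+ pos y) ℤ.- pos ((x * (s + y)) % m) ∣
shifted-residue m z x y = divides ℤ.∣ c ∣ (begin
  ℤ.∣ pos x ℤ.* (z ℤ.+ pos y) ℤ.- pos r ∣                             ≡⟨ cong ℤ.∣_∣ difference ⟩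
  ℤ.∣ c ℤ.* pos m ∣                                               ≡⟨ ℤ.abs-* c (pos m) ⟩
  ℤ.∣ c ∣ * m                                                   ∎)
  where
  open ≡-Reasoning
  s = z ℤ.%ℕ m
  n = x * (s + y)
  r = n % m
  q = z ℤ./ℕ m
  c = pos (n / m) ℤ.+ pos x ℤ.* q

  expand : pos x ℤ.* (pos s ℤ.+ pos y) ≡ pos r ℤ.+ pos (n / m) ℤ.* pos m
  expand = begin
    pos x ℤ.* (pos s ℤ.+ pos y)          ≡⟨ cong (pos x ℤ.*_) (ℤ.pos-+ s y) ⟨
    pos x ℤ.* pos (s + y)              ≡⟨ ℤ.pos-* x (s + y) ⟨
    pos n                            ≡⟨ cong pos (m≡m%n+[m/n]*n n m) ⟩
    pos (r + n / m * m)              ≡⟨ ℤ.pos-+ r _ ⟩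
    pos r ℤ.+ pos (n / m * m)          ≡⟨ cong (λ e → pos r ℤ.+ e) (ℤ.pos-* (n / m) m) ⟩
    pos r ℤ.+ pos (n / m) ℤ.* pos m      ∎

  lemma₁ : ∀ x s y q m r → x ℤ.* (s ℤ.+ q ℤ.* m ℤ.+ y) ℤ.- r ≡ x ℤ.* (s ℤ.+ y) ℤ.- r ℤ.+ x ℤ.* q ℤ.* m
  lemma₁ = solveℤ-∀
  lemma₂ : ∀ x q m r d → r ℤ.+ d ℤ.* m ℤ.- r ℤ.+ x ℤ.* q ℤ.* m ≡ (d ℤ.+ x ℤ.* q) ℤ.* m
  lemma₂ = solveℤ-∀

  difference : pos x ℤ.* (z ℤ.+ pos y) ℤ.- pos r ≡ c ℤ.* pos m
  difference = begin
    pos x ℤ.* (z ℤ.+ pos y) ℤ.- pos r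
      ≡⟨ cong (λ z → pos x ℤ.* (z ℤ.+ pos y) ℤ.- pos r) (ℤ.a≡a%ℕn+[a/ℕn]*n z m) ⟩
    pos x ℤ.* (pos s ℤ.+ q ℤ.* pos m ℤ.+ pos y) ℤ.- pos r
      ≡⟨ lemma₁ (pos x) (pos s) (pos y) q (pos m) (pos r) ⟩
    pos x ℤ.* (pos s ℤ.+ pos y) ℤ.- pos r ℤ.+ pos x ℤ.* q ℤ.* pos m
      ≡⟨ cong (λ e → e ℤ.- pos r ℤ.+ pos x ℤ.* q ℤ.* pos m) expand ⟩
    pos r ℤ.+ pos (n / m) ℤ.* pos m ℤ.- pos r ℤ.+ pos x ℤ.* q ℤ.* pos m
      ≡⟨ lemma₂ (pos x) q (pos m) (pos r) (pos (n / m)) ⟩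
    c ℤ.* pos m ∎

-- The two range hypotheses are the whole interface between the counting and the real numbers of the
-- statement.
many-products : ∀ {m l X} → Size m l X → ∀ t .{{_ : NonZero t}} ε S →
  (∀ {x} → x ≤ X → fromℕ x ≤ᴿ √ᴿ (fromℕ m)) →
  (∀ {y} → y < X * t → fromℤ (S ℤ.+ 1ℤ ℤ.+ pos y) ≤ᴿ
     fromℤ S +ᴿ √ᴿ (fromℕ m) *ᴿ logᴿ (fromℕ m) ^ᴿ (fromℕ 2 +ᴿ ε)) →
  ∃₂ λ k U → Distinct (ProductResidues ε m S) k × m ≤ k + U × U * t ≤ 1536 * l * m
many-products {m} {l} {X} size t ε S x-ok y-ok = from-pairs (few-missed size s t)
  where
  instance
    m≢0′ : NonZero m
    m≢0′ = m≢0 size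

  s = (S ℤ.+ 1ℤ) ℤ.%ℕ m

  c : ℕ × ℕ → ℕ
  c (x , y) = (x * (s + y)) % m

  from-pairs : FewMissed size s t →
    ∃₂ λ k U → Distinct (ProductResidues ε m S) k × m ≤ k + U × U * t ≤ 1536 * l * m
  from-pairs (js , in-range , bound) =
    let (k , list , m≤) = distinct-members (ProductResidues ε m S) (λ a → ∑ js (λ j → ⟦ c j ≟ a ⟧) ≟ 0) covered
    in k , missed m js c , list , m≤ , bound
    where
    attained : ∀ {a} (a<m : a < m) → (∃ λ j → j ∈ js × c j ≡ a) → ProductResidues ε m S (fromℕ< a<m)
    attained a<m ((x , y) , j∈ , refl) =
      let (1≤x , x≤X , y<) = in-range j∈ in
      pos x , S ℤ.+ 1ℤ ℤ.+ pos y ,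
      (ℤ.+≤+ 1≤x , x-ok x≤X) ,
      (ℤ.i≤i+j (S ℤ.+ 1ℤ) (pos y) , y-ok y<) ,
      subst (λ r → m ∣ ℤ.∣ pos x ℤ.* (S ℤ.+ 1ℤ ℤ.+ pos y) ℤ.- pos r ∣) (sym (toℕ-fromℕ< a<m))
        (shifted-residue m (S ℤ.+ 1ℤ) x y)

    covered : ∀ {a} (a<m : a < m) → ∑ js (λ j → ⟦ c j ≟ a ⟧) ≢ 0 → ProductResidues ε m S (fromℕ< a<m)
    covered {a} a<m hit = attained a<m (∑⟦⟧≢0 (λ j → c j ≟ a) js hit)

-- Rational arithmetic and compound interest

ℚ-ring : ACR.AlmostCommutativeRing 0ℓ 0ℓ
ℚ-ring = ACR.fromCommutativeRing ℚ.+-*-commutativeRing isZero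
  where
  isZero : ∀ x → Maybe (0ℚ ≡ x)
  isZero x with 0ℚ ℚ.≟ x
  ... | yes eq = just eq
  ... | no _   = nothing

ι : ℤ → ℚ
ι n = n ℚ./ 1

ιᵘ : ∀ n → ℚ.toℚᵘ (ι n) ℚᵘ.≃ ℚᵘ.mkℚᵘ n 0
ιᵘ n = ℚ.toℚᵘ-fromℚᵘ (ℚᵘ.mkℚᵘ n 0)

ι-mono-≤ : ∀ {a b} → a ℤ.≤ b → ι a ℚ.≤ ι b
ι-mono-≤ {a} {b} a≤b = ℚ.toℚᵘ-cancel-≤ (ℚᵘ.≤-respˡ-≃ (ℚᵘ.≃-sym (ιᵘ a)) (ℚᵘ.≤-respʳ-≃ (ℚᵘ.≃-sym (ιᵘ b))
  (ℚᵘ.*≤* (ℤ.*-monoʳ-≤-nonNeg 1ℤ a≤b))))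

ι-mono-< : ∀ {a b} → a ℤ.< b → ι a ℚ.< ι b
ι-mono-< {a} {b} a<b = ℚ.toℚᵘ-cancel-< (ℚᵘ.<-respˡ-≃ (ℚᵘ.≃-sym (ιᵘ a)) (ℚᵘ.<-respʳ-≃ (ℚᵘ.≃-sym (ιᵘ b))
  (ℚᵘ.*<* (ℤ.*-monoʳ-<-pos 1ℤ a<b))))

ι-+ : ∀ a b → ι (a ℤ.+ b) ≡ ι a ℚ.+ ι b
ι-+ a b = ℚ.toℚᵘ-injective (ℚᵘ.≃-trans (ιᵘ (a ℤ.+ b)) (ℚᵘ.≃-trans
  (ℚᵘ.*≡* (cong (ℤ._* 1ℤ) (sym (cong₂ ℤ._+_ (ℤ.*-identityʳ a) (ℤ.*-identityʳ b)))))
  (ℚᵘ.≃-sym (ℚᵘ.≃-trans (ℚ.toℚᵘ-homo-+ (ι a) (ι b)) (ℚᵘ.+-cong (ιᵘ a) (ιᵘ b))))))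

ι-* : ∀ a b → ι (a ℤ.* b) ≡ ι a ℚ.* ι b
ι-* a b = ℚ.toℚᵘ-injective (ℚᵘ.≃-trans (ιᵘ (a ℤ.* b))
  (ℚᵘ.≃-sym (ℚᵘ.≃-trans (ℚ.toℚᵘ-homo-* (ι a) (ι b)) (ℚᵘ.*-cong (ιᵘ a) (ιᵘ b)))))

ℕ→ℚ : ℕ → ℚ
ℕ→ℚ n = ι (pos n)

ℕ→ℚ-mono-≤ : ∀ {a b} → a ≤ b → ℕ→ℚ a ℚ.≤ ℕ→ℚ b
ℕ→ℚ-mono-≤ a≤b = ι-mono-≤ (ℤ.+≤+ a≤b)

ℕ→ℚ-mono-< : ∀ {a b} → a < b → ℕ→ℚ a ℚ.< ℕ→ℚ b
ℕ→ℚ-mono-< a<b = ι-mono-< (ℤ.+<+ a<b)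

ℕ→ℚ-+ : ∀ a b → ℕ→ℚ (a + b) ≡ ℕ→ℚ a ℚ.+ ℕ→ℚ b
ℕ→ℚ-+ a b = trans (cong ι (ℤ.pos-+ a b)) (ι-+ (pos a) (pos b))

ℕ→ℚ-* : ∀ a b → ℕ→ℚ (a * b) ≡ ℕ→ℚ a ℚ.* ℕ→ℚ b
ℕ→ℚ-* a b = trans (cong ι (ℤ.pos-* a b)) (ι-* (pos a) (pos b))

0≤ℕ→ℚ : ∀ n → 0ℚ ℚ.≤ ℕ→ℚ n
0≤ℕ→ℚ n = ℕ→ℚ-mono-≤ {0} {n} z≤n

inv : ℕ → ℚ
inv k = 1ℤ ℚ./ suc k

inv-pos : ∀ k → 0ℚ ℚ.< inv k
inv-pos k = ℚ.positive⁻¹ (inv k) {{ℚ.normalize-pos 1 (suc k)}}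

0≤inv : ∀ k → 0ℚ ℚ.≤ inv k
0≤inv k = ℚ.<⇒≤ (inv-pos k)

suc*inv : ∀ k → ℕ→ℚ (suc k) ℚ.* inv k ≡ 1ℚ
suc*inv k = ℚ.toℚᵘ-injective (ℚᵘ.≃-trans (ℚ.toℚᵘ-homo-* (ℕ→ℚ (suc k)) (inv k)) (ℚᵘ.≃-trans
  (ℚᵘ.*-cong (ιᵘ (pos (suc k))) (ℚ.toℚᵘ-fromℚᵘ (ℚᵘ.mkℚᵘ 1ℤ k)))
  (ℚᵘ.*≡* (trans (ℤ.*-identityʳ _) (trans (ℤ.*-identityʳ _) (trans (cong (λ n → pos (suc n)) (sym (+-identityʳ k))) (sym (ℤ.*-identityˡ _))))))))

*-monoˡ-≤₀ : ∀ {a b c} → 0ℚ ℚ.≤ c → a ℚ.≤ b → c ℚ.* a ℚ.≤ c ℚ.* b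
*-monoˡ-≤₀ {c = c} 0≤c = ℚ.*-monoˡ-≤-nonNeg c {{ℚ.nonNegative 0≤c}}

*-monoʳ-≤₀ : ∀ {a b c} → 0ℚ ℚ.≤ c → a ℚ.≤ b → a ℚ.* c ℚ.≤ b ℚ.* c
*-monoʳ-≤₀ {c = c} 0≤c = ℚ.*-monoʳ-≤-nonNeg c {{ℚ.nonNegative 0≤c}}

*-mono-≤₀ : ∀ {a b c d} → 0ℚ ℚ.≤ a → a ℚ.≤ b → 0ℚ ℚ.≤ c → c ℚ.≤ d → a ℚ.* c ℚ.≤ b ℚ.* d
*-mono-≤₀ 0≤a a≤b 0≤c c≤d = ℚ.≤-trans (*-monoʳ-≤₀ 0≤c a≤b) (*-monoˡ-≤₀ (ℚ.≤-trans 0≤a a≤b) c≤d)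

*-monoˡ-<₀ : ∀ {a b c} → 0ℚ ℚ.< c → a ℚ.< b → c ℚ.* a ℚ.< c ℚ.* b
*-monoˡ-<₀ {c = c} 0<c = ℚ.*-monoʳ-<-pos c {{ℚ.positive 0<c}}

*-monoʳ-<₀ : ∀ {a b c} → 0ℚ ℚ.< c → a ℚ.< b → a ℚ.* c ℚ.< b ℚ.* c
*-monoʳ-<₀ {c = c} 0<c = ℚ.*-monoˡ-<-pos c {{ℚ.positive 0<c}}

0≤* : ∀ {a b} → 0ℚ ℚ.≤ a → 0ℚ ℚ.≤ b → 0ℚ ℚ.≤ a ℚ.* b
0≤* {a} {b} 0≤a 0≤b = ℚ.≤-trans (ℚ.≤-reflexive (sym (ℚ.*-zeroʳ a))) (*-monoˡ-≤₀ 0≤a 0≤b)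

0<* : ∀ {a b} → 0ℚ ℚ.< a → 0ℚ ℚ.< b → 0ℚ ℚ.< a ℚ.* b
0<* {a} {b} 0<a 0<b = ℚ.≤-<-trans (ℚ.≤-reflexive (sym (ℚ.*-zeroʳ a))) (*-monoˡ-<₀ 0<a 0<b)

*-cancelʳ-≤₀ : ∀ {a b c} → 0ℚ ℚ.< c → a ℚ.* c ℚ.≤ b ℚ.* c → a ℚ.≤ b
*-cancelʳ-≤₀ {c = c} 0<c = ℚ.*-cancelʳ-≤-pos c {{ℚ.positive 0<c}}

a≤b⇒0≤b-a : ∀ {a b} → a ℚ.≤ b → 0ℚ ℚ.≤ b ℚ.- a
a≤b⇒0≤b-a {a} {b} a≤b = ℚ.≤-trans (ℚ.≤-reflexive (sym (ℚ.+-inverseʳ a))) (ℚ.+-monoˡ-≤ (ℚ.- a) a≤b)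

0≤b-a⇒a≤b : ∀ {a b} → 0ℚ ℚ.≤ b ℚ.- a → a ℚ.≤ b
0≤b-a⇒a≤b {a} {b} 0≤ = ℚ.≤-trans (ℚ.≤-reflexive (sym (ℚ.+-identityˡ a)))
  (ℚ.≤-trans (ℚ.+-monoˡ-≤ a 0≤) (ℚ.≤-reflexive (lemma a b)))
  where
  lemma : ∀ a b → b ℚ.- a ℚ.+ a ≡ b
  lemma = Solver.solve-∀ ℚ-ring

a<b⇒0<b-a : ∀ {a b} → a ℚ.< b → 0ℚ ℚ.< b ℚ.- a
a<b⇒0<b-a {a} {b} a<b = ℚ.≤-<-trans (ℚ.≤-reflexive (sym (ℚ.+-inverseʳ a))) (ℚ.+-monoˡ-< (ℚ.- a) a<b)

0≤a² : ∀ a → 0ℚ ℚ.≤ a ℚ.* a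
0≤a² a with ℚ.≤-total 0ℚ a
... | inj₁ 0≤a = 0≤* 0≤a 0≤a
... | inj₂ a≤0 = ℚ.≤-trans (0≤* 0≤-a 0≤-a) (ℚ.≤-reflexive (lemma a))
  where
  0≤-a = ℚ.neg-antimono-≤ a≤0
  lemma : ∀ a → ℚ.- a ℚ.* ℚ.- a ≡ a ℚ.* a
  lemma = Solver.solve-∀ ℚ-ring

archimedean : ∀ x → ∃ λ n → x ℚ.≤ ℕ→ℚ n
archimedean x@record{} = ℤ.∣ ℚ.↥ x ∣ , ℚ.toℚᵘ-cancel-≤ (ℚᵘ.≤-respʳ-≃ (ℚᵘ.≃-sym (ιᵘ (pos ℤ.∣ ℚ.↥ x ∣)))
  (bound (ℚ.toℚᵘ x)))
  where
  bound : ∀ y → y ℚᵘ.≤ ℚᵘ.mkℚᵘ (pos ℤ.∣ ℚᵘ.↥ y ∣) 0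
  bound (ℚᵘ.mkℚᵘ (pos n) d) = ℚᵘ.*≤* (ℤ.*-monoˡ-≤-nonNeg (pos n) (ℤ.+≤+ (s≤s z≤n)))
  bound (ℚᵘ.mkℚᵘ ℤ.-[1+ n ] d) = ℚᵘ.*≤* ℤ.-≤+

archimedean-* : ∀ x {δ} → 0ℚ ℚ.< δ → ∃ λ n → x ℚ.≤ ℕ→ℚ n ℚ.* δ
archimedean-* x {δ} 0<δ =
  let instance
        δ-pos = ℚ.positive 0<δ
        δ≢0 = ℚ.pos⇒nonZero δ
      (n , x/δ≤n) = archimedean (x ℚ.* (ℚ.1/ δ))
  in n , ℚ.≤-trans (ℚ.≤-reflexive (trans (sym (ℚ.*-identityʳ x)) (trans (cong (x ℚ.*_) (sym (ℚ.*-inverseˡ δ))) (sym (ℚ.*-assoc x _ δ)))))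
    (*-monoʳ-≤₀ (ℚ.<⇒≤ 0<δ) x/δ≤n)

ceiling : ∀ {a} → 0ℚ ℚ.< a → ∃ λ t → ℕ→ℚ t ℚ.< a × a ℚ.≤ ℕ→ℚ (suc t)
ceiling {a} 0<a =
  let (n , a≤n) = archimedean a
      (t , _ , t<a , ≮) = last (λ t → ℕ→ℚ t ℚ.<? a) 0<a n (λ n<a → ℚ.<-irrefl refl (ℚ.<-≤-trans n<a a≤n))
  in t , t<a , ℚ.≮⇒≥ ≮

module ℚ^ = Exp (CommutativeRing.commutativeSemiring ℚ.+-*-commutativeRing)

0≤^ : ∀ {x} n → 0ℚ ℚ.≤ x → 0ℚ ℚ.≤ x ^ℚ n
0≤^ zero    0≤x = ℕ→ℚ-mono-≤ {0} {1} z≤n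
0≤^ (suc n) 0≤x = 0≤* 0≤x (0≤^ n 0≤x)

0<^ : ∀ {x} n → 0ℚ ℚ.< x → 0ℚ ℚ.< x ^ℚ n
0<^ zero    0<x = ℕ→ℚ-mono-< {0} {1} (s≤s z≤n)
0<^ (suc n) 0<x = 0<* 0<x (0<^ n 0<x)

^ℚ-mono-≤ : ∀ {x y} n → 0ℚ ℚ.≤ x → x ℚ.≤ y → x ^ℚ n ℚ.≤ y ^ℚ n
^ℚ-mono-≤ zero    0≤x x≤y = ℚ.≤-refl
^ℚ-mono-≤ (suc n) 0≤x x≤y = *-mono-≤₀ 0≤x x≤y (0≤^ n 0≤x) (^ℚ-mono-≤ n 0≤x x≤y)

1^n : ∀ n → 1ℚ ^ℚ n ≡ 1ℚ
1^n zero    = refl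
1^n (suc n) = trans (ℚ.*-identityˡ _) (1^n n)

ℕ→ℚ-^ : ∀ b n → ℕ→ℚ (b ^ n) ≡ ℕ→ℚ b ^ℚ n
ℕ→ℚ-^ b zero    = refl
ℕ→ℚ-^ b (suc n) = trans (ℕ→ℚ-* b (b ^ n)) (cong (ℕ→ℚ b ℚ.*_) (ℕ→ℚ-^ b n))

bernoulli : ∀ n {σ} → 0ℚ ℚ.≤ 1ℚ ℚ.+ σ → 1ℚ ℚ.+ ℕ→ℚ n ℚ.* σ ℚ.≤ (1ℚ ℚ.+ σ) ^ℚ n
bernoulli zero    {σ} 0≤ = ℚ.≤-reflexive (trans (cong (1ℚ ℚ.+_) (ℚ.*-zeroˡ σ)) (ℚ.+-identityʳ 1ℚ))
bernoulli (suc n) {σ} 0≤ = begin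
  1ℚ ℚ.+ ℕ→ℚ (suc n) ℚ.* σ                              ≡⟨ cong (λ k → 1ℚ ℚ.+ k ℚ.* σ) (ℕ→ℚ-+ 1 n) ⟩
  1ℚ ℚ.+ (1ℚ ℚ.+ ℕ→ℚ n) ℚ.* σ
    ≤⟨ 0≤b-a⇒a≤b (ℚ.≤-trans (0≤* (0≤ℕ→ℚ n) (0≤a² σ)) (ℚ.≤-reflexive (lemma (ℕ→ℚ n) σ))) ⟩
  (1ℚ ℚ.+ σ) ℚ.* (1ℚ ℚ.+ ℕ→ℚ n ℚ.* σ)                   ≤⟨ *-monoˡ-≤₀ 0≤ (bernoulli n 0≤) ⟩
  (1ℚ ℚ.+ σ) ℚ.* (1ℚ ℚ.+ σ) ^ℚ n                        ∎
  where
  open ℚ.≤-Reasoning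
  lemma : ∀ n σ → n ℚ.* (σ ℚ.* σ) ≡ (1ℚ ℚ.+ σ) ℚ.* (1ℚ ℚ.+ n ℚ.* σ) ℚ.- (1ℚ ℚ.+ (1ℚ ℚ.+ n) ℚ.* σ)
  lemma = Solver.solve-∀ ℚ-ring

-- The approximations of eᵖ from below and of e⁻ᵖ from below that define expᴿ.
compound : ℚ → ℕ → ℚ
compound p k = (1ℚ ℚ.+ p ℚ.* inv k) ^ℚ suc k

discount : ℚ → ℕ → ℚ
discount p k = (1ℚ ℚ.- p ℚ.* inv k) ^ℚ suc k

compound-mono : ∀ {p q} k → 0ℚ ℚ.≤ 1ℚ ℚ.+ p ℚ.* inv k → p ℚ.≤ q → compound p k ℚ.≤ compound q k
compound-mono k 0≤ p≤q = ^ℚ-mono-≤ (suc k) 0≤ (ℚ.+-monoʳ-≤ 1ℚ (*-monoʳ-≤₀ (0≤inv k) p≤q))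

-- By Bernoulli both bases are at most powers of 1 ± p / (k n).
compound*discount≤1 : ∀ p k n → 0ℚ ℚ.≤ 1ℚ ℚ.+ p ℚ.* inv k → 0ℚ ℚ.≤ 1ℚ ℚ.- p ℚ.* inv n →
                      compound p k ℚ.* discount p n ℚ.≤ 1ℚ
compound*discount≤1 p k n 0≤a 0≤b = begin
  a ^ℚ K ℚ.* b ^ℚ N
    ≤⟨ *-mono-≤₀ (0≤^ K 0≤a) (^ℚ-mono-≤ K 0≤a a≤) (0≤^ N 0≤b) (^ℚ-mono-≤ N 0≤b b≤) ⟩
  ((1ℚ ℚ.+ σ) ^ℚ N) ^ℚ K ℚ.* ((1ℚ ℚ.+ ℚ.- σ) ^ℚ K) ^ℚ N
    ≡⟨ cong₂ ℚ._*_ (ℚ^.^-assocʳ (1ℚ ℚ.+ σ) N K) (trans (ℚ^.^-assocʳ (1ℚ ℚ.+ ℚ.- σ) K N) (cong ((1ℚ ℚ.+ ℚ.- σ) ^ℚ_) (*-comm K N))) ⟩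
  (1ℚ ℚ.+ σ) ^ℚ (N * K) ℚ.* (1ℚ ℚ.+ ℚ.- σ) ^ℚ (N * K)
    ≡⟨ ℚ^.^-distrib-* (1ℚ ℚ.+ σ) (1ℚ ℚ.+ ℚ.- σ) (N * K) ⟨
  ((1ℚ ℚ.+ σ) ℚ.* (1ℚ ℚ.+ ℚ.- σ)) ^ℚ (N * K)
    ≤⟨ ^ℚ-mono-≤ {y = 1ℚ} (N * K) (0≤* 0≤1+σ 0≤1-σ) (0≤b-a⇒a≤b {(1ℚ ℚ.+ σ) ℚ.* (1ℚ ℚ.+ ℚ.- σ)} {1ℚ} (ℚ.≤-trans (0≤a² σ) (ℚ.≤-reflexive (lemma σ)))) ⟩
  1ℚ ^ℚ (N * K)
    ≡⟨ 1^n (N * K) ⟩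
  1ℚ ∎
  where
  open ℚ.≤-Reasoning
  K = suc k
  N = suc n
  a = 1ℚ ℚ.+ p ℚ.* inv k
  b = 1ℚ ℚ.- p ℚ.* inv n
  σ = p ℚ.* inv k ℚ.* inv n

  lemma : ∀ σ → σ ℚ.* σ ≡ 1ℚ ℚ.- (1ℚ ℚ.+ σ) ℚ.* (1ℚ ℚ.+ ℚ.- σ)
  lemma = Solver.solve-∀ ℚ-ring
  expand : ∀ c x y z → x ℚ.* y ≡ 1ℚ → c ≡ x ℚ.* (c ℚ.* y)
  expand c x y z eq = trans (sym (ℚ.*-identityʳ c)) (trans (cong (c ℚ.*_) (sym eq)) (rearrange c x y))
    where
    rearrange : ∀ c x y → c ℚ.* (x ℚ.* y) ≡ x ℚ.* (c ℚ.* y)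
    rearrange = Solver.solve-∀ ℚ-ring

  a≡ : a ≡ 1ℚ ℚ.+ ℕ→ℚ N ℚ.* σ
  a≡ = cong (1ℚ ℚ.+_) (expand (p ℚ.* inv k) (ℕ→ℚ N) (inv n) 1ℚ (suc*inv n))

  b≡ : b ≡ 1ℚ ℚ.+ ℕ→ℚ K ℚ.* ℚ.- σ
  b≡ = cong (1ℚ ℚ.+_) (trans (cong ℚ.-_ (expand (p ℚ.* inv n) (ℕ→ℚ K) (inv k) 1ℚ (suc*inv k))) (rearrange (ℕ→ℚ K) p (inv n) (inv k)))
    where
    rearrange : ∀ K p n k → ℚ.- (K ℚ.* (p ℚ.* n ℚ.* k)) ≡ K ℚ.* ℚ.- (p ℚ.* k ℚ.* n)
    rearrange = Solver.solve-∀ ℚ-ring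

  shrink : ∀ M {τ} → 0ℚ ℚ.≤ 1ℚ ℚ.+ ℕ→ℚ (suc M) ℚ.* τ → 0ℚ ℚ.≤ 1ℚ ℚ.+ τ
  shrink M {τ} 0≤ with ℚ.≤-total 0ℚ τ
  ... | inj₁ 0≤τ = ℚ.≤-trans 0≤τ (ℚ.≤-trans (ℚ.≤-reflexive (sym (ℚ.+-identityˡ τ))) (ℚ.+-monoˡ-≤ τ (0≤ℕ→ℚ 1)))
  ... | inj₂ τ≤0 = ℚ.≤-trans 0≤ (ℚ.+-monoʳ-≤ 1ℚ (ℚ.≤-trans
          (ℚ.*-monoʳ-≤-nonPos τ {{ℚ.nonPositive τ≤0}} (ℕ→ℚ-mono-≤ {1} {suc M} (s≤s z≤n))) (ℚ.≤-reflexive (ℚ.*-identityˡ τ))))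

  0≤1+σ : 0ℚ ℚ.≤ 1ℚ ℚ.+ σ
  0≤1+σ = shrink n (ℚ.≤-trans 0≤a (ℚ.≤-reflexive a≡))
  0≤1-σ : 0ℚ ℚ.≤ 1ℚ ℚ.+ ℚ.- σ
  0≤1-σ = shrink k (ℚ.≤-trans 0≤b (ℚ.≤-reflexive b≡))

  a≤ : a ℚ.≤ (1ℚ ℚ.+ σ) ^ℚ N
  a≤ = ℚ.≤-trans (ℚ.≤-reflexive a≡) (bernoulli N 0≤1+σ)
  b≤ : b ℚ.≤ (1ℚ ℚ.+ ℚ.- σ) ^ℚ K
  b≤ = ℚ.≤-trans (ℚ.≤-reflexive b≡) (bernoulli K 0≤1-σ)

0≤1+ : ∀ {x} → 0ℚ ℚ.≤ x → 0ℚ ℚ.≤ 1ℚ ℚ.+ x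
0≤1+ {x} 0≤x = ℚ.≤-trans 0≤x (ℚ.≤-trans (ℚ.≤-reflexive (sym (ℚ.+-identityˡ x))) (ℚ.+-monoˡ-≤ x (0≤ℕ→ℚ 1)))

-- The new number of periods is (j + 1)(n + 1), so Bernoulli compares one old period with n + 1 new
-- ones.
compound-refine : ∀ {v} j n → 0ℚ ℚ.≤ v → compound v j ℚ.≤ compound v (n + j * suc n)
compound-refine {v} j n 0≤v = begin
  (1ℚ ℚ.+ v ℚ.* inv j) ^ℚ J
    ≤⟨ ^ℚ-mono-≤ J (0≤1+ (0≤* 0≤v (0≤inv j))) (ℚ.≤-trans (ℚ.≤-reflexive (cong (1ℚ ℚ.+_) inv-eq)) (bernoulli N (0≤1+ (0≤* 0≤v (0≤inv (n + j * N)))))) ⟩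
  ((1ℚ ℚ.+ v ℚ.* inv (n + j * N)) ^ℚ N) ^ℚ J
    ≡⟨ trans (ℚ^.^-assocʳ b N J) (cong (b ^ℚ_) (*-comm N J)) ⟩
  (1ℚ ℚ.+ v ℚ.* inv (n + j * N)) ^ℚ (J * N) ∎
  where
  open ℚ.≤-Reasoning
  J = suc j
  N = suc n
  i = inv (n + j * N)
  b = 1ℚ ℚ.+ v ℚ.* i

  inv-eq : v ℚ.* inv j ≡ ℕ→ℚ N ℚ.* (v ℚ.* i)
  inv-eq = begin-equality
    v ℚ.* inv j                              ≡⟨ ℚ.*-identityʳ _ ⟨
    v ℚ.* inv j ℚ.* 1ℚ
      ≡⟨ cong (v ℚ.* inv j ℚ.*_) (trans (cong (ℚ._* i) (sym (ℕ→ℚ-* J N))) (suc*inv (n + j * N))) ⟨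
    v ℚ.* inv j ℚ.* (ℕ→ℚ J ℚ.* ℕ→ℚ N ℚ.* i)  ≡⟨ rearrange v (inv j) (ℕ→ℚ J) (ℕ→ℚ N) i ⟩
    ℕ→ℚ J ℚ.* inv j ℚ.* (ℕ→ℚ N ℚ.* (v ℚ.* i)) ≡⟨ cong (ℚ._* (ℕ→ℚ N ℚ.* (v ℚ.* i))) (suc*inv j) ⟩
    1ℚ ℚ.* (ℕ→ℚ N ℚ.* (v ℚ.* i))             ≡⟨ ℚ.*-identityˡ _ ⟩
    ℕ→ℚ N ℚ.* (v ℚ.* i)                      ∎
    where
    rearrange : ∀ v j J N i → v ℚ.* j ℚ.* (J ℚ.* N ℚ.* i) ≡ J ℚ.* j ℚ.* (N ℚ.* (v ℚ.* i))
    rearrange = Solver.solve-∀ ℚ-ring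

-- With period i, (1 - σ i)(1 + p i) ≥ 1 + w i as soon as σ p i ≤ p - σ - w. The strict gap thus
-- dictates the fineness: n₂ secures this inequality, n₁ keeps 1 - σ i non-negative.
balance : ∀ {p σ w} j → 0ℚ ℚ.≤ p → 0ℚ ℚ.≤ σ → 0ℚ ℚ.≤ w → σ ℚ.+ w ℚ.< p →
          ∃ λ n → 0ℚ ℚ.≤ 1ℚ ℚ.- σ ℚ.* inv n × compound w j ℚ.≤ discount σ n ℚ.* compound p n
balance {p} {σ} {w} j 0≤p 0≤σ 0≤w σ+w<p = k , 0≤1-σi , (begin
  compound w j                               ≤⟨ compound-refine j n 0≤w ⟩
  compound w k
    ≤⟨ ^ℚ-mono-≤ (suc k) (0≤1+ (0≤* 0≤w (0≤inv k))) factor ⟩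
  ((1ℚ ℚ.- σ ℚ.* i) ℚ.* (1ℚ ℚ.+ p ℚ.* i)) ^ℚ suc k
    ≡⟨ ℚ^.^-distrib-* (1ℚ ℚ.- σ ℚ.* i) (1ℚ ℚ.+ p ℚ.* i) (suc k) ⟩
  discount σ k ℚ.* compound p k              ∎)
  where
  open ℚ.≤-Reasoning
  δ = p ℚ.- (σ ℚ.+ w)
  0<δ : 0ℚ ℚ.< δ
  0<δ = a<b⇒0<b-a σ+w<p
  A₁ = archimedean σ
  A₂ = archimedean-* (σ ℚ.* p) 0<δ
  n₁ = proj₁ A₁
  n₂ = proj₁ A₂
  n = n₁ + n₂
  k = n + j * suc n
  i = inv k

  n≤k : n ≤ suc k
  n≤k = ≤-trans (m≤m+n n _) (n≤1+n k)

  0≤1-σi : 0ℚ ℚ.≤ 1ℚ ℚ.- σ ℚ.* i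
  0≤1-σi = a≤b⇒0≤b-a {σ ℚ.* i} {1ℚ} (begin
    σ ℚ.* i
      ≤⟨ *-monoʳ-≤₀ (0≤inv k) (ℚ.≤-trans (proj₂ A₁) (ℕ→ℚ-mono-≤ {n₁} {suc k} (≤-trans (m≤m+n n₁ n₂) n≤k))) ⟩
    ℕ→ℚ (suc k) ℚ.* i       ≡⟨ suc*inv k ⟩
    1ℚ                      ∎)

  σpi≤δ : σ ℚ.* p ℚ.* i ℚ.≤ δ
  σpi≤δ = begin
    σ ℚ.* p ℚ.* i
      ≤⟨ *-monoʳ-≤₀ (0≤inv k) (ℚ.≤-trans (proj₂ A₂) (*-monoʳ-≤₀ (ℚ.<⇒≤ 0<δ) (ℕ→ℚ-mono-≤ {n₂} {suc k} (≤-trans (m≤n+m n₂ n₁) n≤k)))) ⟩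
    ℕ→ℚ (suc k) ℚ.* δ ℚ.* i         ≡⟨ rearrange (ℕ→ℚ (suc k)) δ i ⟩
    ℕ→ℚ (suc k) ℚ.* i ℚ.* δ         ≡⟨ cong (ℚ._* δ) (suc*inv k) ⟩
    1ℚ ℚ.* δ                        ≡⟨ ℚ.*-identityˡ δ ⟩
    δ                               ∎
    where
    rearrange : ∀ a b c → a ℚ.* b ℚ.* c ≡ a ℚ.* c ℚ.* b
    rearrange = Solver.solve-∀ ℚ-ring

  factor : 1ℚ ℚ.+ w ℚ.* i ℚ.≤ (1ℚ ℚ.- σ ℚ.* i) ℚ.* (1ℚ ℚ.+ p ℚ.* i)
  factor = 0≤b-a⇒a≤b (ℚ.≤-trans (0≤* (a≤b⇒0≤b-a σpi≤δ) (0≤inv k)) (ℚ.≤-reflexive (lemma p σ w i)))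
    where
    lemma : ∀ p σ w i → (p ℚ.- (σ ℚ.+ w) ℚ.- σ ℚ.* p ℚ.* i) ℚ.* i ≡
            (1ℚ ℚ.- σ ℚ.* i) ℚ.* (1ℚ ℚ.+ p ℚ.* i) ℚ.- (1ℚ ℚ.+ w ℚ.* i)
    lemma = Solver.solve-∀ ℚ-ring

-- Exponentials and logarithms of cuts

upper-exp-pos : ∀ {x q} → upper (expᴿ x) q → 0ℚ ℚ.< q
upper-exp-pos {x} {q} (p , k , _ , 0≤t , 1<) = ℚ.≰⇒> λ q≤0 → ℚ.<-irrefl refl (begin-strict
  0ℚ                           <⟨ ℕ→ℚ-mono-< {0} {1} (s≤s z≤n) ⟩
  1ℚ                           <⟨ 1< ⟩
  q ℚ.* discount p k           ≤⟨ *-monoʳ-≤₀ (0≤^ (suc k) 0≤t) q≤0 ⟩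
  0ℚ ℚ.* discount p k          ≡⟨ ℚ.*-zeroˡ (discount p k) ⟩
  0ℚ                           ∎)
  where open ℚ.≤-Reasoning

-- In reals, e^(-σ) ≤ e^x for x ≥ -σ. Any witness p for d has -p ≤ σ, so its discount is at most a
-- compound of σ, whose product with `discount σ n` is at most 1.
discount≤upper-exp : ∀ {x d σ} n → upper (expᴿ x) d → (∀ p → upper x p → ℚ.- σ ℚ.≤ p) →
                     0ℚ ℚ.≤ 1ℚ ℚ.- σ ℚ.* inv n → discount σ n ℚ.≤ d
discount≤upper-exp {x} {d} {σ} n ud@(p , k , up , 0≤t , 1<) -σ≤ 0≤1-σi = begin
  discount σ n                               ≡⟨ ℚ.*-identityˡ _ ⟨
  1ℚ ℚ.* discount σ n                        ≤⟨ *-monoʳ-≤₀ (0≤^ (suc n) 0≤1-σi) (ℚ.<⇒≤ 1<) ⟩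
  d ℚ.* discount p k ℚ.* discount σ n        ≡⟨ ℚ.*-assoc d _ _ ⟩
  d ℚ.* (discount p k ℚ.* discount σ n)
    ≤⟨ *-monoˡ-≤₀ 0≤d (*-monoʳ-≤₀ (0≤^ (suc n) 0≤1-σi) (^ℚ-mono-≤ (suc k) 0≤t base≤)) ⟩
  d ℚ.* (compound σ k ℚ.* discount σ n)
    ≤⟨ *-monoˡ-≤₀ 0≤d (compound*discount≤1 σ k n (ℚ.≤-trans 0≤t base≤) 0≤1-σi) ⟩
  d ℚ.* 1ℚ                                   ≡⟨ ℚ.*-identityʳ d ⟩
  d                                          ∎
  where
  open ℚ.≤-Reasoning
  0≤d : 0ℚ ℚ.≤ d
  0≤d = ℚ.<⇒≤ (upper-exp-pos {x} ud)
  base≤ : 1ℚ ℚ.- p ℚ.* inv k ℚ.≤ 1ℚ ℚ.+ σ ℚ.* inv k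
  base≤ = ℚ.+-monoʳ-≤ 1ℚ (begin
    ℚ.- (p ℚ.* inv k)       ≤⟨ ℚ.neg-antimono-≤ (*-monoʳ-≤₀ (0≤inv k) (-σ≤ p up)) ⟩
    ℚ.- (ℚ.- σ ℚ.* inv k)   ≡⟨ lemma σ (inv k) ⟩
    σ ℚ.* inv k             ∎)
    where
    lemma : ∀ σ i → ℚ.- (ℚ.- σ ℚ.* i) ≡ σ ℚ.* i
    lemma = Solver.solve-∀ ℚ-ring

exp-cancel-< : ∀ {c d r s} → upper (expᴿ (fromℚ c)) r → lower (expᴿ (fromℚ d)) s → r ℚ.≤ s → c ℚ.< d
exp-cancel-< {c} {d} {r} {s} (p , k , c<p , 0≤t , 1<) (q , n , q<d , 0≤u , s<) r≤s = ℚ.≰⇒> λ d≤c →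
  let q≤p = ℚ.<⇒≤ (ℚ.<-trans q<d (ℚ.≤-<-trans d≤c c<p)) in
  ℚ.<-irrefl refl (begin-strict
    1ℚ                               <⟨ 1< ⟩
    r ℚ.* discount p k
      ≤⟨ *-monoʳ-≤₀ (0≤^ (suc k) 0≤t) (ℚ.≤-trans r≤s (ℚ.≤-trans (ℚ.<⇒≤ s<) (compound-mono n 0≤u q≤p))) ⟩
    compound p n ℚ.* discount p k
      ≤⟨ compound*discount≤1 p n k (ℚ.≤-trans 0≤u (ℚ.+-monoʳ-≤ 1ℚ (*-monoʳ-≤₀ (0≤inv n) q≤p))) 0≤t ⟩
    1ℚ                               ∎)
  where open ℚ.≤-Reasoning

-- The cut log log m is never shown to satisfy `IsReal`; this separation of its two sides stands in
-- for disjointness. The two exponentials are cancelled in turn.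
log-log-< : ∀ {m c d} → lower (logᴿ (logᴿ (fromℚ m))) c → upper (logᴿ (logᴿ (fromℚ m))) d → c ℚ.< d
log-log-< (r , exp-c<r , r₁ , exp-r<r₁ , r₁<m) (s , (s₁ , m<s₁ , s₁<exp-s) , s<exp-d) =
  exp-cancel-< exp-c<r s<exp-d (ℚ.<⇒≤ (exp-cancel-< exp-r<r₁ s₁<exp-s (ℚ.<⇒≤ (ℚ.<-trans r₁<m m<s₁))))

lower-exp-pos : ∀ {x p} → lower x p → ∃ λ c → 0ℚ ℚ.< c × lower (expᴿ x) c
lower-exp-pos {x} {p} lp =
  let (n , -p≤n) = archimedean (ℚ.- p)
      0<t = positive n -p≤n
      (c , 0<c , c<) = ℚ.<-dense (0<^ (suc n) 0<t)
  in c , 0<c , p , n , lp , ℚ.<⇒≤ 0<t , c<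
  where
  open ℚ.≤-Reasoning
  positive : ∀ n → ℚ.- p ℚ.≤ ℕ→ℚ n → 0ℚ ℚ.< 1ℚ ℚ.+ p ℚ.* inv n
  positive n -p≤n = begin-strict
    0ℚ
      <⟨ 0<* (a<b⇒0<b-a (ℚ.≤-<-trans -p≤n (ℕ→ℚ-mono-< {n} {suc n} ≤-refl))) (inv-pos n) ⟩
    (ℕ→ℚ (suc n) ℚ.- (ℚ.- p)) ℚ.* inv n        ≡⟨ lemma (ℕ→ℚ (suc n)) p (inv n) ⟩
    ℕ→ℚ (suc n) ℚ.* inv n ℚ.+ p ℚ.* inv n      ≡⟨ cong (ℚ._+ p ℚ.* inv n) (suc*inv n) ⟩
    1ℚ ℚ.+ p ℚ.* inv n                         ∎
    where
    lemma : ∀ a p i → (a ℚ.- (ℚ.- p)) ℚ.* i ≡ a ℚ.* i ℚ.+ p ℚ.* i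
    lemma = Solver.solve-∀ ℚ-ring

-- `_*ᴿ_` asks for a member on each side of each factor. Choosing the upper one above a prescribed r
-- provides the order between the ends of the box at once.
upper-exp-above : ∀ {x p} r → upper x p → ∃ λ q → r ℚ.≤ q × upper (expᴿ x) q
upper-exp-above {x} {p} r up =
  let (n , p≤n) = archimedean p
      0<t = positive n p≤n
      (a , 1≤a) = archimedean-* 1ℚ (0<^ (suc n) 0<t)
      (b , r≤b) = archimedean r
  in ℕ→ℚ (suc a + b) ,
     ℚ.≤-trans r≤b (ℕ→ℚ-mono-≤ {b} {suc a + b} (m≤n+m b (suc a))) ,
     p , n , up , ℚ.<⇒≤ 0<t ,
     ℚ.≤-<-trans 1≤a (*-monoʳ-<₀ (0<^ (suc n) 0<t) (ℕ→ℚ-mono-< {a} {suc a + b} (s≤s (m≤m+n a b))))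
  where
  open ℚ.≤-Reasoning
  positive : ∀ n → p ℚ.≤ ℕ→ℚ n → 0ℚ ℚ.< 1ℚ ℚ.- p ℚ.* inv n
  positive n p≤n = begin-strict
    0ℚ
      <⟨ 0<* (a<b⇒0<b-a (ℚ.≤-<-trans p≤n (ℕ→ℚ-mono-< {n} {suc n} ≤-refl))) (inv-pos n) ⟩
    (ℕ→ℚ (suc n) ℚ.- p) ℚ.* inv n              ≡⟨ lemma (ℕ→ℚ (suc n)) p (inv n) ⟩
    ℕ→ℚ (suc n) ℚ.* inv n ℚ.- p ℚ.* inv n      ≡⟨ cong (ℚ._- p ℚ.* inv n) (suc*inv n) ⟩
    1ℚ ℚ.- p ℚ.* inv n                         ∎
    where
    lemma : ∀ a p i → (a ℚ.- p) ℚ.* i ≡ a ℚ.* i ℚ.- p ℚ.* i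
    lemma = Solver.solve-∀ ℚ-ring

cancel-inv : ∀ k c → ℕ→ℚ (suc k) ℚ.* c ℚ.* inv k ≡ c
cancel-inv k c = begin
  ℕ→ℚ (suc k) ℚ.* c ℚ.* inv k       ≡⟨ lemma (ℕ→ℚ (suc k)) c (inv k) ⟩
  ℕ→ℚ (suc k) ℚ.* inv k ℚ.* c       ≡⟨ cong (ℚ._* c) (suc*inv k) ⟩
  1ℚ ℚ.* c                          ≡⟨ ℚ.*-identityˡ c ⟩
  c                                 ∎
  where
  open ≡-Reasoning
  lemma : ∀ K c i → K ℚ.* c ℚ.* i ≡ K ℚ.* i ℚ.* c
  lemma = Solver.solve-∀ ℚ-ring

compound-multiple : ∀ k c → compound (ℕ→ℚ (suc k) ℚ.* c) k ≡ (1ℚ ℚ.+ c) ^ℚ suc k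
compound-multiple k c = cong (λ x → (1ℚ ℚ.+ x) ^ℚ suc k) (cancel-inv k c)

discount-multiple : ∀ k c → discount (ℕ→ℚ (suc k) ℚ.* c) k ≡ (1ℚ ℚ.- c) ^ℚ suc k
discount-multiple k c = cong (λ x → (1ℚ ℚ.- x) ^ℚ suc k) (cancel-inv k c)

lower-exp-multiple : ∀ {x s} k c → 0ℚ ℚ.≤ c → ℕ→ℚ (suc k) ℚ.* c ℚ.< x → s ℚ.< (1ℚ ℚ.+ c) ^ℚ suc k →
                     lower (expᴿ (fromℚ x)) s
lower-exp-multiple {s = s} k c 0≤c p<x s< = ℕ→ℚ (suc k) ℚ.* c , k , p<x ,
  subst (λ y → 0ℚ ℚ.≤ 1ℚ ℚ.+ y) (sym (cancel-inv k c)) (0≤1+ 0≤c) ,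
  subst (s ℚ.<_) (sym (compound-multiple k c)) s<

upper-exp-multiple : ∀ {x} s k c → 0ℚ ℚ.≤ 1ℚ ℚ.- c → x ℚ.< ℕ→ℚ (suc k) ℚ.* c → 1ℚ ℚ.< s ℚ.* (1ℚ ℚ.- c) ^ℚ suc k →
                     upper (expᴿ (fromℚ x)) s
upper-exp-multiple s k c 0≤ x<p 1< = ℕ→ℚ (suc k) ℚ.* c , k , x<p ,
  subst (λ y → 0ℚ ℚ.≤ 1ℚ ℚ.- y) (sym (cancel-inv k c)) 0≤ ,
  subst (λ y → 1ℚ ℚ.< s ℚ.* y) (sym (discount-multiple k c)) 1<

-- This is 2 ≤ e in the form (1 + 1)^n ≤ e^n with n = l + 2; the 3 leaves room for the strict
-- inequalities.
log-upper : ∀ m l → m < 2 ^ suc l → upper (logᴿ (fromℕ m)) (ℕ→ℚ (3 + l))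
log-upper m l m< = ℕ→ℚ (2 ^ suc l) , ℕ→ℚ-mono-< {m} {2 ^ suc l} m< ,
  lower-exp-multiple (suc l) 1ℚ (0≤ℕ→ℚ 1)
    (subst (ℚ._< ℕ→ℚ (3 + l)) (sym (ℚ.*-identityʳ (ℕ→ℚ (2 + l)))) (ℕ→ℚ-mono-< {2 + l} {3 + l} ≤-refl))
    (subst (ℕ→ℚ (2 ^ suc l) ℚ.<_) (ℕ→ℚ-^ 2 (2 + l))
      (ℕ→ℚ-mono-< {2 ^ suc l} {2 ^ (2 + l)} (^-monoʳ-< 2 ≤-refl {suc l} {2 + l} ≤-refl)))

[½]^n : ∀ n → ℕ→ℚ (2 ^ n) ℚ.* (1ℚ ℚ.- inv 1) ^ℚ n ≡ 1ℚ
[½]^n n = trans (cong (ℚ._* (1ℚ ℚ.- inv 1) ^ℚ n) (ℕ→ℚ-^ 2 n))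
  (trans (sym (ℚ^.^-distrib-* (ℕ→ℚ 2) (1ℚ ℚ.- inv 1) n)) (1^n n))

-- With n = l - 2 periods of rate 1/2, e^(n / 2) ≤ (1 - 1/2)^(-n) = 2^n. The condition 5 ≤ l is what
-- makes l / 4 < n / 2.
log-lower : ∀ m l → 5 ≤ l → 2 ^ l ≤ m → lower (logᴿ (fromℕ m)) (ℕ→ℚ l ℚ.* inv 3)
log-lower m 1 (s≤s ()) _
log-lower m 2 (s≤s (s≤s ())) _
log-lower m l@(suc (suc (suc k))) 5≤l 2^l≤m = ℕ→ℚ (2 ^ suc (suc k)) ,
  upper-exp-multiple (ℕ→ℚ (2 ^ suc (suc k))) k (inv 1) (0≤inv 1) (begin-strict
    ℕ→ℚ l ℚ.* inv 3                   <⟨ *-monoʳ-<₀ (inv-pos 3) (ℕ→ℚ-mono-< {l} {suc k * 2} l<) ⟩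
    ℕ→ℚ (suc k * 2) ℚ.* inv 3         ≡⟨ cong (ℚ._* inv 3) (ℕ→ℚ-* (suc k) 2) ⟩
    ℕ→ℚ (suc k) ℚ.* ℕ→ℚ 2 ℚ.* inv 3   ≡⟨ ℚ.*-assoc (ℕ→ℚ (suc k)) (ℕ→ℚ 2) (inv 3) ⟩
    ℕ→ℚ (suc k) ℚ.* inv 1             ∎)
    (begin-strict
    1ℚ                                                     ≡⟨ [½]^n (suc k) ⟨
    ℕ→ℚ (2 ^ suc k) ℚ.* (1ℚ ℚ.- inv 1) ^ℚ suc k
      <⟨ *-monoʳ-<₀ (0<^ (suc k) (inv-pos 1)) (ℕ→ℚ-mono-< {2 ^ suc k} {2 ^ suc (suc k)} (^-monoʳ-< 2 ≤-refl {suc k} {suc (suc k)} ≤-refl)) ⟩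
    ℕ→ℚ (2 ^ suc (suc k)) ℚ.* (1ℚ ℚ.- inv 1) ^ℚ suc k      ∎) ,
  ℕ→ℚ-mono-< {2 ^ suc (suc k)} {m} (<-≤-trans (^-monoʳ-< 2 ≤-refl {suc (suc k)} {l} ≤-refl) 2^l≤m)
  where
  open ℚ.≤-Reasoning
  l< : l < suc k * 2
  l< = s≤s (s≤s (≤-trans (≤-trans (≤-reflexive (+-comm 2 k)) (+-monoʳ-≤ k (s≤s⁻¹ (s≤s⁻¹ (s≤s⁻¹ 5≤l)))))
         (≤-reflexive (trans (cong (k +_) (sym (+-identityʳ k))) (*-comm 2 k)))))

-- The discount at rate 1 / (N + 1) exactly inverts growth at rate 1 / N, so powers of the same β
-- bracket log log m from both sides.
[1+inv][1-inv]≡1 : ∀ n → (1ℚ ℚ.+ inv n) ℚ.* (1ℚ ℚ.- inv (suc n)) ≡ 1ℚ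
[1+inv][1-inv]≡1 n = begin
  (1ℚ ℚ.+ i) ℚ.* (1ℚ ℚ.- i′)                    ≡⟨ cong (λ x → (1ℚ ℚ.+ x) ℚ.* (1ℚ ℚ.- i′)) i≡ ⟩
  (1ℚ ℚ.+ (i′ ℚ.+ i ℚ.* i′)) ℚ.* (1ℚ ℚ.- i′)    ≡⟨ lemma₁ i i′ ⟩
  1ℚ ℚ.+ i′ ℚ.* (i ℚ.- (i′ ℚ.+ i ℚ.* i′))
    ≡⟨ cong (λ x → 1ℚ ℚ.+ i′ ℚ.* (x ℚ.- (i′ ℚ.+ i ℚ.* i′))) i≡ ⟩
  1ℚ ℚ.+ i′ ℚ.* (i′ ℚ.+ i ℚ.* i′ ℚ.- (i′ ℚ.+ i ℚ.* i′))
    ≡⟨ cong (λ x → 1ℚ ℚ.+ i′ ℚ.* x) (ℚ.+-inverseʳ (i′ ℚ.+ i ℚ.* i′)) ⟩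
  1ℚ ℚ.+ i′ ℚ.* 0ℚ
    ≡⟨ trans (cong (1ℚ ℚ.+_) (ℚ.*-zeroʳ i′)) (ℚ.+-identityʳ 1ℚ) ⟩
  1ℚ                                            ∎
  where
  open ≡-Reasoning
  i = inv n
  i′ = inv (suc n)
  N = ℕ→ℚ (suc n)
  lemma₁ : ∀ i j → (1ℚ ℚ.+ (j ℚ.+ i ℚ.* j)) ℚ.* (1ℚ ℚ.- j) ≡ 1ℚ ℚ.+ j ℚ.* (i ℚ.- (j ℚ.+ i ℚ.* j))
  lemma₁ = Solver.solve-∀ ℚ-ring
  lemma₂ : ∀ i j N → i ℚ.* ((1ℚ ℚ.+ N) ℚ.* j) ≡ N ℚ.* i ℚ.* j ℚ.+ i ℚ.* j
  lemma₂ = Solver.solve-∀ ℚ-ring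

  i≡ : i ≡ i′ ℚ.+ i ℚ.* i′
  i≡ = begin
    i                                    ≡⟨ ℚ.*-identityʳ i ⟨
    i ℚ.* 1ℚ                             ≡⟨ cong (i ℚ.*_) (suc*inv (suc n)) ⟨
    i ℚ.* (ℕ→ℚ (suc (suc n)) ℚ.* i′)     ≡⟨ cong (λ x → i ℚ.* (x ℚ.* i′)) (ℕ→ℚ-+ 1 (suc n)) ⟩
    i ℚ.* ((1ℚ ℚ.+ N) ℚ.* i′)            ≡⟨ lemma₂ i i′ N ⟩
    N ℚ.* i ℚ.* i′ ℚ.+ i ℚ.* i′          ≡⟨ cong (λ x → x ℚ.* i′ ℚ.+ i ℚ.* i′) (suc*inv n) ⟩
    1ℚ ℚ.* i′ ℚ.+ i ℚ.* i′               ≡⟨ cong (ℚ._+ i ℚ.* i′) (ℚ.*-identityˡ i′) ⟩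
    i′ ℚ.+ i ℚ.* i′                      ∎

2≤[1+inv]^ : ∀ n → ℕ→ℚ 2 ℚ.≤ (1ℚ ℚ.+ inv n) ^ℚ suc n
2≤[1+inv]^ n = ℚ.≤-trans (ℚ.≤-reflexive (cong (1ℚ ℚ.+_) (sym (suc*inv n)))) (bernoulli (suc n) (0≤1+ (0≤inv n)))

2^k≤[1+inv]^ : ∀ n k → ℕ→ℚ (2 ^ k) ℚ.≤ (1ℚ ℚ.+ inv n) ^ℚ (suc n * k)
2^k≤[1+inv]^ n k = ℚ.≤-trans (ℚ.≤-reflexive (ℕ→ℚ-^ 2 k))
  (ℚ.≤-trans (^ℚ-mono-≤ {ℕ→ℚ 2} k (0≤ℕ→ℚ 2) (2≤[1+inv]^ n)) (ℚ.≤-reflexive (ℚ^.^-assocʳ (1ℚ ℚ.+ inv n) (suc n) k)))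

-- log log m to relative accuracy 1 / N, where β = 1 + 1 / N stands in for
-- e^{1 / N}, from βʲ ≤ l < βʲ⁺¹ where l = ⌊log₂ m⌋.
module LogLog {m l : ℕ} (n k : ℕ) (5≤l : 5 ≤ l) (2^l≤m : 2 ^ l ≤ m) (m<2^1+l : m < 2 ^ suc l)
  (β^j≤l : (1ℚ ℚ.+ inv n) ^ℚ (suc n * 3 + suc k) ℚ.≤ ℕ→ℚ l)
  (l<β^1+j : ℕ→ℚ l ℚ.< (1ℚ ℚ.+ inv n) ^ℚ suc (suc n * 3 + suc k)) where

  open ℚ.≤-Reasoning

  β = 1ℚ ℚ.+ inv n
  N = suc n
  -- The 3 N extra factors β amount to at least 2³ = 8. They pay for the loss in log m > l / 4
  -- below, where 8 / 4 > 1; another 3 N, in h, pay for 3 + l ≤ 8 l above.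
  j = N * 3 + suc k
  h = N * 3 + j

  w₁ w₂ : ℚ
  w₁ = ℕ→ℚ k ℚ.* inv (suc n)
  w₂ = ℕ→ℚ (2 + h) ℚ.* inv n

  0<β : 0ℚ ℚ.< β
  0<β = ℚ.≤-<-trans (0≤inv n) (subst (ℚ._< β) (ℚ.+-identityˡ (inv n)) (ℚ.+-monoˡ-< (inv n) (ℕ→ℚ-mono-< {0} {1} (s≤s z≤n))))

  3+l<β^1+h : ℕ→ℚ (3 + l) ℚ.< β ^ℚ suc h
  3+l<β^1+h = begin-strict
    ℕ→ℚ (3 + l)                      ≤⟨ ℕ→ℚ-mono-≤ {3 + l} {8 * l} 3+l≤8l ⟩
    ℕ→ℚ (8 * l)                      ≡⟨ ℕ→ℚ-* 8 l ⟩
    ℕ→ℚ 8 ℚ.* ℕ→ℚ l                  <⟨ *-monoˡ-<₀ (ℕ→ℚ-mono-< {0} {8} (s≤s z≤n)) l<β^1+j ⟩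
    ℕ→ℚ 8 ℚ.* β ^ℚ suc j             ≤⟨ *-monoʳ-≤₀ (0≤^ (suc j) (ℚ.<⇒≤ 0<β)) (2^k≤[1+inv]^ n 3) ⟩
    β ^ℚ (N * 3) ℚ.* β ^ℚ suc j      ≡⟨ ℚ^.^-homo-* β (N * 3) (suc j) ⟨
    β ^ℚ (N * 3 + suc j)             ≡⟨ cong (β ^ℚ_) (+-suc (N * 3) j) ⟩
    β ^ℚ suc h                       ∎
    where
    3+l≤8l : 3 + l ≤ 8 * l
    3+l≤8l = ≤-trans (≤-reflexive (+-comm 3 l)) (+-monoʳ-≤ l (≤-trans (≤-trans (m≤m+n 3 2) 5≤l) (m≤m+n l (6 * l))))

  p<w₂ : ℕ→ℚ (suc h) ℚ.* inv n ℚ.< w₂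
  p<w₂ = *-monoʳ-<₀ (inv-pos n) (ℕ→ℚ-mono-< {suc h} {2 + h} ≤-refl)

  loglog-upper : upper (logᴿ (logᴿ (fromℕ m))) w₂
  loglog-upper = ℕ→ℚ (3 + l) , log-upper m l m<2^1+l ,
    lower-exp-multiple h (inv n) (0≤inv n) p<w₂ 3+l<β^1+h

  l≤compound : ℕ→ℚ l ℚ.≤ compound w₂ h
  l≤compound = begin
    ℕ→ℚ l                                     ≤⟨ ℕ→ℚ-mono-≤ {l} {3 + l} (m≤n+m l 3) ⟩
    ℕ→ℚ (3 + l)                               ≤⟨ ℚ.<⇒≤ 3+l<β^1+h ⟩
    β ^ℚ suc h                                ≡⟨ compound-multiple h (inv n) ⟨
    compound (ℕ→ℚ (suc h) ℚ.* inv n) h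
      ≤⟨ compound-mono h (0≤1+ (0≤* (0≤* (0≤ℕ→ℚ (suc h)) (0≤inv n)) (0≤inv h))) (ℚ.<⇒≤ p<w₂) ⟩
    compound w₂ h                             ∎

  loglog-lower : lower (logᴿ (logᴿ (fromℕ m))) w₁
  loglog-lower = ℕ→ℚ l ℚ.* inv 3 ,
    upper-exp-multiple (ℕ→ℚ l ℚ.* inv 3) k (inv (suc n)) (ℚ.<⇒≤ 0<α)
      (*-monoʳ-<₀ (inv-pos (suc n)) (ℕ→ℚ-mono-< {k} {suc k} ≤-refl)) (begin-strict
      1ℚ                                                        <⟨ ℕ→ℚ-mono-< {1} {2} ≤-refl ⟩
      ℕ→ℚ 8 ℚ.* inv 3                                           ≡⟨ ℚ.*-identityʳ (ℕ→ℚ 8 ℚ.* inv 3) ⟨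
      ℕ→ℚ 8 ℚ.* inv 3 ℚ.* 1ℚ
        ≡⟨ cong (ℕ→ℚ 8 ℚ.* inv 3 ℚ.*_) [βα]^≡1 ⟨
      ℕ→ℚ 8 ℚ.* inv 3 ℚ.* (β ^ℚ suc k ℚ.* α ^ℚ suc k)
        ≡⟨ lemma (ℕ→ℚ 8) (inv 3) (β ^ℚ suc k) (α ^ℚ suc k) ⟩
      ℕ→ℚ 8 ℚ.* β ^ℚ suc k ℚ.* (inv 3 ℚ.* α ^ℚ suc k)
        ≤⟨ *-monoʳ-≤₀ (0≤* (0≤inv 3) (0≤^ (suc k) (ℚ.<⇒≤ 0<α))) 8β^≤l ⟩
      ℕ→ℚ l ℚ.* (inv 3 ℚ.* α ^ℚ suc k)
        ≡⟨ ℚ.*-assoc (ℕ→ℚ l) (inv 3) (α ^ℚ suc k) ⟨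
      ℕ→ℚ l ℚ.* inv 3 ℚ.* α ^ℚ suc k                            ∎) ,
    log-lower m l 5≤l 2^l≤m
    where
    α = 1ℚ ℚ.- inv (suc n)

    0<α : 0ℚ ℚ.< α
    0<α = ℚ.≰⇒> λ α≤0 → ℚ.<-irrefl refl (begin-strict
      0ℚ         <⟨ ℕ→ℚ-mono-< {0} {1} (s≤s z≤n) ⟩
      1ℚ         ≡⟨ [1+inv][1-inv]≡1 n ⟨
      β ℚ.* α    ≤⟨ *-monoˡ-≤₀ (ℚ.<⇒≤ 0<β) α≤0 ⟩
      β ℚ.* 0ℚ   ≡⟨ ℚ.*-zeroʳ β ⟩
      0ℚ         ∎)

    [βα]^≡1 : β ^ℚ suc k ℚ.* α ^ℚ suc k ≡ 1ℚ
    [βα]^≡1 = trans (sym (ℚ^.^-distrib-* β α (suc k)))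
      (trans (cong (_^ℚ suc k) ([1+inv][1-inv]≡1 n)) (1^n (suc k)))

    8β^≤l : ℕ→ℚ 8 ℚ.* β ^ℚ suc k ℚ.≤ ℕ→ℚ l
    8β^≤l = begin
      ℕ→ℚ 8 ℚ.* β ^ℚ suc k             ≤⟨ *-monoʳ-≤₀ (0≤^ (suc k) (ℚ.<⇒≤ 0<β)) (2^k≤[1+inv]^ n 3) ⟩
      β ^ℚ (N * 3) ℚ.* β ^ℚ suc k      ≡⟨ ℚ^.^-homo-* β (N * 3) (suc k) ⟨
      β ^ℚ j                           ≤⟨ β^j≤l ⟩
      ℕ→ℚ l                            ∎

    lemma : ∀ a b c d → a ℚ.* b ℚ.* (c ℚ.* d) ≡ a ℚ.* c ℚ.* (b ℚ.* d)
    lemma = Solver.solve-∀ ℚ-ring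

-- Products of cuts

lower-*-nonNeg : ∀ {x y a b c d p} → lower x a × upper x b → lower y c × upper y d →
  0ℚ ℚ.≤ a → a ℚ.≤ b → 0ℚ ℚ.≤ c → c ℚ.≤ d → p ℚ.< a ℚ.* c → lower (x *ᴿ y) p
lower-*-nonNeg x∈ y∈ 0≤a a≤b 0≤c c≤d p< = _ , _ , _ , _ , x∈ , y∈ , p< ,
  ℚ.<-≤-trans p< (*-monoˡ-≤₀ 0≤a c≤d) ,
  ℚ.<-≤-trans p< (*-monoʳ-≤₀ 0≤c a≤b) ,
  ℚ.<-≤-trans p< (*-mono-≤₀ 0≤a a≤b 0≤c c≤d)

upper-*-nonNeg : ∀ {x y a b c d p} → lower x a × upper x b → lower y c × upper y d →
  0ℚ ℚ.≤ a → a ℚ.≤ b → 0ℚ ℚ.≤ c → c ℚ.≤ d → b ℚ.* d ℚ.< p → upper (x *ᴿ y) p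
upper-*-nonNeg x∈ y∈ 0≤a a≤b 0≤c c≤d <p = _ , _ , _ , _ , x∈ , y∈ ,
  ℚ.≤-<-trans (*-mono-≤₀ 0≤a a≤b 0≤c c≤d) <p ,
  ℚ.≤-<-trans (*-monoʳ-≤₀ (ℚ.≤-trans 0≤c c≤d) a≤b) <p ,
  ℚ.≤-<-trans (*-monoˡ-≤₀ (ℚ.≤-trans 0≤a a≤b) c≤d) <p , <p

0<1 : 0ℚ ℚ.< 1ℚ
0<1 = ℕ→ℚ-mono-< {0} {1} (s≤s z≤n)

p<p+1 : ∀ p → p ℚ.< p ℚ.+ 1ℚ
p<p+1 p = subst (ℚ._< p ℚ.+ 1ℚ) (ℚ.+-identityʳ p) (ℚ.+-monoʳ-< p 0<1)

-- Rational brackets for the exponents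

sixteenths : ℕ → ℚ
sixteenths i = ℕ→ℚ i ℚ.* inv 15

0≤sixteenths : ∀ i → 0ℚ ℚ.≤ sixteenths i
0≤sixteenths i = 0≤* (0≤ℕ→ℚ i) (0≤inv 15)

sixteenths-+ : ∀ i j → sixteenths (i + j) ≡ sixteenths i ℚ.+ sixteenths j
sixteenths-+ i j = trans (cong (ℚ._* inv 15) (ℕ→ℚ-+ i j)) (ℚ.*-distribʳ-+ (inv 15) (ℕ→ℚ i) (ℕ→ℚ j))

sixteenths-mono-< : ∀ {i j} → i < j → sixteenths i ℚ.< sixteenths j
sixteenths-mono-< {i} {j} i<j = *-monoʳ-<₀ (inv-pos 15) (ℕ→ℚ-mono-< {i} {j} i<j)

-- Here w will be log log m. The comparisons `<ε₂`, `<w₂` and `w₁<` carry what is used of the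
-- disjointness of ε and w, so the products with w are bounded without being shown to be reals.
module Exponents (ε w : Cut) (i : ℕ)
  (ε₁<ε : lower ε (sixteenths i)) (ε<ε₂ : upper ε (sixteenths (2 + i)))
  (<ε₂ : ∀ {c} → lower ε c → c ℚ.< sixteenths (2 + i))
  {w₁ w₂ : ℚ} (w₁<w : lower w w₁) (w<w₂ : upper w w₂)
  (<w₂ : ∀ {c} → lower w c → c ℚ.< w₂) (w₁< : ∀ {d} → upper w d → w₁ ℚ.< d)
  (0<w₁ : 0ℚ ℚ.< w₁) where

  open ℚ.≤-Reasoning

  ε₁ ε₂ : ℚ
  ε₁ = sixteenths i
  ε₂ = sixteenths (2 + i)

  0≤w₁ : 0ℚ ℚ.≤ w₁
  0≤w₁ = ℚ.<⇒≤ 0<w₁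
  w₁≤w₂ : w₁ ℚ.≤ w₂
  w₁≤w₂ = ℚ.<⇒≤ (<w₂ w₁<w)
  0≤w₂ : 0ℚ ℚ.≤ w₂
  0≤w₂ = ℚ.≤-trans 0≤w₁ w₁≤w₂

  -- p lies below (2 + ε) w and σ above ε w. The coefficient 3/2 + ε₁ in p exceeds 1 + ε₂ by 3/8,
  -- and this is the room left for σ + w₂ < p when w₂ is larger than w₁.
  p σ : ℚ
  p = sixteenths (24 + i) ℚ.* w₁
  σ = ε₂ ℚ.* w₂

  0≤σ : 0ℚ ℚ.≤ σ
  0≤σ = 0≤* (0≤sixteenths (2 + i)) 0≤w₂

  2+ε∈ : lower (fromℕ 2 +ᴿ ε) (sixteenths (25 + i)) × upper (fromℕ 2 +ᴿ ε) (sixteenths (36 + i))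
  2+ε∈ =
    (sixteenths 26 , ε₁ , sixteenths-mono-< {26} {32} (m≤m+n 27 5) , ε₁<ε ,
      subst (sixteenths (25 + i) ℚ.<_) (sixteenths-+ 26 i) (sixteenths-mono-< {25 + i} {26 + i} ≤-refl)) ,
    (sixteenths 33 , ε₂ , sixteenths-mono-< {32} {33} ≤-refl , ε<ε₂ ,
      subst (ℚ._< sixteenths (36 + i)) (sixteenths-+ 33 (2 + i)) (sixteenths-mono-< {35 + i} {36 + i} ≤-refl))

  25≤36 : sixteenths (25 + i) ℚ.≤ sixteenths (36 + i)
  25≤36 = ℚ.<⇒≤ (sixteenths-mono-< {25 + i} {36 + i} (m≤n+m (26 + i) 10))

  lower-2+ε : lower ((fromℕ 2 +ᴿ ε) *ᴿ w) p
  lower-2+ε = lower-*-nonNeg 2+ε∈ (w₁<w , w<w₂) (0≤sixteenths (25 + i)) 25≤36 0≤w₁ w₁≤w₂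
    (*-monoʳ-<₀ 0<w₁ (sixteenths-mono-< {24 + i} {25 + i} ≤-refl))

  upper-2+ε : ∃ (upper ((fromℕ 2 +ᴿ ε) *ᴿ w))
  upper-2+ε = _ , upper-*-nonNeg 2+ε∈ (w₁<w , w<w₂) (0≤sixteenths (25 + i)) 25≤36 0≤w₁ w₁≤w₂ (p<p+1 _)

  -ε∈ : lower (-ᴿ ε) (ℚ.- ε₂) × upper (-ᴿ ε) (ℚ.- ε₁)
  -ε∈ = subst (upper ε) (sym (lemma ε₂)) ε<ε₂ , subst (lower ε) (sym (lemma ε₁)) ε₁<ε
    where
    lemma : ∀ x → ℚ.- (ℚ.- x) ≡ x
    lemma = Solver.solve-∀ ℚ-ring

  neg*≤0 : ∀ {a c} → 0ℚ ℚ.≤ a → 0ℚ ℚ.≤ c → ℚ.- a ℚ.* c ℚ.≤ 0ℚ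
  neg*≤0 {a} {c} 0≤a 0≤c = ℚ.≤-trans (ℚ.≤-reflexive (sym (ℚ.neg-distribˡ-* a c))) (ℚ.neg-antimono-≤ (0≤* 0≤a 0≤c))

  -σ≤neg* : ∀ {a c} → 0ℚ ℚ.≤ a → a ℚ.≤ ε₂ → 0ℚ ℚ.≤ c → c ℚ.≤ w₂ → ℚ.- σ ℚ.≤ ℚ.- a ℚ.* c
  -σ≤neg* {a} {c} 0≤a a≤ 0≤c c≤ = ℚ.≤-trans (ℚ.neg-antimono-≤ (*-mono-≤₀ 0≤a a≤ 0≤c c≤))
    (ℚ.≤-reflexive (ℚ.neg-distribˡ-* a c))

  ε₁≤ε₂ : ε₁ ℚ.≤ ε₂
  ε₁≤ε₂ = ℚ.<⇒≤ (sixteenths-mono-< {i} {2 + i} (m≤n+m (suc i) 1))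

  lower-neg-ε : ∃ (lower ((-ᴿ ε) *ᴿ w))
  lower-neg-ε = ℚ.- σ ℚ.- 1ℚ , _ , _ , _ , _ , -ε∈ , (w₁<w , w<w₂) ,
    below (-σ≤neg* 0≤ε₂ ℚ.≤-refl 0≤w₁ w₁≤w₂) , below (-σ≤neg* 0≤ε₂ ℚ.≤-refl 0≤w₂ ℚ.≤-refl) ,
    below (-σ≤neg* 0≤ε₁ ε₁≤ε₂ 0≤w₁ w₁≤w₂) , below (-σ≤neg* 0≤ε₁ ε₁≤ε₂ 0≤w₂ ℚ.≤-refl)
    where
    0≤ε₁ = 0≤sixteenths i
    0≤ε₂ = 0≤sixteenths (2 + i)
    below : ∀ {x} → ℚ.- σ ℚ.≤ x → ℚ.- σ ℚ.- 1ℚ ℚ.< x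
    below = ℚ.<-≤-trans (subst (ℚ.- σ ℚ.- 1ℚ ℚ.<_) (ℚ.+-identityʳ (ℚ.- σ)) (ℚ.+-monoʳ-< (ℚ.- σ) (ℚ.neg-antimono-< 0<1)))

  upper-neg-ε : ∃ (upper ((-ᴿ ε) *ᴿ w))
  upper-neg-ε = 1ℚ , _ , _ , _ , _ , -ε∈ , (w₁<w , w<w₂) ,
    above (neg*≤0 0≤ε₂ 0≤w₁) , above (neg*≤0 0≤ε₂ 0≤w₂) , above (neg*≤0 0≤ε₁ 0≤w₁) , above (neg*≤0 0≤ε₁ 0≤w₂)
    where
    0≤ε₁ = 0≤sixteenths i
    0≤ε₂ = 0≤sixteenths (2 + i)
    above : ∀ {x} → x ℚ.≤ 0ℚ → x ℚ.< 1ℚ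
    above x≤0 = ℚ.≤-<-trans x≤0 0<1

  -- The right-hand corners of the box suffice: for b ≥ 0 the product b d is non-negative, and for b
  -- ≤ 0, -b < ε₂ and c < w₂ give b c ≥ -ε₂ w₂.
  -σ≤upper-neg-ε : ∀ q → upper ((-ᴿ ε) *ᴿ w) q → ℚ.- σ ℚ.≤ q
  -σ≤upper-neg-ε q (a , b , c , d , (_ , -b<ε) , (c<w , w<d) , _ , _ , bc<q , bd<q) with ℚ.≤-total 0ℚ b
  ... | inj₁ 0≤b = begin
    ℚ.- σ        ≤⟨ ℚ.neg-antimono-≤ 0≤σ ⟩
    0ℚ           ≤⟨ 0≤* 0≤b (ℚ.≤-trans 0≤w₁ (ℚ.<⇒≤ (w₁< w<d))) ⟩
    b ℚ.* d      ≤⟨ ℚ.<⇒≤ bd<q ⟩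
    q            ∎
  ... | inj₂ b≤0 = begin
    ℚ.- σ                ≤⟨ ℚ.neg-antimono-≤ (*-monoʳ-≤₀ 0≤w₂ (ℚ.<⇒≤ (<ε₂ -b<ε))) ⟩
    ℚ.- (ℚ.- b ℚ.* w₂)   ≡⟨ lemma b w₂ ⟩
    b ℚ.* w₂             ≤⟨ ℚ.*-monoˡ-≤-nonPos b {{ℚ.nonPositive b≤0}} (ℚ.<⇒≤ (<w₂ c<w)) ⟩
    b ℚ.* c              ≤⟨ ℚ.<⇒≤ bc<q ⟩
    q                    ∎
    where
    lemma : ∀ b w → ℚ.- (ℚ.- b ℚ.* w) ≡ b ℚ.* w
    lemma = Solver.solve-∀ ℚ-ring

  -- t approximates e^{(2 + ε) w}; the inequality loses a factor e^w, which is
  -- what makes room for the errors in ε₂ and w₂.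
  scale : ∀ h {l} → ℕ→ℚ l ℚ.≤ compound w₂ h → σ ℚ.+ w₂ ℚ.< p →
    ∃₂ λ t t′ → NonZero t × ℕ→ℚ t ℚ.< t′ × lower (expᴿ ((fromℕ 2 +ᴿ ε) *ᴿ w)) t′ ×
      (∀ d → upper (expᴿ ((-ᴿ ε) *ᴿ w)) d → ℕ→ℚ l ℚ.≤ ℕ→ℚ 2 ℚ.* (d ℚ.* ℕ→ℚ t))
  scale h {l} l≤ σ+w₂<p =
    let (n , 0≤1-σi , le) = balance h 0≤p 0≤σ 0≤w₂ σ+w₂<p
        0≤1+pi = 0≤1+ {p ℚ.* inv n} (0≤* 0≤p (0≤inv n))
        -- Thus t < `compound p n` ≤ t + 1. The compound exceeds 1, so t ≥ 1 and t + 1 ≤ 2 t, whence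
        -- the factor 2 in the conclusion.
        (t , t< , ≤1+t) = ceiling (ℚ.<-trans 0<1 (1<compound n))
        (t′ , t<t′ , t′<) = ℚ.<-dense t<
    in t , t′ , t≢0 n t ≤1+t , t<t′ , (p , n , lower-2+ε , 0≤1+pi , t′<) ,
       λ d E<d → let d≥ = discount≤upper-exp {(-ᴿ ε) *ᴿ w} {d} n E<d -σ≤upper-neg-ε 0≤1-σi in begin
         ℕ→ℚ l                              ≤⟨ l≤ ⟩
         compound w₂ h                      ≤⟨ le ⟩
         discount σ n ℚ.* compound p n
           ≤⟨ *-mono-≤₀ (0≤^ (suc n) 0≤1-σi) d≥ (0≤^ (suc n) 0≤1+pi) ≤1+t ⟩
         d ℚ.* ℕ→ℚ (suc t)
           ≤⟨ *-monoˡ-≤₀ (ℚ.≤-trans (0≤^ (suc n) 0≤1-σi) d≥) (ℕ→ℚ-mono-≤ {suc t} {2 * t} (double t (t≢0 n t ≤1+t))) ⟩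
         d ℚ.* ℕ→ℚ (2 * t)                  ≡⟨ cong (d ℚ.*_) (ℕ→ℚ-* 2 t) ⟩
         d ℚ.* (ℕ→ℚ 2 ℚ.* ℕ→ℚ t)            ≡⟨ lemma d (ℕ→ℚ 2) (ℕ→ℚ t) ⟩
         ℕ→ℚ 2 ℚ.* (d ℚ.* ℕ→ℚ t)            ∎
    where
    0≤p : 0ℚ ℚ.≤ p
    0≤p = 0≤* (0≤sixteenths (24 + i)) 0≤w₁

    1<compound : ∀ n → 1ℚ ℚ.< compound p n
    1<compound n = begin-strict
      1ℚ                                          ≡⟨ ℚ.+-identityʳ 1ℚ ⟨
      1ℚ ℚ.+ 0ℚ
        <⟨ ℚ.+-monoʳ-< 1ℚ (ℚ.≤-<-trans (0≤* {σ ℚ.+ w₂} {1ℚ} (0≤+ 0≤σ 0≤w₂) (ℚ.<⇒≤ 0<1)) (subst (ℚ._< p) (sym (ℚ.*-identityʳ (σ ℚ.+ w₂))) σ+w₂<p)) ⟩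
      1ℚ ℚ.+ p
        ≡⟨ cong (1ℚ ℚ.+_) (trans (sym (cancel-inv n p)) (ℚ.*-assoc (ℕ→ℚ (suc n)) p (inv n))) ⟩
      1ℚ ℚ.+ ℕ→ℚ (suc n) ℚ.* (p ℚ.* inv n)        ≤⟨ bernoulli (suc n) (0≤1+ (0≤* 0≤p (0≤inv n))) ⟩
      compound p n                                ∎
      where
      0≤+ : ∀ {a b} → 0ℚ ℚ.≤ a → 0ℚ ℚ.≤ b → 0ℚ ℚ.≤ a ℚ.+ b
      0≤+ = ℚ.+-mono-≤

    t≢0 : ∀ n t → compound p n ℚ.≤ ℕ→ℚ (suc t) → NonZero t
    t≢0 n zero    ≤1 = contradiction (ℚ.<-≤-trans (1<compound n) ≤1) (ℚ.<-irrefl refl)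
    t≢0 n (suc t) _  = _

    double : ∀ t → NonZero t → suc t ≤ 2 * t
    double t@(suc _) _ = ≤-trans (+-monoˡ-≤ t (s≤s z≤n)) (≤-reflexive (cong (t +_) (sym (+-identityʳ t))))

    lemma : ∀ d a t → d ℚ.* (a ℚ.* t) ≡ a ℚ.* (d ℚ.* t)
    lemma = Solver.solve-∀ ℚ-ring

-- Comparison with the cuts of the statement

lower<upper : ∀ {x} → IsReal x → ∀ {c d} → lower x c → upper x d → c ℚ.< d
lower<upper real {c} {d} lc ud with ℚ.<-cmp c d
... | tri< c<d _ _ = c<d
... | tri≈ _ refl _ = contradiction (lc , ud) (disjoint real c)
... | tri> _ _ d<c = contradiction (Equivalence.from (lower-rounded real d) (c , d<c , lc) , ud) (disjoint real d)

-- Locatedness only chooses between overlapping alternatives at two neighbouring grid points, so the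
-- bracket is two steps wide. The upward walk stops because a grid point above ε is known in
-- advance.
grid : ∀ {ε} → IsReal ε → fromℕ 0 <ᴿ ε → ∃ λ i → lower ε (sixteenths i) × upper ε (sixteenths (2 + i))
grid {ε} real (q , 0<q , q<ε) = search (suc n) 0 (+-identityʳ (suc n))
  (subst (lower ε) (sym (ℚ.*-zeroˡ (inv 15))) (Equivalence.from (lower-rounded real 0ℚ) (q , 0<q , q<ε)))
  where
  u = proj₁ (upper-inhabited real)
  n = proj₁ (archimedean-* u (inv-pos 15))

  ε<n : upper ε (sixteenths (suc n))
  ε<n = Equivalence.from (upper-rounded real (sixteenths (suc n)))
    (u , ℚ.≤-<-trans (proj₂ (archimedean-* u (inv-pos 15))) (sixteenths-mono-< {n} {suc n} ≤-refl) , proj₂ (upper-inhabited real))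

  search : ∀ k i → k + i ≡ suc n → lower ε (sixteenths i) → ∃ λ i → lower ε (sixteenths i) × upper ε (sixteenths (2 + i))
  search zero    i refl i<ε = contradiction (i<ε , ε<n) (disjoint real (sixteenths (suc n)))
  search (suc k) i eq   i<ε with located real (sixteenths (1 + i)) (sixteenths (2 + i)) (sixteenths-mono-< {1 + i} {2 + i} ≤-refl)
  ... | inj₁ 1+i<ε = search k (suc i) (trans (+-suc k i) eq) 1+i<ε
  ... | inj₂ ε<2+i = i , i<ε , ε<2+i

≤√ : ∀ {x X m} → x ≤ X → X * X ≤ m → fromℕ x ≤ᴿ √ᴿ (fromℕ m)
≤√ {x} {X} {m} x≤X X²≤m q q<x with q ℚ.<? 0ℚ
... | yes q<0 = inj₁ q<0
... | no q≮0  = inj₂ (begin-strict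
  q ℚ.* q                  ≤⟨ *-monoˡ-≤₀ 0≤q (ℚ.<⇒≤ q<x) ⟩
  q ℚ.* ℕ→ℚ x              <⟨ *-monoʳ-<₀ (ℚ.≤-<-trans 0≤q q<x) q<x ⟩
  ℕ→ℚ x ℚ.* ℕ→ℚ x          ≡⟨ ℕ→ℚ-* x x ⟨
  ℕ→ℚ (x * x)              ≤⟨ ℕ→ℚ-mono-≤ {x * x} {m} (≤-trans (*-mono-≤ x≤X x≤X) X²≤m) ⟩
  ℕ→ℚ m                    ∎)
  where
  open ℚ.≤-Reasoning
  0≤q = ℚ.≮⇒≥ q≮0

√-upper : ∀ m → upper (√ᴿ (fromℕ m)) (ℕ→ℚ (suc m))
√-upper m = ℕ→ℚ-mono-< {0} {suc m} (s≤s z≤n) , subst (ℕ→ℚ m ℚ.<_) (ℕ→ℚ-* (suc m) (suc m))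
  (ℕ→ℚ-mono-< {m} {suc m * suc m} (m≤m*n (suc m) (suc m)))

divide : ∀ {a b t} → 0ℚ ℚ.< t → a ℚ.< b ℚ.* t → ∃ λ x → a ℚ.< x ℚ.* t × x ℚ.< b
divide {a} {b} {t} 0<t a<bt =
  let (c , a<c , c<bt) = ℚ.<-dense a<bt in
  c ℚ.* u ,
  subst (a ℚ.<_) (sym (trans (ℚ.*-assoc c u t) (trans (cong (c ℚ.*_) (ℚ.*-inverseˡ t)) (ℚ.*-identityʳ c)))) a<c ,
  subst (c ℚ.* u ℚ.<_) (trans (ℚ.*-assoc b t u) (trans (cong (b ℚ.*_) (ℚ.*-inverseʳ t)) (ℚ.*-identityʳ b)))
    (*-monoʳ-<₀ (ℚ.positive⁻¹ u {{ℚ.1/pos⇒pos t}}) c<bt)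
  where
  instance
    t-pos = ℚ.positive 0<t
    t≢0 = ℚ.pos⇒nonZero t
  u = ℚ.1/ t

a<b+c⇒a-c<b : ∀ {a b c} → a ℚ.< b ℚ.+ c → a ℚ.- c ℚ.< b
a<b+c⇒a-c<b {a} {b} {c} a<b+c = subst (a ℚ.- c ℚ.<_) (lemma b c) (ℚ.+-monoˡ-< (ℚ.- c) a<b+c)
  where
  lemma : ∀ b c → b ℚ.+ c ℚ.- c ≡ b
  lemma = Solver.solve-∀ ℚ-ring

a-c<b⇒a<b+c : ∀ {a b c} → a ℚ.- c ℚ.< b → a ℚ.< b ℚ.+ c
a-c<b⇒a<b+c {a} {b} {c} a-c<b = subst (ℚ._< b ℚ.+ c) (lemma a c) (ℚ.+-monoˡ-< c a-c<b)
  where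
  lemma : ∀ a c → a ℚ.- c ℚ.+ c ≡ a
  lemma = Solver.solve-∀ ℚ-ring

-- The cut E plays the role of (log m)^{2 + ε}.
≤S+√m*E : ∀ {m X t t′ E} S .{{_ : NonZero X}} → X * X ≤ m → ℕ→ℚ t ℚ.< t′ →
  lower E t′ → (∃ λ u → t′ ℚ.≤ u × upper E u) →
  ∀ {y} → y < X * t → fromℤ (S ℤ.+ 1ℤ ℤ.+ pos y) ≤ᴿ fromℤ S +ᴿ √ᴿ (fromℕ m) *ᴿ E
≤S+√m*E {m} {X} {t} {t′} {E} S X²≤m t<t′ t′<E (u , t′≤u , E<u) {y} y< q q< =
  -- X itself fails to be a lower member of √m when m = X²; the gap between t and t′ is traded for a
  -- factor x strictly below X.
  let (x , Xt<xt′ , x<X) = divide {b = ℕ→ℚ X} 0<t′ Xt<Xt′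
      (s , q-Xt<s , s<S) = ℚ.<-dense (a<b+c⇒a-c<b (ℚ.<-≤-trans q< S+1+y≤))
  in s , ℕ→ℚ (X * t) , s<S ,
     lower-*-nonNeg (≤√ {X} {X} ≤-refl X²≤m x x<X , √-upper m) (t′<E , E<u)
       (ℚ.<⇒≤ (ℚ.≰⇒> λ x≤0 → ℚ.<-irrefl refl (begin-strict
         0ℚ            ≤⟨ 0≤ℕ→ℚ (X * t) ⟩
         ℕ→ℚ (X * t)   <⟨ Xt<xt′ ⟩
         x ℚ.* t′      ≤⟨ *-monoʳ-≤₀ (ℚ.<⇒≤ 0<t′) x≤0 ⟩
         0ℚ ℚ.* t′     ≡⟨ ℚ.*-zeroˡ t′ ⟩
         0ℚ            ∎)))
       (ℚ.<⇒≤ (ℚ.<-≤-trans x<X (ℕ→ℚ-mono-≤ {X} {suc m} (≤-trans (m≤m*n X X) (≤-trans X²≤m (n≤1+n m))))))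
       (ℚ.<⇒≤ 0<t′) t′≤u Xt<xt′ ,
     a-c<b⇒a<b+c q-Xt<s
  where
  open ℚ.≤-Reasoning
  0<t′ : 0ℚ ℚ.< t′
  0<t′ = ℚ.≤-<-trans (0≤ℕ→ℚ t) t<t′

  Xt<Xt′ : ℕ→ℚ (X * t) ℚ.< ℕ→ℚ X ℚ.* t′
  Xt<Xt′ = begin-strict
    ℕ→ℚ (X * t)       ≡⟨ ℕ→ℚ-* X t ⟩
    ℕ→ℚ X ℚ.* ℕ→ℚ t   <⟨ *-monoˡ-<₀ (ℕ→ℚ-mono-< {0} {X} (>-nonZero⁻¹ X)) t<t′ ⟩
    ℕ→ℚ X ℚ.* t′      ∎

  S+1+y≤ : ι (S ℤ.+ 1ℤ ℤ.+ pos y) ℚ.≤ ι S ℚ.+ ℕ→ℚ (X * t)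
  S+1+y≤ = begin
    ι (S ℤ.+ 1ℤ ℤ.+ pos y)
      ≡⟨ cong ι (trans (ℤ.+-assoc S 1ℤ (pos y)) (cong (λ n → S ℤ.+ n) (sym (ℤ.pos-+ 1 y)))) ⟩
    ι (S ℤ.+ pos (suc y))     ≡⟨ ι-+ S (pos (suc y)) ⟩
    ι S ℚ.+ ℕ→ℚ (suc y)       ≤⟨ ℚ.+-monoʳ-≤ (ι S) (ℕ→ℚ-mono-≤ {suc y} {X * t} y<) ⟩
    ι S ℚ.+ ℕ→ℚ (X * t)       ∎

-- Each d above E satisfies l / t ≤ 2 d, so the missed part U ≤ c l m / t is at most 2 c d m; this
-- doubles the constant c.
lower-bound : ∀ {m k U t l} c E .{{_ : NonZero t}} → m ≤ k + U → U * t ≤ c * l * m →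
  (∀ d → upper E d → 0ℚ ℚ.< d × ℕ→ℚ l ℚ.≤ ℕ→ℚ 2 ℚ.* (d ℚ.* ℕ→ℚ t)) →
  (fromℕ 1 -ᴿ fromℕ (c * 2) *ᴿ E) *ᴿ fromℕ m ≤ᴿ fromℕ k
lower-bound {m} {k} {U} {t} {l} c E m≤ Ut≤ E-large q
  (a , _ , g , h , ((a′ , b′ , a′<1 , (_ , β , _ , δ , (_ , C<β) , (_ , E<δ) , _ , _ , _ , βδ<-b′) , a<) , _) ,
   (g<m , m<h) , q<ag , q<ah , _) = begin-strict
  q                                <⟨ q<am ⟩
  a ℚ.* M                          ≤⟨ *-monoʳ-≤₀ (0≤ℕ→ℚ m) (ℚ.<⇒≤ a<) ⟩
  (a′ ℚ.+ b′) ℚ.* M                ≤⟨ *-monoʳ-≤₀ (0≤ℕ→ℚ m) (ℚ.+-monoˡ-≤ b′ (ℚ.<⇒≤ a′<1)) ⟩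
  (1ℚ ℚ.+ b′) ℚ.* M                ≡⟨ lemma₁ b′ M ⟩
  M ℚ.- ℚ.- b′ ℚ.* M               ≤⟨ ℚ.+-monoʳ-≤ M (ℚ.neg-antimono-≤ U≤) ⟩
  M ℚ.- ℕ→ℚ U
    ≤⟨ ℚ.+-monoˡ-≤ (ℚ.- ℕ→ℚ U) (ℚ.≤-trans (ℕ→ℚ-mono-≤ {m} {k + U} m≤) (ℚ.≤-reflexive (ℕ→ℚ-+ k U))) ⟩
  ℕ→ℚ k ℚ.+ ℕ→ℚ U ℚ.- ℕ→ℚ U        ≡⟨ lemma₂ (ℕ→ℚ k) (ℕ→ℚ U) ⟩
  ℕ→ℚ k                            ∎
  where
  open ℚ.≤-Reasoning
  M = ℕ→ℚ m
  T = ℕ→ℚ t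
  e = ℚ.- b′

  lemma₁ : ∀ b m → (1ℚ ℚ.+ b) ℚ.* m ≡ m ℚ.- ℚ.- b ℚ.* m
  lemma₁ = Solver.solve-∀ ℚ-ring
  lemma₂ : ∀ k u → k ℚ.+ u ℚ.- u ≡ k
  lemma₂ = Solver.solve-∀ ℚ-ring
  lemma₃ : ∀ c w d t m → c ℚ.* (w ℚ.* (d ℚ.* t)) ℚ.* m ≡ c ℚ.* w ℚ.* d ℚ.* m ℚ.* t
  lemma₃ = Solver.solve-∀ ℚ-ring

  -- A lower member a of 1 - 2 c E may be negative; its sign decides which end of the interval
  -- around m is the relevant one.
  q<am : q ℚ.< a ℚ.* M
  q<am with ℚ.≤-total 0ℚ a
  ... | inj₁ 0≤a = ℚ.<-≤-trans q<ag (*-monoˡ-≤₀ 0≤a (ℚ.<⇒≤ g<m))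
  ... | inj₂ a≤0 = ℚ.<-≤-trans q<ah (ℚ.*-monoˡ-≤-nonPos a {{ℚ.nonPositive a≤0}} (ℚ.<⇒≤ m<h))

  Cδ≤e : ℕ→ℚ (c * 2) ℚ.* δ ℚ.≤ e
  Cδ≤e = ℚ.≤-trans (*-monoʳ-≤₀ (ℚ.<⇒≤ (proj₁ (E-large δ E<δ))) (ℚ.<⇒≤ C<β)) (ℚ.<⇒≤ βδ<-b′)

  U≤ : ℕ→ℚ U ℚ.≤ e ℚ.* M
  U≤ = *-cancelʳ-≤₀ (ℕ→ℚ-mono-< {0} {t} (>-nonZero⁻¹ t)) (begin
    ℕ→ℚ U ℚ.* T                                ≡⟨ ℕ→ℚ-* U t ⟨
    ℕ→ℚ (U * t)                                ≤⟨ ℕ→ℚ-mono-≤ {U * t} {c * l * m} Ut≤ ⟩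
    ℕ→ℚ (c * l * m)
      ≡⟨ trans (ℕ→ℚ-* (c * l) m) (cong (ℚ._* M) (ℕ→ℚ-* c l)) ⟩
    ℕ→ℚ c ℚ.* ℕ→ℚ l ℚ.* M
      ≤⟨ *-monoʳ-≤₀ (0≤ℕ→ℚ m) (*-monoˡ-≤₀ (0≤ℕ→ℚ c) (proj₂ (E-large δ E<δ))) ⟩
    ℕ→ℚ c ℚ.* (ℕ→ℚ 2 ℚ.* (δ ℚ.* T)) ℚ.* M      ≡⟨ lemma₃ (ℕ→ℚ c) (ℕ→ℚ 2) δ T M ⟩
    ℕ→ℚ c ℚ.* ℕ→ℚ 2 ℚ.* δ ℚ.* M ℚ.* T          ≡⟨ cong (λ C → C ℚ.* δ ℚ.* M ℚ.* T) (ℕ→ℚ-* c 2) ⟨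
    ℕ→ℚ (c * 2) ℚ.* δ ℚ.* M ℚ.* T              ≤⟨ *-monoʳ-≤₀ (0≤ℕ→ℚ t) (*-monoʳ-≤₀ (0≤ℕ→ℚ m) Cδ≤e) ⟩
    e ℚ.* M ℚ.* T                              ∎)

-- A positive member c below E makes 1 a lower member of 1 + C E, after which k ≤ m is enough. Since
-- 1 < C, the number 1 is a lower member of C and c survives the product.
upper-bound : ∀ {m k} C E → 1 < C → 0 < m → k ≤ m →
  (∃ λ c → 0ℚ ℚ.< c × lower E c × ∃ λ d → c ℚ.≤ d × upper E d) →
  fromℕ k ≤ᴿ (fromℕ 1 +ᴿ fromℕ C *ᴿ E) *ᴿ fromℕ m
upper-bound {m} {k} C E 1<C 0<m k≤m (c , 0<c , c<E , d , c≤d , E<d) q q<k =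
  let (g , q<g , 0≤g , g<m) = below-m
      (p , 0<p , p<c) = ℚ.<-dense 0<c
      (r , 1-p<r , r<1) = ℚ.<-dense (subst (1ℚ ℚ.- p ℚ.<_) (ℚ.+-identityʳ 1ℚ) (ℚ.+-monoʳ-< 1ℚ (ℚ.neg-antimono-< 0<p)))
      box = (ℕ→ℚ-mono-< {1} {C} 1<C , ℕ→ℚ-mono-< {C} {suc C} ≤-refl)
      0≤d = ℚ.≤-trans (ℚ.<⇒≤ 0<c) c≤d
      v = ℕ→ℚ (suc C) ℚ.* d ℚ.+ 1ℚ
      0≤v = ℚ.≤-trans (0≤* (0≤ℕ→ℚ (suc C)) 0≤d) (ℚ.<⇒≤ (p<p+1 _))
      1≤1+C = ℕ→ℚ-mono-≤ {1} {suc C} (s≤s z≤n)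
      p<CE = lower-*-nonNeg {fromℕ C} {E} box (c<E , E<d) (0≤ℕ→ℚ 1) 1≤1+C (ℚ.<⇒≤ 0<c) c≤d
               (subst (p ℚ.<_) (sym (ℚ.*-identityˡ c)) p<c)
      CE<v = upper-*-nonNeg {fromℕ C} {E} box (c<E , E<d) (0≤ℕ→ℚ 1) 1≤1+C (ℚ.<⇒≤ 0<c) c≤d (p<p+1 _)
  in lower-*-nonNeg
       ((r , p , r<1 , p<CE , a-c<b⇒a<b+c {1ℚ} {r} {p} 1-p<r) ,
        (ℕ→ℚ 2 , v , ℕ→ℚ-mono-< {1} {2} ≤-refl , CE<v , p<p+1 (ℕ→ℚ 2 ℚ.+ v)))
       (g<m , ℕ→ℚ-mono-< {m} {suc m} ≤-refl)
       (0≤ℕ→ℚ 1)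
       (ℚ.≤-trans (ℚ.≤-trans (ℚ.≤-reflexive (sym (ℚ.+-identityʳ 1ℚ))) (ℚ.+-mono-≤ (ℕ→ℚ-mono-≤ {1} {2} (s≤s z≤n)) 0≤v)) (ℚ.<⇒≤ (p<p+1 _)))
       0≤g (ℚ.<⇒≤ (ℚ.<-trans g<m (ℕ→ℚ-mono-< {m} {suc m} ≤-refl)))
       (subst (q ℚ.<_) (sym (ℚ.*-identityˡ g)) q<g)
  where
  below-m : ∃ λ g → q ℚ.< g × 0ℚ ℚ.≤ g × g ℚ.< ℕ→ℚ m
  below-m with q ℚ.<? 0ℚ
  ... | yes q<0 = 0ℚ , q<0 , ℚ.≤-refl , ℕ→ℚ-mono-< {0} {m} 0<m
  ... | no q≮0  = let (g , q<g , g<m) = ℚ.<-dense (ℚ.<-≤-trans q<k (ℕ→ℚ-mono-≤ {k} {m} k≤m)) in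
    g , q<g , ℚ.≤-trans (ℚ.≮⇒≥ q≮0) (ℚ.<⇒≤ q<g) , g<m

-- Large m and the choice of all parameters

1+inv≤2 : ∀ n → 1ℚ ℚ.+ inv n ℚ.≤ ℕ→ℚ 2
1+inv≤2 n = ℚ.+-monoʳ-≤ 1ℚ (begin
  inv n                        ≡⟨ ℚ.*-identityˡ (inv n) ⟨
  1ℚ ℚ.* inv n                 ≤⟨ *-monoʳ-≤₀ (0≤inv n) (ℕ→ℚ-mono-≤ {1} {suc n} (s≤s z≤n)) ⟩
  ℕ→ℚ (suc n) ℚ.* inv n        ≡⟨ suc*inv n ⟩
  1ℚ                           ∎)
  where open ℚ.≤-Reasoning

-- As β ≤ 2, powers of β cannot pass l before powers of 2 do, which gives J ≤ j. The search ends by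
-- (n + 1) l because β^(n + 1) ≥ 2.
floor-log : ∀ n {l} J → 1 ≤ l → 2 ^ J ≤ l →
  ∃ λ j → J ≤ j × (1ℚ ℚ.+ inv n) ^ℚ j ℚ.≤ ℕ→ℚ l × ℕ→ℚ l ℚ.< (1ℚ ℚ.+ inv n) ^ℚ suc j
floor-log n {l} J 1≤l 2^J≤l =
  let (j , _ , β^j≤l , ≰l) = last (λ j → β ^ℚ j ℚ.≤? ℕ→ℚ l) (ℕ→ℚ-mono-≤ {1} {l} 1≤l) (suc n * l)
        (λ ≤l → ℚ.<-irrefl refl (ℚ.<-≤-trans (ℕ→ℚ-mono-< {l} {2 ^ l} (n<2^n l)) (ℚ.≤-trans (2^k≤[1+inv]^ n l) ≤l)))
      l<β^1+j = ℚ.≰⇒> ≰l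
  in j , ≮⇒≥ (λ j<J → ℚ.<-irrefl refl (begin-strict
       ℕ→ℚ l                 <⟨ l<β^1+j ⟩
       β ^ℚ suc j            ≤⟨ ^ℚ-mono-≤ (suc j) (0≤1+ (0≤inv n)) (1+inv≤2 n) ⟩
       ℕ→ℚ 2 ^ℚ suc j        ≡⟨ ℕ→ℚ-^ 2 (suc j) ⟨
       ℕ→ℚ (2 ^ suc j)       ≤⟨ ℕ→ℚ-mono-≤ {2 ^ suc j} {l} (≤-trans (^-monoʳ-≤ 2 j<J) 2^J≤l) ⟩
       ℕ→ℚ l                 ∎)) , β^j≤l , l<β^1+j
  where
  open ℚ.≤-Reasoning
  β = 1ℚ ℚ.+ inv n

size-of : ∀ m L → 120 ≤ L → 2 ^ L ≤ m → ∃₂ λ l X → Size m l X × L ≤ l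
size-of m L 120≤L 2^L≤m =
  let (l , _ , 2^l≤m , 2^1+l≰m) = last (λ l → 2 ^ l ≤? m) 1≤m m (<⇒≱ (n<2^n m))
      (X , _ , X²≤m , [1+X]²≰m) = last (λ X → X * X ≤? m) z≤n (suc m) (<⇒≱ (m≤m*n (suc m) (suc m)))
      L≤l = s≤s⁻¹ (≰⇒> λ l<L → 2^1+l≰m (≤-trans (^-monoʳ-≤ 2 l<L) 2^L≤m))
  in l , X , record { 2^l≤m = 2^l≤m ; m<2^1+l = ≰⇒> 2^1+l≰m ; X²≤m = X²≤m ; m<[1+X]² = ≰⇒> [1+X]²≰m ; 120≤l = ≤-trans 120≤L L≤l } , L≤l
  where
  1≤m : 1 ≤ m
  1≤m = ≤-trans (m^n>0 2 L) 2^L≤m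

Bounds : Cut → ℕ → ℕ → ℤ → Set
Bounds ε C m S =
  let error = fromℕ C *ᴿ logᴿ (fromℕ m) ^ᴿ (-ᴿ ε) in
  ((fromℕ 1 -ᴿ error) *ᴿ fromℕ m) ≤∣ ProductResidues ε m S ∣ ×
  ∣ ProductResidues ε m S ∣≤ ((fromℕ 1 +ᴿ error) *ᴿ fromℕ m)

-- With n = 17 + i this is (1 + ε₂) w₂ < (3/2 + ε₁) w₁.
slack : ∀ {i} n k → n ≡ 17 + i → let N = suc n in suc N * (3 + 6 * N) ≤ k →
        let w₁ = ℕ→ℚ k ℚ.* inv N
            w₂ = ℕ→ℚ (2 + (N * 3 + (N * 3 + suc k))) ℚ.* inv n
        in sixteenths (2 + i) ℚ.* w₂ ℚ.+ w₂ ℚ.< sixteenths (24 + i) ℚ.* w₁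
slack {i} n k n≡ large = begin-strict
  sixteenths (2 + i) ℚ.* w₂ ℚ.+ w₂                    ≡⟨ factor (sixteenths (2 + i)) w₂ ⟩
  (sixteenths 16 ℚ.+ sixteenths (2 + i)) ℚ.* w₂
    -- Since N = 16 + (2 + i), the coefficient 1 + ε₂ is exactly N / 16 and cancels the 1 / N in w₂;
    -- likewise 3/2 + ε₁ is (6 + N) / 16. This is the origin of 17 + i.
    ≡⟨ cong (ℚ._* w₂) (trans (cong sixteenths (cong suc n≡)) (sixteenths-+ 16 (2 + i))) ⟨
  sixteenths N ℚ.* w₂                                 ≡⟨ regroup₁ (ℕ→ℚ N) (inv 15) (ℕ→ℚ H) (inv n) ⟩
  ℕ→ℚ N ℚ.* inv n ℚ.* (ℕ→ℚ H ℚ.* inv 15)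
    ≡⟨ cong (ℚ._* (ℕ→ℚ H ℚ.* inv 15)) (trans (suc*inv n) (sym (suc*inv N))) ⟩
  ℕ→ℚ (suc N) ℚ.* inv N ℚ.* (ℕ→ℚ H ℚ.* inv 15)
    ≡⟨ regroup₂ (ℕ→ℚ (suc N)) (inv N) (ℕ→ℚ H) (inv 15) ⟩
  ℕ→ℚ (suc N) ℚ.* ℕ→ℚ H ℚ.* (inv N ℚ.* inv 15)
    ≡⟨ cong (ℚ._* (inv N ℚ.* inv 15)) (ℕ→ℚ-* (suc N) H) ⟨
  ℕ→ℚ (suc N * H) ℚ.* (inv N ℚ.* inv 15)
    <⟨ *-monoʳ-<₀ (0<* (inv-pos N) (inv-pos 15)) (ℕ→ℚ-mono-< {suc N * H} {(6 + N) * k} naturals) ⟩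
  ℕ→ℚ ((6 + N) * k) ℚ.* (inv N ℚ.* inv 15)
    ≡⟨ cong (ℚ._* (inv N ℚ.* inv 15)) (ℕ→ℚ-* (6 + N) k) ⟩
  ℕ→ℚ (6 + N) ℚ.* ℕ→ℚ k ℚ.* (inv N ℚ.* inv 15)
    ≡⟨ regroup₃ (ℕ→ℚ (6 + N)) (ℕ→ℚ k) (inv N) (inv 15) ⟩
  sixteenths (6 + N) ℚ.* (ℕ→ℚ k ℚ.* inv N)
    ≡⟨ cong (λ n → sixteenths (7 + n) ℚ.* (ℕ→ℚ k ℚ.* inv N)) n≡ ⟩
  sixteenths (24 + i) ℚ.* (ℕ→ℚ k ℚ.* inv N)           ∎
  where
  open ℚ.≤-Reasoning
  N = suc n
  H = 2 + (N * 3 + (N * 3 + suc k))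
  w₂ = ℕ→ℚ H ℚ.* inv n

  factor : ∀ a w → a ℚ.* w ℚ.+ w ≡ (1ℚ ℚ.+ a) ℚ.* w
  factor = Solver.solve-∀ ℚ-ring
  regroup₁ : ∀ a b c d → a ℚ.* b ℚ.* (c ℚ.* d) ≡ a ℚ.* d ℚ.* (c ℚ.* b)
  regroup₁ = Solver.solve-∀ ℚ-ring
  regroup₂ : ∀ a b c d → a ℚ.* b ℚ.* (c ℚ.* d) ≡ a ℚ.* c ℚ.* (b ℚ.* d)
  regroup₂ = Solver.solve-∀ ℚ-ring
  regroup₃ : ∀ a b c d → a ℚ.* b ℚ.* (c ℚ.* d) ≡ a ℚ.* d ℚ.* (b ℚ.* c)
  regroup₃ = Solver.solve-∀ ℚ-ring

  expand : ∀ N k → suc N * (2 + (N * 3 + (N * 3 + suc k))) ≡ suc N * (3 + 6 * N) + suc N * k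
  expand = solve-∀
  expand′ : ∀ N k → k + suc N * k + 4 * k ≡ (6 + N) * k
  expand′ = solve-∀

  -- The right side exceeds (N + 1) k by 5 k; one of these k absorbs the part of (N + 1) H that does
  -- not grow with k.
  naturals : suc N * H < (6 + N) * k
  naturals = ≤-Reasoning.begin-strict
    suc N * H                              ≤-Reasoning.≡⟨ expand N k ⟩
    suc N * (3 + 6 * N) + suc N * k        ≤-Reasoning.≤⟨ +-monoˡ-≤ (suc N * k) large ⟩
    k + suc N * k
      ≤-Reasoning.<⟨ m<m+n (k + suc N * k) (*-mono-< {0} {4} (s≤s z≤n) (<-≤-trans (s≤s z≤n) large)) ⟩
    k + suc N * k + 4 * k                  ≤-Reasoning.≡⟨ expand′ N k ⟩
    (6 + N) * k                            ≤-Reasoning.∎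


module _ {ε : Cut} (real : IsReal ε) {i : ℕ}
  (ε₁<ε : lower ε (sixteenths i)) (ε<ε₂ : upper ε (sixteenths (2 + i)))
  (n : ℕ) (n≡17+i : n ≡ 17 + i) where

  N : ℕ
  N = suc n

  bounds : ∀ {m l X} k → Size m l X → suc N * (3 + 6 * N) ≤ k →
    (1ℚ ℚ.+ inv n) ^ℚ (N * 3 + suc k) ℚ.≤ ℕ→ℚ l →
    ℕ→ℚ l ℚ.< (1ℚ ℚ.+ inv n) ^ℚ suc (N * 3 + suc k) → ∀ S → Bounds ε 3072 m S
  bounds {m} {l} {X} k size large β^j≤l l<β^1+j S = from-scale (scale h {l} l≤compound (slack n k n≡17+i large))
    where
    open Size size
    open LogLog {m} {l} n k (≤-trans (m≤m+n 5 115) 120≤l) 2^l≤m m<2^1+l β^j≤l l<β^1+j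
      using (h; l≤compound; loglog-lower; loglog-upper)
    loglog = logᴿ (logᴿ (fromℕ m))
    -- By definition of `_^ᴿ_`, these two cuts are (log m)^(2 + ε) and (log m)^(-ε) themselves.
    E₊ = expᴿ ((fromℕ 2 +ᴿ ε) *ᴿ loglog)
    E₋ = expᴿ ((-ᴿ ε) *ᴿ loglog)
    open Exponents ε loglog i ε₁<ε ε<ε₂ (λ c<ε → lower<upper real c<ε ε<ε₂)
      loglog-lower loglog-upper (λ c< → log-log-< c< loglog-upper) (λ <d → log-log-< loglog-lower <d)
      (0<* {ℕ→ℚ k} {inv (suc n)} (ℕ→ℚ-mono-< {0} {k} (<-≤-trans (s≤s z≤n) large)) (inv-pos (suc n)))
      using (scale; upper-2+ε; lower-neg-ε; upper-neg-ε)

    from-products : ∀ {t} → NonZero t → (∀ d → upper E₋ d → ℕ→ℚ l ℚ.≤ ℕ→ℚ 2 ℚ.* (d ℚ.* ℕ→ℚ t)) →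
      (∃₂ λ a U → Distinct (ProductResidues ε m S) a × m ≤ a + U × U * t ≤ 1536 * l * m) → Bounds ε 3072 m S
    from-products {t} t≢0 E₋-large (a , U , list , m≤ , Ut≤) =
      -- 3072 = 2 · 1536, the 2 coming from t + 1 ≤ 2 t in `scale`.
      (a , list , lower-bound {m} {a} {U} {t} {l} 1536 E₋ {{t≢0}} m≤ Ut≤ λ d E₋<d →
        upper-exp-pos {(-ᴿ ε) *ᴿ loglog} {d} E₋<d , E₋-large d E₋<d) ,
      λ b (f , f-inj , _) → upper-bound {m} {b} 3072 E₋ (s≤s (s≤s z≤n)) (>-nonZero⁻¹ m {{m≢0 size}}) (injective⇒≤ f-inj)
        (let (c , 0<c , c<E₋) = lower-exp-pos {(-ᴿ ε) *ᴿ loglog} (proj₂ lower-neg-ε)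
         in c , 0<c , c<E₋ , upper-exp-above {(-ᴿ ε) *ᴿ loglog} c (proj₂ upper-neg-ε))

    from-scale : (∃₂ λ t t′ → NonZero t × ℕ→ℚ t ℚ.< t′ × lower E₊ t′ ×
                   (∀ d → upper E₋ d → ℕ→ℚ l ℚ.≤ ℕ→ℚ 2 ℚ.* (d ℚ.* ℕ→ℚ t))) → Bounds ε 3072 m S
    from-scale (t , t′ , t≢0 , t<t′ , t′<E₊ , E₋-large) = from-products t≢0 E₋-large
      (many-products {m} {l} {X} size t {{t≢0}} ε S (λ {x} x≤X → ≤√ {x} {X} {m} x≤X X²≤m)
        (≤S+√m*E {m} {X} {t} {t′} {E₊} S {{X≢0 size}} X²≤m t<t′ t′<E₊
          (upper-exp-above {(fromℕ 2 +ᴿ ε) *ᴿ loglog} t′ (proj₂ upper-2+ε))))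

  -- J adds the least k that `slack` admits to the 3 N + 1 factors β that `LogLog` sets apart. It is
  -- reached once l ≥ 2^J, and l is about log₂ m, so the threshold for m is doubly exponential in J.
  bounds-eventually : ∀ J L → J ≡ suc N * (3 + 6 * N) + suc (N * 3) → 120 ≤ L → 2 ^ J ≤ L →
    ∀ m → 2 ^ L ≤ m → ∀ S → Bounds ε 3072 m S
  bounds-eventually J L J≡ 120≤L 2^J≤L m 2^L≤m S = from-size (size-of m L 120≤L 2^L≤m)
    where
    a = suc N * (3 + 6 * N)
    b = suc (N * 3)

    from-floor : ∀ {l X} → Size m l X → (∃ λ j → J ≤ j × (1ℚ ℚ.+ inv n) ^ℚ j ℚ.≤ ℕ→ℚ l × ℕ→ℚ l ℚ.< (1ℚ ℚ.+ inv n) ^ℚ suc j) →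
      Bounds ε 3072 m S
    from-floor {l} size (j , J≤j , β^j≤l , l<β^1+j) = bounds (j ∸ b) size (m+n≤o⇒m≤o∸n a a+b≤j)
      (subst (λ j → (1ℚ ℚ.+ inv n) ^ℚ j ℚ.≤ ℕ→ℚ l) j≡ β^j≤l)
      (subst (λ j → ℕ→ℚ l ℚ.< (1ℚ ℚ.+ inv n) ^ℚ suc j) j≡ l<β^1+j) S
      where
      a+b≤j : a + b ≤ j
      a+b≤j = subst (_≤ j) J≡ J≤j
      j≡ : j ≡ N * 3 + suc (j ∸ b)
      j≡ = sym (trans (+-suc (N * 3) (j ∸ b)) (m+[n∸m]≡n (m+n≤o⇒n≤o a a+b≤j)))

    from-size : (∃₂ λ l X → Size m l X × L ≤ l) → Bounds ε 3072 m S
    from-size (l , X , size , L≤l) = from-floor size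
      (floor-log n {l} J (≤-trans (s≤s z≤n) (Size.120≤l size)) (≤-trans 2^J≤L L≤l))

Eventually : Cut → Set
Eventually ε = ∃₂ λ C m₀ → ∀ m → m₀ ≤ m → ∀ S → Bounds ε C m S

eventually : ∀ {ε} → IsReal ε → (∃ λ i → lower ε (sixteenths i) × upper ε (sixteenths (2 + i))) → Eventually ε
eventually {ε} real (i , ε₁<ε , ε<ε₂) = with-n (17 + i) refl
  where
  with-L : ∀ n J L → n ≡ 17 + i → J ≡ suc (suc n) * (3 + 6 * suc n) + suc (suc n * 3) → 120 ≤ L → 2 ^ J ≤ L → Eventually ε
  with-L n J L n≡ J≡ 120≤L 2^J≤L = 3072 , 2 ^ L , bounds-eventually real ε₁<ε ε<ε₂ n n≡ J L J≡ 120≤L 2^J≤L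

  with-J : ∀ n J → n ≡ 17 + i → J ≡ suc (suc n) * (3 + 6 * suc n) + suc (suc n * 3) → Eventually ε
  with-J n J n≡ J≡ = with-L n J (2 ^ J + 120) n≡ J≡ (m≤n+m 120 _) (m≤m+n _ 120)

  with-n : ∀ n → n ≡ 17 + i → Eventually ε
  with-n n n≡ = with-J n (suc (suc n) * (3 + 6 * suc n) + suc (suc n * 3)) n≡ refl

corollary4 : (ε : Cut) → IsReal ε → fromℕ 0 <ᴿ ε →
    ∃₂ λ (C m₀ : ℕ) → (m : ℕ) → m₀ ≤ m → (S : ℤ) →
    let error = fromℕ C *ᴿ logᴿ (fromℕ m) ^ᴿ (-ᴿ ε) in
    ((fromℕ 1 -ᴿ error) *ᴿ fromℕ m) ≤∣ ProductResidues ε m S ∣ ×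
    ∣ ProductResidues ε m S ∣≤ ((fromℕ 1 +ᴿ error) *ᴿ fromℕ m)
corollary4 ε real 0<ε = eventually real (grid real 0<ε)
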